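{- There is an absolute constant $C>0$ such that the following holds. Let $\mathcal{A}=\mathrm{Greedy}_3$ (the greedy algorithm using contraction Rule 3) and let $\mathcal{I}$ be an instance of online Steiner Forest with graph $G$ and $k\ge 3$ pairs $p_1=\{s_1,t_1\},\dots,p_k=\{s_k,t_k\}$ in order of arrival. Denote by $c_i$ the cost paid by $\mathcal{A}$ when connecting pair $p_i$, and let $d_i=d_G(s_i,t_i)$ be the distance in the original graph $G$. If either of the two sequences $(c_1,c_2,\dots,c_k)$ or $(d_1,d_2,\dots,d_k)$ is non-increasing, then $$\mathrm{cost}_{\mathcal{A}}(\mathcal{I})\le C\cdot\log(k)\,\log\log(k)\cdot w(\mathrm{OPT}(\mathcal{I})).$$
   Context: Logarithms are in base 2. Online Steiner Forest. An instance $\mathcal{I}$ consists of a finite undirected weighted graph $G=(V,E,w)$ with $w:E\to\mathbb{R}_{\ge 0}$ and an ordered sequence $\mathcal{P}=(p_1,\dots,p_k)$ of pairs $p_i=\{s_i,t_i\}$ of vertices (lying in the same connected component of $G$), revealed one by one. $w(\mathrm{OPT}(\mathcal{I}))$ is the minimum total weight of a subgraph (forest) of $G$ in which $s_i$ and $t_i$ are connected for every $i$. $\mathrm{Greedy}_3$. The algorithm maintains graphs $G^{(\tau)}=(V,E\cup S^{(\tau)})$, where $S^{(0)}=\emptyset$ and $S^{(0)}\subseteq S^{(1)}\subseteq\cdots\subseteq S^{(k)}$ are sets of edges of weight $0$ on $V$ called shortcuts. When pair $p_{\tau+1}=\{s,t\}$ arrives, the algorithm takes a shortest $s$–$t$ path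 in $G^{(\tau)}$ (ties broken arbitrarily) and pays $c_{\tau+1}=d_{G^{(\tau)}}(s,t)$, its length. Then Rule 3 is applied: let $s=v'_0,v'_1,\dots,v'_{\ell'},v'_{\ell'+1}=t$ be the subsequence of the path consisting of $s$, $t$ and those path vertices that appeared in a previously arrived pair; $S^{(\tau+1)}$ is $S^{(\tau)}$ together with a weight-0 edge $\{v'_j,v'_{j+1}\}$ for all $0\le j\le\ell'$. $\mathrm{cost}_{\mathcal{A}}(\mathcal{I})=\sum_{i=1}^k c_i$. -}

module Defs where

open import Algebra.Bundles using (CommutativeRing; Semiring)
open import Data.Fin.Base using (Fin)
import Data.Fin.Properties as Fin
open import Data.List.Base using (List; []; _∷_; [_]; _++_; map; foldr; filter; zip; drop)
open import Data.List.Membership.Propositional using (_∈_)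
open import Data.List.Relation.Binary.Sublist.Propositional using (_⊆_)
open import Data.List.Relation.Unary.All using (All)
open import Data.List.Relation.Unary.Unique.Propositional using (Unique)
open import Data.Nat.Base using (ℕ; suc)
open import Data.Product.Base using (Σ; ∃; _×_; _,_; uncurry)
open import Data.Sum.Base using (_⊎_)
open import Data.Vec.Base as Vec using (Vec; []; _∷_)
import Data.Vec.Relation.Binary.Pointwise.Inductive as Pointwise
import Data.Vec.Relation.Unary.All as VecAll
import Data.Vec.Relation.Unary.Linked as VecLinked
open import Level using (0ℓ) renaming (suc to lsuc)
open import Relation.Binary.Core using (Rel)
open import Relation.Binary.PropositionalEquality using (_≡_)
open import Relation.Binary.Structures using (IsDecTotalOrder)
open import Relation.Nullary using (¬_)
import Algebra.Definitions.RawSemiring as RawSemiringDefinitions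
import Data.List.Membership.DecPropositional as DecMembership

-- The classical real numbers, given axiomatically as a complete ordered field;
-- these axioms determine them up to isomorphism. The order is decidable, as it
-- is classically. `sup` is a total function: its value is constrained only on
-- nonempty predicates that are bounded above and is arbitrary elsewhere.

record RealNumbers : Set (lsuc 0ℓ) where
  field
    commutativeRing : CommutativeRing 0ℓ 0ℓ

  open CommutativeRing commutativeRing public

  infix 4 _≤_ _<_

  field
    _≤_             : Rel Carrier 0ℓ
    isDecTotalOrder : IsDecTotalOrder _≈_ _≤_
    0≉1             : ¬ (0# ≈ 1#)
    inverse         : ∀ x → ¬ (x ≈ 0#) → ∃ λ y → x * y ≈ 1#
    +-monoʳ-≤       : ∀ z {x y} → x ≤ y → z + x ≤ z + y
    *-nonNegative   : ∀ {x y} → 0# ≤ x → 0# ≤ y → 0# ≤ x * y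

  IsUpperBound : (Carrier → Set) → Carrier → Set
  IsUpperBound P b = ∀ x → P x → x ≤ b

  field
    sup             : (Carrier → Set) → Carrier
    sup-upperBound  : ∀ P → ∃ P → ∃ (IsUpperBound P) → IsUpperBound P (sup P)
    sup-least       : ∀ P → ∃ P → ∀ b → IsUpperBound P b → sup P ≤ b

  _<_ : Rel Carrier 0ℓ
  x < y = (x ≤ y) × ¬ (x ≈ y)

  open RawSemiringDefinitions (Semiring.rawSemiring semiring) using (_^_) renaming (_×_ to _·_)

  fromℕ : ℕ → Carrier
  fromℕ n = n · 1#

  -- For x > 0, log₂ x is the supremum of the rationals r = (a - b) / q, q ≥ 1,
  -- with 2 ^ r ≤ x; the inequality is raised to the power q and multiplied
  -- by 2 ^ b. The value for x ≤ 0 is meaningless.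
  log₂ : Carrier → Carrier
  log₂ x = sup λ r → Σ ℕ λ a → Σ ℕ λ b → Σ ℕ λ q-1 →
    (fromℕ (suc q-1) * r ≈ fromℕ a - fromℕ b) ×
    (fromℕ 2 ^ a ≤ fromℕ 2 ^ b * x ^ suc q-1)

module SteinerForest (R : RealNumbers) where
  open RealNumbers R renaming (Carrier to ℝ)

  -- The vertex set is Fin n. An edge is undirected: the order of its two ends
  -- is irrelevant, see `Joins`.
  record Edge (n : ℕ) : Set where
    constructor edge
    field
      end₁ end₂ : Fin n
      weight    : ℝ

  open Edge public

  -- A finite family of edges; parallel edges and loops are allowed, since
  -- a shortcut may be parallel to an edge of the original graph.
  Edges : ℕ → Set
  Edges n = List (Edge n)

  record Graph (n : ℕ) : Set where
    field
      edges       : Edges n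
      nonNegative : All (λ e → 0# ≤ weight e) edges

  open Graph public

  totalWeight : ∀ {n} → Edges n → ℝ
  totalWeight E = foldr _+_ 0# (map weight E)

  Joins : ∀ {n} → Edge n → Fin n → Fin n → Set
  Joins e u v = (end₁ e ≡ u × end₂ e ≡ v) ⊎ (end₁ e ≡ v × end₂ e ≡ u)

  data Walk {n : ℕ} (E : Edges n) : Fin n → Fin n → Set where
    stop : ∀ {u} → Walk E u u
    step : ∀ {u v t} (e : Edge n) → e ∈ E → Joins e u v → Walk E v t → Walk E u t

  Connected : ∀ {n} → Edges n → Fin n → Fin n → Set
  Connected E s t = Walk E s t

  vertices : ∀ {n} {E : Edges n} {s t} → Walk E s t → List (Fin n)
  vertices {s = s} stop           = [ s ]
  vertices {s = s} (step _ _ _ p) = s ∷ vertices p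

  length : ∀ {n} {E : Edges n} {s t} → Walk E s t → ℝ
  length stop           = 0#
  length (step e _ _ p) = weight e + length p

  IsPath : ∀ {n} {E : Edges n} {s t} → Walk E s t → Set
  IsPath p = Unique (vertices p)

  IsShortestPath : ∀ {n} {E : Edges n} {s t} → Walk E s t → Set
  IsShortestPath {E = E} {s} {t} p =
    IsPath p × (∀ (q : Walk E s t) → IsPath q → length p ≤ length q)

  IsDistance : ∀ {n} → Edges n → Fin n → Fin n → ℝ → Set
  IsDistance E s t d =
    Σ (Walk E s t) λ p → IsShortestPath p × d ≈ length p

  record Instance (n k : ℕ) : Set where
    field
      graph     : Graph n
      pairs     : Vec (Fin n × Fin n) k
      connected : VecAll.All (uncurry (Connected (edges graph))) pairs

  open Instance public

  Feasible : ∀ {n k} → Instance n k → Edges n → Set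
  Feasible I F =
    (F ⊆ edges (graph I)) × VecAll.All (uncurry (Connected F)) (pairs I)

  IsOPT : ∀ {n k} → Instance n k → Edges n → Set
  IsOPT I F = Feasible I F × (∀ F′ → Feasible I F′ → totalWeight F ≤ totalWeight F′)

  shortcut : ∀ {n} → Fin n × Fin n → Edge n
  shortcut (u , v) = edge u v 0#

  -- The shortcuts added for a path p from s to t, where `seen` lists the
  -- vertices of the previously arrived pairs: one between any two consecutive
  -- members of the subsequence of p formed by s, t and the vertices in `seen`.
  rule₃ : ∀ {n} {E : Edges n} {s t} → List (Fin n) → Walk E s t → Edges n
  rule₃ {n} {s = s} {t} seen p = map shortcut (zip marked (drop 1 marked))
    where
    open DecMembership (Fin._≟_ {n}) using (_∈?_)
    marked : List (Fin n)
    marked = filter (_∈? (s ∷ t ∷ seen)) (vertices p)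

  -- Greedy₃ E seen S ps cs: starting from shortcuts S and already seen
  -- vertices `seen`, some resolution of the ties makes the algorithm serve the
  -- remaining pairs ps at the respective costs cs.
  data Greedy₃ {n : ℕ} (E : Edges n) (seen : List (Fin n)) (S : Edges n)
       : ∀ {k} → Vec (Fin n × Fin n) k → Vec ℝ k → Set where
    done  : Greedy₃ E seen S [] []
    serve : ∀ {k s t} {ps : Vec (Fin n × Fin n) k} {cs : Vec ℝ k}
            (p : Walk (E ++ S) s t) → IsShortestPath p →
            Greedy₃ E (s ∷ t ∷ seen) (rule₃ seen p ++ S) ps cs →
            Greedy₃ E seen S ((s , t) ∷ ps) (length p ∷ cs)

  IsGreedy₃Run : ∀ {n k} → Instance n k → Vec ℝ k → Set
  IsGreedy₃Run I cs = Greedy₃ (edges (graph I)) [] [] (pairs I) cs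

  AreDistances : ∀ {n k} → Instance n k → Vec ℝ k → Set
  AreDistances I ds =
    Pointwise.Pointwise (uncurry (IsDistance (edges (graph I)))) (pairs I) ds

  NonIncreasing : ∀ {k} → Vec ℝ k → Set
  NonIncreasing = VecLinked.Linked (λ x y → y ≤ x)

  cost : ∀ {k} → Vec ℝ k → ℝ
  cost = Vec.foldr′ _+_ 0#

{-# OPTIONS --safe #-}

-- Cut the path that serves a pair at the terminals seen so far. A piece between two of them that is
-- not a shortcut (a segment) is a path of the original graph, so the cost of the run is the total
-- length of the segments. By monotonicity every terminal on the path has its mate at distance at
-- least the length of the segment, hence in OPT it lies on a tour at least that long.
--
-- Each segment σ carries a potential ψ σ, the greedy distance at its arrival clamped to σ: it is
-- 1-Lipschitz in the original graph, increases by the length of σ along σ, and does not change along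
-- the segments of smaller priority (older ones, and those later on the same path). Consequently a
-- cycle of segments of length about D whose consecutive ends are close has total gap at least D.
--
-- Fix a level, i.e. the segments of length about D = 2^i, and write κ(u,ρ) for the total length of
-- the segments with an end within ρ of u. Cluster the ends around picked terminals u with radius
-- δ(u) ≈ D / 64 g(u), where κ(u,ρ) < 2^g(u) D for a radius ρ = D polylog(k). If there were more than
-- two segments per cluster, a subgraph of minimum degree three would contain 2^g(u) nonbacktracking
-- walks of length g(u) from some u with distinct last segments, contradicting the choice of g(u).
--
-- So a level costs at most 4 D per pick. A pick with κ(u,2δ(u)) ≥ polylog(k) D is absorbed by the
-- total cost. Any other pick is charged to an interval of length δ(u) of the tours of OPT, at density
-- O(g(u)). If a point of the tours is charged at levels i < j at least s = O(log log k) apart, the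
-- small κ at level j bounds the large κ at level i, so g at level i is O(log log k) + j - i. On each
-- residue class of levels modulo s these densities telescope, which gives O(log k log log k) per point.

module Submission where

open import Defs
open import Data.Nat.Base as ℕ using (ℕ)
open import Data.Product.Base using (Σ; _×_)
open import Data.Sum.Base using (_⊎_)
open import Data.Vec.Base using (Vec)

-- The core is a Moore-type bound: short closed walks cannot exist in the cluster graph, so a dense
-- one expands exponentially. The obstacle is a closed walk that traverses its top-priority segment
-- in both directions, about which the potential of that segment says nothing; but the part between
-- the two traversals is again closed and shorter, so an induction disposes of it. The bound has a
-- price: about 2 g hops must add up to less than D, which forces clusters of radius about D / g,
-- and the interval of the tours that a pick owns is too short by a factor g. Since g can be of
-- order log k, adding up the levels separately would give only log² k; the saving comes from
-- comparing levels. There a ball of radius D polylog(k) must fit into a cluster of the higher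
-- level, so only levels sufficiently far apart can be compared. Lengths are integer multiples of a
-- unit, with OPT a polynomial number of units: pieces below a polynomial threshold together cost at
-- most OPT, O(log k) levels remain, and balls, potentials and intervals become finite and
-- decidable.

module Combinatorics where

  open import Data.Bool.Base using (Bool; true; false; if_then_else_; not)
  import Data.Bool.Properties as Bool
  open import Data.Empty using (⊥)
  open import Data.Fin.Base as Fin using (Fin; toℕ)
  import Data.Fin.Properties as Fin
  open import Data.List.Base as List using (List; []; _∷_; _++_; map; filter; length; allFin; upTo; applyUpTo)
  open import Data.List.Membership.Propositional using (_∈_; lose; find)
  open import Data.List.Membership.Propositional.Properties
    using (∈-∃++; ∈-++⁻; ∈-++⁺ˡ; ∈-++⁺ʳ; ∈-filter⁺; ∈-filter⁻; ∈-map⁺; ∈-map⁻; ∈-allFin; ∈-upTo⁺)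
  open import Data.List.Properties
    using (length-++; filter-notAll; length-map; length-applyUpTo; map-∘; map-upTo)
  open import Data.List.Relation.Unary.All as All using (All; []; _∷_)
  import Data.List.Relation.Unary.All.Properties as All
  open import Data.List.Relation.Unary.AllPairs as AllPairs using (AllPairs; []; _∷_)
  import Data.List.Relation.Unary.AllPairs.Properties as AllPairs
  open import Data.List.Relation.Unary.Any as Any using (Any; here; there)
  open import Data.List.Relation.Unary.Linked as Linked using (Linked; []; [-]; _∷_)
  open import Data.List.Relation.Unary.Unique.Propositional using (Unique)
  import Data.List.Relation.Unary.Unique.Propositional.Properties as Unique
  open import Data.Nat
  open import Data.Nat.DivMod using (_/_; m/n*n≤m; /-monoˡ-≤; m*n/n≡m; m≥n⇒m/n>0; m≡m%n+[m/n]*n; m%n<n)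
  open import Data.Nat.ListAction using (sum)
  open import Data.Nat.Properties
  open import Data.Nat.Solver using (module +-*-Solver)
  open import Data.Product.Base using (∃; _,_; proj₁; proj₂)
  open import Data.Product.Properties using (≡-dec)
  open import Data.Sum.Base using (inj₁; inj₂)
  open import Function.Base using (_∘_; id; case_of_)
  open import Relation.Binary.PropositionalEquality hiding ([_])
  open import Relation.Nullary using (¬_; Dec; yes; no; does; contradiction)
  open import Relation.Nullary.Decidable using (_×-dec_; _⊎-dec_; ¬?)
  open import Relation.Unary using (Decidable)
  open import Algebra.Properties.CommutativeSemigroup +-commutativeSemigroup using (interchange)

  -- Finite sums over lists, extremal elements and chains.

  ∑ : {A : Set} → List A → (A → ℕ) → ℕ
  ∑ xs f = sum (map f xs)

  ⟦_⟧ : {P : Set} → Dec P → ℕ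
  ⟦ d ⟧ = if does d then 1 else 0

  module _ {A : Set} where

    ∑-mono : ∀ (xs : List A) {f g : A → ℕ} → (∀ {x} → x ∈ xs → f x ≤ g x) → ∑ xs f ≤ ∑ xs g
    ∑-mono []       h = z≤n
    ∑-mono (x ∷ xs) h = +-mono-≤ (h (here refl)) (∑-mono xs (h ∘ there))

    ∑-cong : ∀ (xs : List A) {f g : A → ℕ} → (∀ {x} → x ∈ xs → f x ≡ g x) → ∑ xs f ≡ ∑ xs g
    ∑-cong []       h = refl
    ∑-cong (x ∷ xs) h = cong₂ _+_ (h (here refl)) (∑-cong xs (h ∘ there))

    ∑-+ : ∀ (xs : List A) (f g : A → ℕ) → ∑ xs (λ x → f x + g x) ≡ ∑ xs f + ∑ xs g
    ∑-+ []       f g = refl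
    ∑-+ (x ∷ xs) f g rewrite ∑-+ xs f g = interchange (f x) (g x) (∑ xs f) (∑ xs g)

    ∑-*ˡ : ∀ c (xs : List A) (f : A → ℕ) → ∑ xs (λ x → c * f x) ≡ c * ∑ xs f
    ∑-*ˡ c []       f = sym (*-zeroʳ c)
    ∑-*ˡ c (x ∷ xs) f rewrite ∑-*ˡ c xs f = sym (*-distribˡ-+ c (f x) (∑ xs f))

    ∑-const : ∀ c (xs : List A) → ∑ xs (λ _ → c) ≡ length xs * c
    ∑-const c []       = refl
    ∑-const c (x ∷ xs) = cong (c +_) (∑-const c xs)

    ∑-≤ : ∀ c (xs : List A) {f : A → ℕ} → (∀ {x} → x ∈ xs → f x ≤ c) → ∑ xs f ≤ length xs * c
    ∑-≤ c xs h = subst (_ ≤_) (∑-const c xs) (∑-mono xs h)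

    ∑-++ : ∀ (xs ys : List A) (f : A → ℕ) → ∑ (xs ++ ys) f ≡ ∑ xs f + ∑ ys f
    ∑-++ []       ys f = refl
    ∑-++ (x ∷ xs) ys f rewrite ∑-++ xs ys f = sym (+-assoc (f x) (∑ xs f) (∑ ys f))

    ∑-swap : ∀ {B : Set} (xs : List A) (ys : List B) (f : A → B → ℕ) →
             ∑ xs (λ x → ∑ ys (f x)) ≡ ∑ ys (λ y → ∑ xs (λ x → f x y))
    ∑-swap []       ys f = sym (zero-sum ys)
      where
      zero-sum : ∀ {B : Set} (ys : List B) → ∑ ys (λ _ → 0) ≡ 0
      zero-sum []       = refl
      zero-sum (_ ∷ ys) = zero-sum ys
    ∑-swap (x ∷ xs) ys f = trans (cong (∑ ys (f x) +_) (∑-swap xs ys f)) (sym (add ys))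
      where
      add : ∀ zs → ∑ zs (λ y → f x y + ∑ xs (λ x′ → f x′ y)) ≡
                   ∑ zs (f x) + ∑ zs (λ y → ∑ xs (λ x′ → f x′ y))
      add []       = refl
      add (z ∷ zs) rewrite add zs =
        interchange (f x z) (∑ xs (λ x′ → f x′ z)) (∑ zs (f x)) _

    ∈⇒≤∑ : ∀ {xs : List A} {x} (f : A → ℕ) → x ∈ xs → f x ≤ ∑ xs f
    ∈⇒≤∑ f (here refl) = m≤m+n _ _
    ∈⇒≤∑ f (there {y} i) = ≤-trans (∈⇒≤∑ f i) (m≤n+m _ (f y))

    ∑-⊆ : ∀ {xs ys : List A} (f : A → ℕ) → Unique xs → (∀ {x} → x ∈ xs → x ∈ ys) →
          ∑ xs f ≤ ∑ ys f
    ∑-⊆ {[]}     {ys} f _        sub = z≤n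
    ∑-⊆ {x ∷ xs} {ys} f (x∉ ∷ u) sub with ∈-∃++ (sub (here refl))
    ... | as , bs , refl = begin
      f x + ∑ xs f            ≤⟨ +-monoʳ-≤ (f x) (∑-⊆ f u sub′) ⟩
      f x + ∑ (as ++ bs) f    ≡⟨ cong (f x +_) (∑-++ as bs f) ⟩
      f x + (∑ as f + ∑ bs f) ≡⟨ +-assoc (f x) _ _ ⟨
      f x + ∑ as f + ∑ bs f   ≡⟨ cong (_+ ∑ bs f) (+-comm (f x) (∑ as f)) ⟩
      ∑ as f + f x + ∑ bs f   ≡⟨ +-assoc (∑ as f) _ _ ⟩
      ∑ as f + ∑ (x ∷ bs) f   ≡⟨ ∑-++ as (x ∷ bs) f ⟨
      ∑ (as ++ x ∷ bs) f      ∎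
      where
      open ≤-Reasoning
      sub′ : ∀ {y} → y ∈ xs → y ∈ as ++ bs
      sub′ {y} i with ∈-++⁻ as (sub (there i))
      ... | inj₁ j         = ∈-++⁺ˡ j
      ... | inj₂ (there j) = ∈-++⁺ʳ as j
      ... | inj₂ (here refl) = contradiction refl (All.lookup x∉ i)

    ∑-1 : ∀ (xs : List A) → ∑ xs (λ _ → 1) ≡ length xs
    ∑-1 xs = trans (∑-const 1 xs) (*-identityʳ _)

    length-⊆ : ∀ {xs ys : List A} → Unique xs → (∀ {x} → x ∈ xs → x ∈ ys) → length xs ≤ length ys
    length-⊆ {xs} {ys} u sub = subst₂ _≤_ (∑-1 xs) (∑-1 ys) (∑-⊆ (λ _ → 1) u sub)

    module _ {P : A → Set} (P? : Decidable P) where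

      ∑-filter : ∀ xs (f : A → ℕ) → ∑ (filter P? xs) f ≡ ∑ xs (λ x → ⟦ P? x ⟧ * f x)
      ∑-filter []       f = refl
      ∑-filter (x ∷ xs) f with P? x
      ... | yes _ = cong₂ _+_ (sym (+-identityʳ (f x))) (∑-filter xs f)
      ... | no  _ = ∑-filter xs f

      ∑-filter-length : ∀ xs → ∑ xs (λ x → ⟦ P? x ⟧) ≡ length (filter P? xs)
      ∑-filter-length xs = begin
        ∑ xs (λ x → ⟦ P? x ⟧)     ≡⟨ ∑-cong xs (λ _ → sym (*-identityʳ _)) ⟩
        ∑ xs (λ x → ⟦ P? x ⟧ * 1) ≡⟨ ∑-filter xs (λ _ → 1) ⟨
        ∑ (filter P? xs) (λ _ → 1) ≡⟨ ∑-1 (filter P? xs) ⟩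
        length (filter P? xs) ∎
        where open ≡-Reasoning

      ∑-none : ∀ xs (f : A → ℕ) → (∀ {x} → x ∈ xs → ¬ P x) → ∑ xs (λ x → ⟦ P? x ⟧ * f x) ≡ 0
      ∑-none []       f h = refl
      ∑-none (x ∷ xs) f h with P? x
      ... | yes p = contradiction p (h (here refl))
      ... | no  _ = ∑-none xs f (h ∘ there)

      ∑-atMostOne : ∀ xs (f : A → ℕ) → AllPairs (λ x y → ¬ (P x × P y)) xs →
                    (∑ xs (λ x → ⟦ P? x ⟧ * f x) ≡ 0) ⊎
                    (∃ λ x → x ∈ xs × P x × ∑ xs (λ x → ⟦ P? x ⟧ * f x) ≡ f x)
      ∑-atMostOne []       f _       = inj₁ refl
      ∑-atMostOne (x ∷ xs) f (a ∷ d) with P? x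
      ... | yes p = inj₂ (x , here refl , p ,
                      trans (cong₂ _+_ (+-identityʳ (f x))
                                       (∑-none xs f (λ i q → All.lookup a i (p , q))))
                            (+-identityʳ (f x)))
      ... | no  _ with ∑-atMostOne xs f d
      ...   | inj₁ e = inj₁ e
      ...   | inj₂ (y , i , p , e) = inj₂ (y , there i , p , e)

    argmax : ∀ (f : A → ℕ) x xs → ∃ λ y → y ∈ x ∷ xs × (∀ {z} → z ∈ x ∷ xs → f z ≤ f y)
    argmax f x []        = x , here refl , λ { (here refl) → ≤-refl }
    argmax f x (x′ ∷ xs) with argmax f x′ xs
    ... | y , i , h with f x ≤? f y
    ...   | yes p = y , there i , λ { (here refl) → p ; (there j) → h j }
    ...   | no ¬p = x , here refl , λ { (here refl) → ≤-refl
                                      ; (there j) → ≤-trans (h j) (<⇒≤ (≰⇒> ¬p)) }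

    twoOthers : ∀ {xs : List A} → (∀ (x y : A) → Dec (x ≡ y)) → Unique xs → 3 ≤ length xs → ∀ x →
                ∃ λ y → ∃ λ z → y ∈ xs × z ∈ xs × y ≢ x × z ≢ x × y ≢ z
    twoOthers {a ∷ b ∷ c ∷ _} _≟_ ((ab ∷ ac ∷ _) ∷ (bc ∷ _) ∷ _) _ x with a ≟ x | b ≟ x
    ... | yes refl | _        = b , c , there (here refl) , there (there (here refl)) ,
                                ab ∘ sym , ac ∘ sym , bc
    ... | no ax    | yes refl = a , c , here refl , there (there (here refl)) , ax , bc ∘ sym , ac
    ... | no ax    | no bx    = a , b , here refl , there (here refl) , ax , bx , ab
    twoOthers {a ∷ []}     _ _ (s≤s ())
    twoOthers {a ∷ b ∷ []} _ _ (s≤s (s≤s ()))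

    ∈∈-split : ∀ {xs : List A} {x y} → x ∈ xs → y ∈ xs → x ≢ y →
               (∃ λ as → ∃ λ bs → ∃ λ cs → xs ≡ as ++ x ∷ bs ++ y ∷ cs) ⊎
               (∃ λ as → ∃ λ bs → ∃ λ cs → xs ≡ as ++ y ∷ bs ++ x ∷ cs)
    ∈∈-split (here refl) (here refl) x≢y = contradiction refl x≢y
    ∈∈-split (here refl) (there j) _ with ∈-∃++ j
    ... | bs , cs , refl = inj₁ ([] , bs , cs , refl)
    ∈∈-split (there i) (here refl) _ with ∈-∃++ i
    ... | bs , cs , refl = inj₂ ([] , bs , cs , refl)
    ∈∈-split {z ∷ _} (there i) (there j) x≢y with ∈∈-split i j x≢y
    ... | inj₁ (as , bs , cs , refl) = inj₁ (z ∷ as , bs , cs , refl)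
    ... | inj₂ (as , bs , cs , refl) = inj₂ (z ∷ as , bs , cs , refl)

  lastOf : {A : Set} → A → List A → A
  lastOf x []       = x
  lastOf _ (y ∷ ys) = lastOf y ys

  module _ {A : Set} {R : A → A → Set} where

    Linked-++⁻ʳ : ∀ xs {ys} → Linked R (xs ++ ys) → Linked R ys
    Linked-++⁻ʳ []       l = l
    Linked-++⁻ʳ (x ∷ xs) l = Linked-++⁻ʳ xs (Linked.tail l)

    Linked-++⁻ˡ : ∀ xs {ys} → Linked R (xs ++ ys) → Linked R xs
    Linked-++⁻ˡ []           l       = []
    Linked-++⁻ˡ (x ∷ [])     l       = [-]
    Linked-++⁻ˡ (x ∷ y ∷ xs) (r ∷ l) = r ∷ Linked-++⁻ˡ (y ∷ xs) l

    Linked-middle : ∀ x xs {y ys} → Linked R (x ∷ xs ++ y ∷ ys) → R (lastOf x xs) y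
    Linked-middle x []        (r ∷ _) = r
    Linked-middle x (x′ ∷ xs) (_ ∷ l) = Linked-middle x′ xs l

  +-*-suc : ∀ a h l → a + h + h * l ≡ a + h * suc l
  +-*-suc a h l = trans (+-assoc a h _) (cong (a +_) (sym (*-suc h l)))

  -- Darts, potentials and short closed walks in the cluster graph.

  Dart : ℕ → Set
  Dart M = Fin M × Bool

  rev : ∀ {M} → Dart M → Dart M
  rev (σ , b) = σ , not b

  rev-rev : ∀ {M} (e : Dart M) → rev (rev e) ≡ e
  rev-rev (σ , b) = cong (σ ,_) (Bool.not-involutive b)

  _≟ᵈ_ : ∀ {M} (e e′ : Dart M) → Dec (e ≡ e′)
  _≟ᵈ_ = ≡-dec Fin._≟_ Bool._≟_

  darts : ∀ {M} → List (Fin M) → List (Dart M)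
  darts []      = []
  darts (σ ∷ E) = (σ , false) ∷ (σ , true) ∷ darts E

  module _ {M : ℕ} where

    ∈-darts⁺ : ∀ {E : List (Fin M)} {σ} b → σ ∈ E → (σ , b) ∈ darts E
    ∈-darts⁺ false (here refl) = here refl
    ∈-darts⁺ true  (here refl) = there (here refl)
    ∈-darts⁺ b     (there i)   = there (there (∈-darts⁺ b i))

    ∈-darts⁻ : ∀ {E : List (Fin M)} {e} → e ∈ darts E → proj₁ e ∈ E
    ∈-darts⁻ {_ ∷ _} (here refl)         = here refl
    ∈-darts⁻ {_ ∷ _} (there (here refl)) = here refl
    ∈-darts⁻ {_ ∷ _} (there (there i))   = there (∈-darts⁻ i)

    Unique-darts : ∀ {E : List (Fin M)} → Unique E → Unique (darts E)
    Unique-darts []      = []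
    Unique-darts (a ∷ u) =
      ((λ ()) ∷ All.tabulate (λ i eq → All.lookup a (∈-darts⁻ i) (cong proj₁ eq))) ∷
      All.tabulate (λ i eq → All.lookup a (∈-darts⁻ i) (cong proj₁ eq)) ∷ Unique-darts u

    ∑-darts : ∀ (E : List (Fin M)) (f : Fin M → ℕ) → ∑ (darts E) (f ∘ proj₁) ≡ 2 * ∑ E f
    ∑-darts []      f = refl
    ∑-darts (σ ∷ E) f rewrite ∑-darts E f = begin
      f σ + (f σ + 2 * ∑ E f)       ≡⟨ +-assoc (f σ) (f σ) _ ⟨
      f σ + f σ + 2 * ∑ E f         ≡⟨ cong (λ z → f σ + z + 2 * ∑ E f) (sym (+-identityʳ (f σ))) ⟩
      2 * f σ + 2 * ∑ E f           ≡⟨ *-distribˡ-+ 2 (f σ) (∑ E f) ⟨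
      2 * (f σ + ∑ E f)             ∎
      where open ≡-Reasoning

  -- Segment σ joins src (σ , false) to src (σ , true); a smaller index means a higher priority.
  record Potentials (n M : ℕ) : Set where
    field
      src   : Dart M → Fin n
      lev   : Fin M → ℕ
      ψ     : Fin M → Fin n → ℕ
      ψ-src : ∀ σ → ψ σ (src (σ , false)) ≡ 0
      ψ-tgt : ∀ σ → ψ σ (src (σ , true)) ≡ 2 ^ lev σ
      ψ-old : ∀ {σ τ} → σ Fin.< τ → ψ σ (src (τ , false)) ≡ ψ σ (src (τ , true))

    tgt : Dart M → Fin n
    tgt e = src (rev e)

    -- Stands in for the distance in the original graph: a walk of length at most `m` units gives
    -- `Near m`, since all potentials are 1-Lipschitz. As a finite conjunction over the segments it
    -- is decidable, and it carries all that the cycle argument uses.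
    Near : ℕ → Fin n → Fin n → Set
    Near m u v = ∀ τ → ψ τ u ≤ ψ τ v + m × ψ τ v ≤ ψ τ u + m

    near? : ∀ m u v → Dec (Near m u v)
    near? m u v = Fin.all? (λ τ → (ψ τ u ≤? ψ τ v + m) ×-dec (ψ τ v ≤? ψ τ u + m))

    near-refl : ∀ {m} u → Near m u u
    near-refl u τ = m≤m+n _ _ , m≤m+n _ _

    near-sym : ∀ {m u v} → Near m u v → Near m v u
    near-sym p τ = proj₂ (p τ) , proj₁ (p τ)

    near-mono : ∀ {m m′ u v} → m ≤ m′ → Near m u v → Near m′ u v
    near-mono le p τ = ≤-trans (proj₁ (p τ)) (+-monoʳ-≤ _ le) , ≤-trans (proj₂ (p τ)) (+-monoʳ-≤ _ le)

    near-trans : ∀ {m m′ u v w} → Near m u v → Near m′ v w → Near (m + m′) u w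
    near-trans {m} {m′} {u} {v} {w} p p′ τ =
      add {ψ τ u} {ψ τ v} {ψ τ w} (proj₁ (p τ)) (proj₁ (p′ τ)) ,
      subst (λ z → ψ τ w ≤ ψ τ u + z) (+-comm m′ m)
        (add {ψ τ w} {ψ τ v} {ψ τ u} (proj₂ (p′ τ)) (proj₂ (p τ)))
      where
      add : ∀ {a b c k l} → a ≤ b + k → b ≤ c + l → a ≤ c + (k + l)
      add {a} {b} {c} {k} {l} x y = ≤-trans x (≤-trans (+-monoˡ-≤ k y)
        (≤-reflexive (trans (+-assoc c l k) (cong (c +_) (+-comm l k)))))

    -- A graph whose vertices are the values of q (clusters) and whose edges are the
    -- segments in E, all of the same level i; a cluster has diameter at most h.
    module ClusterGraph (E : List (Fin M)) (i : ℕ) (lev≡i : ∀ {σ} → σ ∈ E → lev σ ≡ i)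
                        (q : Dart M → Fin n) (h : ℕ)
                        (diam : ∀ {e e′} → proj₁ e ∈ E → proj₁ e′ ∈ E → q e ≡ q e′ →
                                Near h (src e) (src e′)) where

      -- Walks list their darts latest first.
      NonBacktracking : Dart M → Dart M → Set
      NonBacktracking e′ e = q e′ ≡ q (rev e) × e′ ≢ rev e

      InE : List (Dart M) → Set
      InE W = ∀ {e} → e ∈ W → proj₁ e ∈ E

      module _ (φ : Fin n → ℕ) (lip : ∀ {u v} → Near h u v → φ u ≤ φ v + h) where

        -- If no dart of a walk decreases φ, the hops between them must make up for the increase
        -- D along one of the darts.
        telescope₀ : ∀ e w → InE (e ∷ w) → Linked NonBacktracking (e ∷ w) →
                     (∀ {x} → x ∈ e ∷ w → φ (src x) ≤ φ (tgt x)) →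
                     φ (src (lastOf e w)) ≤ φ (tgt e) + h * length w
        telescope₀ e []       _  _       up = ≤-trans (up (here refl)) (m≤m+n _ _)
        telescope₀ e (x ∷ w) inE (r ∷ l) up = begin
          φ (src (lastOf x w))             ≤⟨ telescope₀ x w (inE ∘ there) l (up ∘ there) ⟩
          φ (tgt x) + h * length w         ≤⟨ +-monoˡ-≤ _ (lip (diam (inE (there (here refl))) (inE (here refl)) (sym (proj₁ r)))) ⟩
          φ (src e) + h + h * length w     ≤⟨ +-monoˡ-≤ _ (+-monoˡ-≤ h (up (here refl))) ⟩
          φ (tgt e) + h + h * length w     ≡⟨ +-*-suc (φ (tgt e)) h (length w) ⟩
          φ (tgt e) + h * suc (length w)   ∎
          where open ≤-Reasoning

        telescope₁ : ∀ {D} e w → InE (e ∷ w) → Linked NonBacktracking (e ∷ w) →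
                     (∀ {x} → x ∈ e ∷ w → φ (src x) ≤ φ (tgt x)) →
                     ∀ {y} → y ∈ e ∷ w → φ (src y) + D ≤ φ (tgt y) →
                     φ (src (lastOf e w)) + D ≤ φ (tgt e) + h * length w
        telescope₁ {D} e [] _ _ up (here refl) jump = ≤-trans jump (m≤m+n _ _)
        telescope₁ {D} e (x ∷ w) inE (r ∷ l) up y∈ jump = begin
          φ (src (lastOf x w)) + D         ≤⟨ step y∈ jump ⟩
          φ (tgt e) + h + h * length w     ≡⟨ +-*-suc (φ (tgt e)) h (length w) ⟩
          φ (tgt e) + h * suc (length w)   ∎
          where
          open ≤-Reasoning
          hop : φ (tgt x) ≤ φ (src e) + h
          hop = lip (diam (inE (there (here refl))) (inE (here refl)) (sym (proj₁ r)))
          step : ∀ {y} → y ∈ e ∷ x ∷ w → φ (src y) + D ≤ φ (tgt y) →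
                 φ (src (lastOf x w)) + D ≤ φ (tgt e) + h + h * length w
          step (here refl) jump = begin
            φ (src (lastOf x w)) + D             ≤⟨ +-monoˡ-≤ D (telescope₀ x w (inE ∘ there) l (up ∘ there)) ⟩
            φ (tgt x) + h * length w + D         ≤⟨ +-monoˡ-≤ D (+-monoˡ-≤ _ hop) ⟩
            φ (src e) + h + h * length w + D     ≡⟨ trans (cong (_+ D) (+-assoc (φ (src e)) h _)) (trans (+-assoc (φ (src e)) _ D) (trans (cong (φ (src e) +_) (+-comm _ D)) (sym (+-assoc (φ (src e)) D _)))) ⟩
            φ (src e) + D + (h + h * length w)   ≤⟨ +-monoˡ-≤ _ jump ⟩
            φ (tgt e) + (h + h * length w)       ≡⟨ +-assoc (φ (tgt e)) h _ ⟨
            φ (tgt e) + h + h * length w         ∎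
          step (there y∈) jump = begin
            φ (src (lastOf x w)) + D         ≤⟨ telescope₁ x w (inE ∘ there) l (up ∘ there) y∈ jump ⟩
            φ (tgt x) + h * length w         ≤⟨ +-monoˡ-≤ _ hop ⟩
            φ (src e) + h + h * length w     ≤⟨ +-monoˡ-≤ _ (+-monoˡ-≤ h (up (here refl))) ⟩
            φ (tgt e) + h + h * length w     ∎

        -- The closing hop makes as many hops as darts, and around the whole walk `φ` returns to its
        -- value; the rise `D` must be lost in the hops, at most `h` in each.
        closed⇒D≤ : ∀ {D} e w → InE (e ∷ w) → Linked NonBacktracking (e ∷ w) →
                    q (rev e) ≡ q (lastOf e w) → lastOf e w ∈ e ∷ w →
                    (∀ {x} → x ∈ e ∷ w → φ (src x) ≤ φ (tgt x)) →
                    ∀ {y} → y ∈ e ∷ w → φ (src y) + D ≤ φ (tgt y) → D ≤ h * length (e ∷ w)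
        closed⇒D≤ {D} e w inE l closed last∈ up y∈ jump = +-cancelˡ-≤ (φ (src (lastOf e w))) _ _ (begin
          φ (src (lastOf e w)) + D                   ≤⟨ telescope₁ e w inE l up y∈ jump ⟩
          φ (tgt e) + h * length w                   ≤⟨ +-monoˡ-≤ _ (lip (diam (inE (here refl)) (inE last∈) closed)) ⟩
          φ (src (lastOf e w)) + h + h * length w    ≡⟨ +-*-suc (φ (src (lastOf e w))) h (length w) ⟩
          φ (src (lastOf e w)) + h * suc (length w)  ∎)
          where open ≤-Reasoning

      lastOf-∈ : ∀ {A : Set} (x : A) xs → lastOf x xs ∈ x ∷ xs
      lastOf-∈ x []       = here refl
      lastOf-∈ x (y ∷ ys) = there (lastOf-∈ y ys)

      -- The potential of the top-priority segment of a short closed walk only changes along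
      -- that segment itself, so the segment is traversed in both directions.
      bothDirections : ∀ e w → InE (e ∷ w) → Linked NonBacktracking (e ∷ w) →
                       q (rev e) ≡ q (lastOf e w) → h * length (e ∷ w) < 2 ^ i →
                       ∃ λ σ → (σ , false) ∈ e ∷ w × (σ , true) ∈ e ∷ w
      bothDirections e w inE l closed short with argmax (λ x → M ∸ toℕ (proj₁ x)) e w
      ... | (σ , b) , top∈ , top
        with Any.any? ((σ , false) ≟ᵈ_) (e ∷ w) | Any.any? ((σ , true) ≟ᵈ_) (e ∷ w)
      ... | yes f∈ | yes t∈ = σ , f∈ , t∈
      ... | no f∉ | no t∉ with b
      ...   | false = contradiction top∈ f∉
      ...   | true  = contradiction top∈ t∉
      bothDirections e w inE l closed short | (σ , b) , top∈ , top | yes f∈ | no t∉ =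
        contradiction (closed⇒D≤ (ψ σ) (λ p → proj₁ (p σ)) e w inE l closed (lastOf-∈ e w) up f∈
          (≤-reflexive (trans (cong (_+ 2 ^ i) (ψ-src σ)) (sym (trans (ψ-tgt σ) (cong (2 ^_) (lev≡i (inE f∈))))))))
          (<⇒≱ short)
        where
        up : ∀ {x} → x ∈ e ∷ w → ψ σ (src x) ≤ ψ σ (tgt x)
        up {τ , c} x∈ with m≤n⇒m<n∨m≡n (≮⇒≥ {toℕ τ} {toℕ σ} (λ τ<σ → <⇒≱ (∸-monoʳ-< τ<σ (Fin.toℕ≤n σ)) (top x∈)))
        up {τ , false} x∈ | inj₁ lt = ≤-reflexive (ψ-old lt)
        up {τ , true}  x∈ | inj₁ lt = ≤-reflexive (sym (ψ-old lt))
        up {τ , c}     x∈ | inj₂ eq with Fin.toℕ-injective {i = σ} {j = τ} eq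
        up {τ , false} x∈ | inj₂ eq | refl = ≤-trans (≤-reflexive (ψ-src τ)) z≤n
        up {τ , true}  x∈ | inj₂ eq | refl = contradiction x∈ t∉
      bothDirections e w inE l closed short | (σ , b) , top∈ , top | no f∉ | yes t∈ =
        contradiction (closed⇒D≤ (λ v → 2 ^ i ∸ ψ σ v) flip-lip e w inE l closed (lastOf-∈ e w) up t∈
          (≤-reflexive (cong₂ (λ x y → 2 ^ i ∸ x + y) ψt (trans (sym (m+[n∸m]≡n z≤n)) (cong (λ x → 2 ^ i ∸ x) (sym (ψ-src σ)))) ∙ cong (_+ (2 ^ i ∸ ψ σ (src (σ , false)))) (n∸n≡0 (2 ^ i)))))
          (<⇒≱ short)
        where
        _∙_ = trans
        ψt : ψ σ (src (σ , true)) ≡ 2 ^ i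
        ψt = trans (ψ-tgt σ) (cong (2 ^_) (lev≡i (inE t∈)))
        -- The top segment is only traversed backwards here, so the reflected potential replaces
        -- `ψ σ`: in that direction it rises from 0 to 2 ^ i, and truncation at 0 keeps it
        -- Lipschitz.
        flip-lip : ∀ {u v} → Near h u v → 2 ^ i ∸ ψ σ u ≤ 2 ^ i ∸ ψ σ v + h
        flip-lip {u} {v} p = begin
          2 ^ i ∸ ψ σ u                ≤⟨ m≤n+m∸n _ h ⟩
          h + (2 ^ i ∸ ψ σ u ∸ h)      ≡⟨ cong (h +_) (∸-+-assoc (2 ^ i) (ψ σ u) h) ⟩
          h + (2 ^ i ∸ (ψ σ u + h))    ≤⟨ +-monoʳ-≤ h (∸-monoʳ-≤ (2 ^ i) (proj₂ (p σ))) ⟩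
          h + (2 ^ i ∸ ψ σ v)          ≡⟨ +-comm h _ ⟩
          2 ^ i ∸ ψ σ v + h            ∎
          where open ≤-Reasoning
        up : ∀ {x} → x ∈ e ∷ w → 2 ^ i ∸ ψ σ (src x) ≤ 2 ^ i ∸ ψ σ (tgt x)
        up {τ , c} x∈ with m≤n⇒m<n∨m≡n (≮⇒≥ {toℕ τ} {toℕ σ} (λ τ<σ → <⇒≱ (∸-monoʳ-< τ<σ (Fin.toℕ≤n σ)) (top x∈)))
        up {τ , false} x∈ | inj₁ lt = ≤-reflexive (cong (2 ^ i ∸_) (ψ-old lt))
        up {τ , true}  x∈ | inj₁ lt = ≤-reflexive (cong (2 ^ i ∸_) (sym (ψ-old lt)))
        up {τ , c}     x∈ | inj₂ eq with Fin.toℕ-injective {i = σ} {j = τ} eq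
        up {τ , false} x∈ | inj₂ eq | refl = contradiction x∈ f∉
        up {τ , true}  x∈ | inj₂ eq | refl =
          ∸-monoʳ-≤ (2 ^ i) (≤-trans (≤-reflexive (ψ-src τ)) (z≤n {ψ τ (src (τ , true))}))

      -- Between the two opposite traversals of its top-priority segment the walk contains a shorter
      -- closed walk, or nothing, and then it backtracks. The chain condition is linear rather than
      -- cyclic, so the inner walk inherits it. `m` bounds the length for the recursion.
      noShortClosedWalk : ∀ m e w → length w < m → InE (e ∷ w) → Linked NonBacktracking (e ∷ w) →
                          q (rev e) ≡ q (lastOf e w) → ¬ (h * length (e ∷ w) < 2 ^ i)
      noShortClosedWalk (suc m) e w (s≤s len) inE l closed short =
        case bothDirections e w inE l closed short of λ (σ , f∈ , t∈) →
        case ∈∈-split f∈ t∈ (λ ()) of λ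
          { (inj₁ (as , bs , cs , eq)) → inner as (σ , false) bs cs eq
          ; (inj₂ (as , bs , cs , eq)) → inner as (σ , true) bs cs eq }
        where
        inner : ∀ as x bs cs → e ∷ w ≡ as ++ x ∷ bs ++ rev x ∷ cs → ⊥
        inner as x [] cs eq with Linked-++⁻ʳ as (subst (Linked NonBacktracking) eq l)
        ... | (_ , ne) ∷ _ = ne (sym (rev-rev x))
        inner as x (b ∷ bs) cs eq with Linked-++⁻ʳ as (subst (Linked NonBacktracking) eq l)
        ... | (xb , _) ∷ l′ = noShortClosedWalk m b bs (≤-trans shorter len)
                (λ z∈ → inE (subst (_ ∈_) (sym eq) (∈-++⁺ʳ as (there (∈-++⁺ˡ z∈)))))
                (Linked-++⁻ˡ (b ∷ bs) l′)
                (trans (sym xb) (trans (cong q (sym (rev-rev x))) (sym (proj₁ (Linked-middle b bs l′)))))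
                (≤-<-trans (*-monoʳ-≤ h (≤-trans shorter (n≤1+n _))) short)
          where
          shorter : suc (length bs) ≤ length w
          shorter = begin
            suc (length bs)                       ≤⟨ s≤s (m≤m+n _ _) ⟩
            suc (length bs + length (rev x ∷ cs)) ≡⟨ cong suc (length-++ bs) ⟨
            length (b ∷ bs ++ rev x ∷ cs)         ≤⟨ ≤-pred (≤-trans (m≤n+m _ (length as)) (≤-reflexive (trans (sym (length-++ as)) (cong length (sym eq))))) ⟩
            length w                              ∎
            where open ≤-Reasoning

      -- The closed walk that follows a walk and then another one backwards.
      record Closing (base : Dart M) (len : ℕ) : Set where
        field
          e     : Dart M
          w     : List (Dart M)
          inE   : InE (e ∷ w)
          chain : Linked NonBacktracking (e ∷ w)
          end   : rev e ≡ base
          start : lastOf e w ≡ base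
          size  : length (e ∷ w) ≡ len

      close : ∀ z acc y ys → InE (z ∷ acc) → InE (y ∷ ys) →
              Linked NonBacktracking (z ∷ acc) → Linked NonBacktracking (y ∷ ys) →
              q (rev y) ≡ q (rev z) → y ≢ z → lastOf z acc ≡ lastOf y ys →
              Closing (lastOf y ys) (length (y ∷ ys) + length (z ∷ acc))
      close z acc y [] inE inE′ l l′ meet y≢z same = record
        { e = rev y ; w = z ∷ acc
        ; inE   = λ { (here refl) → inE′ (here refl) ; (there i) → inE i }
        ; chain = (meet , λ eq → y≢z (trans (sym (rev-rev y)) (trans (cong rev eq) (rev-rev z)))) ∷ l
        ; end   = rev-rev y ; start = same ; size = refl }
      close z acc y (y′ ∷ ys) inE inE′ l (r ∷ l′) meet y≢z same =
        subst (Closing _) (cong suc (+-suc _ _))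
          (close (rev y) (z ∷ acc) y′ ys
            (λ { (here refl) → inE′ (here refl) ; (there i) → inE i }) (inE′ ∘ there)
            ((meet , λ eq → y≢z (trans (sym (rev-rev y)) (trans (cong rev eq) (rev-rev z)))) ∷ l) l′
            (trans (sym (proj₁ r)) (cong q (sym (rev-rev y))))
            (λ eq → proj₂ r (trans (sym (rev-rev y)) (cong rev (sym eq)))) same)

      -- If the last darts differ, one walk followed by the other one backwards is a closed chain of
      -- twice the length, based at the common first dart and too short to exist. If they agree,
      -- both walks are shortened by that dart.
      walk-unique : ∀ x xs y ys → length xs ≡ length ys → lastOf x xs ≡ lastOf y ys →
                    InE (x ∷ xs) → InE (y ∷ ys) →
                    Linked NonBacktracking (x ∷ xs) → Linked NonBacktracking (y ∷ ys) →
                    q (rev x) ≡ q (rev y) → h * (2 * length (x ∷ xs)) < 2 ^ i → x ∷ xs ≡ y ∷ ys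
      walk-unique x xs y ys len same inE inE′ l l′ meet short with x ≟ᵈ y
      ... | no x≢y = contradiction
              (subst (λ k → h * k < 2 ^ i) (trans (cong (length (x ∷ xs) +_) (+-identityʳ _)) (trans (cong (λ k → suc k + length (x ∷ xs)) len) (sym size))) short)
              (noShortClosedWalk _ e w (n<1+n _) inE″ chain (trans (cong q end) (cong q (sym start))))
        where open Closing (close x xs y ys inE inE′ l l′ (sym meet) (x≢y ∘ sym) same) renaming (inE to inE″)
      walk-unique x [] y [] len same inE inE′ l l′ meet short | yes refl = refl
      walk-unique x (x′ ∷ xs) y (y′ ∷ ys) len same inE inE′ (r ∷ l) (r′ ∷ l′) meet short | yes refl =
        cong (x ∷_) (walk-unique x′ xs y′ ys (suc-injective len) same (inE ∘ there) (inE′ ∘ there) l l′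
          (trans (sym (proj₁ r)) (proj₁ r′))
          (≤-<-trans (*-monoʳ-≤ h (*-monoʳ-≤ 2 (n≤1+n (suc (length xs))))) short))

      module Growth (uniqueE : Unique E)
                    (degree≥3 : ∀ {e} → proj₁ e ∈ E →
                                3 ≤ length (filter (λ e′ → q e′ Fin.≟ q e) (darts E))) where

        -- Three darts leave the cluster that `e` enters, and at most one of them is `rev e`; two
        -- continuations remain.
        children : ∀ e → proj₁ e ∈ E → ∃ λ y → ∃ λ z →
                   (proj₁ y ∈ E × NonBacktracking y e) × (proj₁ z ∈ E × NonBacktracking z e) × y ≢ z
        children e e∈ with twoOthers _≟ᵈ_ (Unique.filter⁺ at? (Unique-darts uniqueE)) (degree≥3 {rev e} e∈) (rev e)
          where at? = λ e′ → q e′ Fin.≟ q (rev e)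
        ... | y , z , y∈ , z∈ , y≢ , z≢ , y≢z = y , z , ok y∈ y≢ , ok z∈ z≢ , y≢z
          where
          at? = λ e′ → q e′ Fin.≟ q (rev e)
          ok : ∀ {x} → x ∈ filter at? (darts E) → x ≢ rev e → proj₁ x ∈ E × NonBacktracking x e
          ok x∈ x≢ with ∈-filter⁻ at? {xs = darts E} x∈
          ... | i , qx = ∈-darts⁻ i , qx , x≢

        child : Bool → (Σ (Dart M) λ e → proj₁ e ∈ E) → Σ (Dart M) λ e → proj₁ e ∈ E
        child false (e , e∈) = let y , _ , (y∈ , _) , _     = children e e∈ in y , y∈
        child true  (e , e∈) = let _ , z , _ , (z∈ , _) , _ = children e e∈ in z , z∈

        child-step : ∀ b e → NonBacktracking (proj₁ (child b e)) (proj₁ e)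
        child-step false (e , e∈) = let _ , _ , (_ , r) , _     = children e e∈ in r
        child-step true  (e , e∈) = let _ , _ , _ , (_ , r) , _ = children e e∈ in r

        child-injective : ∀ b b′ e → proj₁ (child b e) ≡ proj₁ (child b′ e) → b ≡ b′
        child-injective false false e _ = refl
        child-injective true  true  e _ = refl
        child-injective false true (e , e∈) eq =
          let _ , _ , _ , _ , y≢z = children e e∈ in contradiction eq y≢z
        child-injective true false (e , e∈) eq =
          let _ , _ , _ , _ , y≢z = children e e∈ in contradiction (sym eq) y≢z

        module _ (e₀ : Dart M) (e₀∈ : proj₁ e₀ ∈ E) where

          -- A binary word records the choices between the two continuations, its head being the
          -- latest one, just as walks list their latest dart first.
          final : List Bool → Σ (Dart M) λ e → proj₁ e ∈ E
          final []      = e₀ , e₀∈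
          final (b ∷ w) = child b (final w)

          previous : List Bool → List (Dart M)
          previous []      = []
          previous (b ∷ w) = proj₁ (final w) ∷ previous w

          trace : List Bool → List (Dart M)
          trace w = proj₁ (final w) ∷ previous w

          trace-linked : ∀ w → Linked NonBacktracking (trace w)
          trace-linked []      = [-]
          trace-linked (b ∷ w) = child-step b (final w) ∷ trace-linked w

          trace-inE : ∀ w → InE (trace w)
          trace-inE w       (here refl) = proj₂ (final w)
          trace-inE (b ∷ w) (there i)   = trace-inE w i

          trace-last : ∀ w → lastOf (proj₁ (final w)) (previous w) ≡ e₀
          trace-last []      = refl
          trace-last (b ∷ w) = trace-last w

          length-previous : ∀ w → length (previous w) ≡ length w
          length-previous []      = refl
          length-previous (b ∷ w) = cong suc (length-previous w)

          trace-injective : ∀ w w′ → trace w ≡ trace w′ → w ≡ w′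
          trace-injective []      []        eq = refl
          trace-injective (b ∷ w) (b′ ∷ w′) eq
            with trace-injective w w′ (cong (λ { [] → [] ; (_ ∷ xs) → xs }) eq)
          ... | refl = cong (_∷ w) (child-injective b b′ (final w) (cong (lastOf-head e₀) eq))
            where
            lastOf-head : Dart M → List (Dart M) → Dart M
            lastOf-head d []      = d
            lastOf-head d (x ∷ _) = x

          final-injective : ∀ w w′ → length w ≡ length w′ → h * (2 * suc (length w)) < 2 ^ i →
                            proj₁ (final w) ≡ proj₁ (final w′) → w ≡ w′
          final-injective w w′ len short eq = trace-injective w w′
            (walk-unique _ _ _ _ (trans (length-previous w) (trans len (sym (length-previous w′))))
              (trans (trace-last w) (sym (trace-last w′))) (trace-inE w) (trace-inE w′)
              (trace-linked w) (trace-linked w′) (cong (q ∘ rev) eq)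
              (subst (λ k → h * (2 * suc k) < 2 ^ i) (sym (length-previous w)) short))

          final-near : ∀ m → (∀ {e} → proj₁ e ∈ E → Near m (src e) (tgt e)) → ∀ w →
                       Near (length w * (m + h)) (src e₀) (src (proj₁ (final w)))
          final-near m seg []      = near-refl _
          final-near m seg (b ∷ w) = subst (λ k → Near k (src e₀) (src (proj₁ (child b (final w)))))
            (+-comm (length w * (m + h)) (m + h))
            (near-trans (final-near m seg w)
              (near-trans (seg (proj₂ (final w)))
                (diam (proj₂ (final w)) (proj₂ (child b (final w))) (sym (proj₁ (child-step b (final w)))))))

  -- Binary words, packing of points and pruning to minimum degree three.

  words : ℕ → List (List Bool)
  words zero    = [] ∷ []
  words (suc g) = map (false ∷_) (words g) ++ map (true ∷_) (words g)

  length-words : ∀ g → length (words g) ≡ 2 ^ g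
  length-words zero    = refl
  length-words (suc g) = begin
    length (map (false ∷_) (words g) ++ map (true ∷_) (words g))
      ≡⟨ length-++ (map (false ∷_) (words g)) ⟩
    length (map (false ∷_) (words g)) + length (map (true ∷_) (words g))
      ≡⟨ cong₂ _+_ (length-map (false ∷_) (words g)) (length-map (true ∷_) (words g)) ⟩
    length (words g) + length (words g)  ≡⟨ cong₂ _+_ (length-words g) (length-words g) ⟩
    2 ^ g + 2 ^ g                        ≡⟨ cong (2 ^ g +_) (+-identityʳ _) ⟨
    2 ^ suc g                            ∎
    where open ≡-Reasoning

  ∈-words : ∀ g {w} → w ∈ words g → length w ≡ g
  ∈-words zero (here refl) = refl
  ∈-words (suc g) i with ∈-++⁻ (map (false ∷_) (words g)) i
  ... | inj₁ j with ∈-map⁻ (false ∷_) j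
  ...   | w , k , refl = cong suc (∈-words g k)
  ∈-words (suc g) i | inj₂ j with ∈-map⁻ (true ∷_) j
  ...   | w , k , refl = cong suc (∈-words g k)

  Unique-words : ∀ g → Unique (words g)
  Unique-words zero    = [] ∷ []
  Unique-words (suc g) = Unique.++⁺
    (Unique.map⁺ (λ { refl → refl }) (Unique-words g)) (Unique.map⁺ (λ { refl → refl }) (Unique-words g))
    (λ (i , j) → case (∈-map⁻ (false ∷_) i , ∈-map⁻ (true ∷_) j) of λ { ((_ , _ , refl) , (_ , _ , ())) })

  Unique-map-∈ : ∀ {A B : Set} (f : A → B) {xs} → Unique xs →
                 (∀ {x y} → x ∈ xs → y ∈ xs → f x ≡ f y → x ≡ y) → Unique (map f xs)
  Unique-map-∈ f []      inj = []
  Unique-map-∈ f (a ∷ u) inj =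
    All.map⁺ (All.tabulate (λ i eq → All.lookup a i (inj (here refl) (there i) eq))) ∷
    Unique-map-∈ f u (λ i j → inj (there i) (there j))

  module _ {A : Set} (δ : A → ℕ) (Near : ℕ → A → A → Set) (near? : ∀ m x y → Dec (Near m x y))
           (near-refl : ∀ {m} x → Near m x x) where

    Separated : List A → Set
    Separated = AllPairs (λ u v → ¬ Near (4 * (δ u ⊔ δ v)) u v)

    -- Points are picked greedily by largest `δ`, and each pick discards the points within 4 δ of
    -- it; so the maximum in `Separated` is always the radius of the earlier pick. `m` is fuel for
    -- the recursion.
    packing : ∀ m xs → length xs ≤ m → ∃ λ U → (∀ {u} → u ∈ U → u ∈ xs) × Separated U ×
              (∀ {x} → x ∈ xs → Any (λ u → Near (4 * δ u) u x) U)
    packing _       []       _   = [] , id , [] , λ ()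
    packing (suc m) (x ∷ xs) (s≤s len) with argmax δ x xs
    ... | u , u∈ , top with packing m rest (≤-pred (≤-trans shorter (s≤s len)))
      where
      far? : Decidable (λ y → ¬ Near (4 * δ u) u y)
      far? y = ¬? (near? (4 * δ u) u y)
      rest = filter far? (x ∷ xs)
      shorter : length rest < length (x ∷ xs)
      shorter = filter-notAll far? (x ∷ xs) (lose u∈ (λ far → far (near-refl u)))
    ...   | U , U⊆ , sep , cov = u ∷ U , sub , All.tabulate new ∷ sep , cover
      where
      far? : Decidable (λ y → ¬ Near (4 * δ u) u y)
      far? y = ¬? (near? (4 * δ u) u y)
      sub : ∀ {v} → v ∈ u ∷ U → v ∈ x ∷ xs
      sub (here refl) = u∈
      sub (there i)   = proj₁ (∈-filter⁻ far? {xs = x ∷ xs} (U⊆ i))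
      new : ∀ {v} → v ∈ U → ¬ Near (4 * (δ u ⊔ δ v)) u v
      new {v} i with ∈-filter⁻ far? {xs = x ∷ xs} (U⊆ i)
      ... | v∈ , far = subst (λ k → ¬ Near (4 * k) u v) (sym (m≥n⇒m⊔n≡m (top v∈))) far
      cover : ∀ {y} → y ∈ x ∷ xs → Any (λ v → Near (4 * δ v) v y) (u ∷ U)
      cover {y} i with near? (4 * δ u) u y
      ... | yes p = here p
      ... | no ¬p = there (cov (∈-filter⁺ far? i ¬p))

  module _ {n M : ℕ} (q : Dart M → Fin n) where

    at? : ∀ u → Decidable (λ e → q e ≡ u)
    at? u e = q e Fin.≟ u

    degree : List (Fin M) → Fin n → ℕ
    degree E u = length (filter (at? u) (darts E))

    touches? : ∀ u → Decidable (λ σ → q (σ , false) ≡ u ⊎ q (σ , true) ≡ u)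
    touches? u σ = at? u (σ , false) ⊎-dec at? u (σ , true)

    length≤untouched+degree : ∀ E u → length E ≤ length (filter (¬? ∘ touches? u) E) + degree E u
    length≤untouched+degree []      u = z≤n
    length≤untouched+degree (σ ∷ E) u with at? u (σ , false)
    length≤untouched+degree (σ ∷ E) u | yes _ with at? u (σ , true)
    ... | yes _ = ≤-trans (s≤s (length≤untouched+degree E u)) (≤-trans (≤-reflexive (sym (+-suc _ _)))
                    (+-monoʳ-≤ (length (filter (¬? ∘ touches? u) E)) (n≤1+n _)))
    ... | no _  = ≤-trans (s≤s (length≤untouched+degree E u)) (≤-reflexive (sym (+-suc _ _)))
    length≤untouched+degree (σ ∷ E) u | no _ with at? u (σ , true)
    ... | yes _ = ≤-trans (s≤s (length≤untouched+degree E u)) (≤-reflexive (sym (+-suc _ _)))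
    ... | no _  = s≤s (length≤untouched+degree E u)

    -- Deleting a cluster of degree at most two removes one cluster and at most two segments, so
    -- there remain more than twice as many segments as clusters, and the segments never run out.
    prune : ∀ m (U : List (Fin n)) (E : List (Fin M)) → length U ≤ m → Unique E →
            (∀ {e} → proj₁ e ∈ E → q e ∈ U) → 2 * length U < length E →
            ∃ λ E′ → Unique E′ × (∀ {σ} → σ ∈ E′ → σ ∈ E) × 0 < length E′ ×
            (∀ {e} → proj₁ e ∈ E′ → 3 ≤ degree E′ (q e))
    prune m U E len uniq inU dense with Any.any? (λ u → degree E u <? 3) U
    ... | no ¬low = E , uniq , id , ≤-trans (s≤s z≤n) dense ,
                    λ i → ≮⇒≥ (λ low → ¬low (lose (inU i) low))
    ... | yes low with find low
    prune zero    []      E len uniq inU dense | yes low | _ , () , _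
    prune (suc m) U E len uniq inU dense | yes low | u , u∈ , d<3
      with prune m (filter other? U) (filter (¬? ∘ touches? u) E) len″
             (Unique.filter⁺ (¬? ∘ touches? u) uniq) inU′ dense′
      where
      other? : Decidable (_≢ u)
      other? v = ¬? (v Fin.≟ u)
      len′ : length (filter other? U) < length U
      len′ = filter-notAll other? U (lose u∈ (λ ne → ne refl))
      len″ = ≤-pred (≤-trans len′ len)
      inU′ : ∀ {e} → proj₁ e ∈ filter (¬? ∘ touches? u) E → q e ∈ filter other? U
      inU′ {e} i with ∈-filter⁻ (¬? ∘ touches? u) {xs = E} i
      inU′ {σ , false} i | j , nt = ∈-filter⁺ other? (inU j) (nt ∘ inj₁)
      inU′ {σ , true}  i | j , nt = ∈-filter⁺ other? (inU j) (nt ∘ inj₂)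
      dense′ : 2 * length (filter other? U) < length (filter (¬? ∘ touches? u) E)
      dense′ = +-cancelʳ-≤ 2 _ _ (begin
        suc (2 * length (filter other? U)) + 2   ≡⟨ cong suc (trans (+-comm _ 2) (sym (*-suc 2 _))) ⟩
        suc (2 * suc (length (filter other? U))) ≤⟨ s≤s (*-monoʳ-≤ 2 len′) ⟩
        suc (2 * length U)                       ≤⟨ dense ⟩
        length E                                 ≤⟨ length≤untouched+degree E u ⟩
        length (filter (¬? ∘ touches? u) E) + degree E u ≤⟨ +-monoʳ-≤ _ (≤-pred d<3) ⟩
        length (filter (¬? ∘ touches? u) E) + 2  ∎)
        where open ≤-Reasoning
    ...   | E′ , uniq′ , sub , ne , deg =
            E′ , uniq′ , (λ i → proj₁ (∈-filter⁻ (¬? ∘ touches? u) {xs = E} (sub i))) , ne , deg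

  -- Segments of one level against picks of that level.

  private
    δ≤gδ : ∀ g δ → 1 ≤ g * δ → δ ≤ g * δ
    δ≤gδ (suc g) δ _ = m≤m+n δ (g * δ)

    8δ≤ : ∀ g δ N → 1 ≤ g * δ → 64 * (g * δ) ≤ N → 8 * δ ≤ N
    8δ≤ g δ N pos le = ≤-trans (*-mono-≤ (m≤m+n 8 56) (δ≤gδ g δ pos)) le

    -- Two walks of g + 1 darts close up with 2 (g + 1) hops, each across a cluster of diameter 8 δ.
    -- Their sum 16 g δ + 16 δ is at most 32 g δ, so the factor 64 in the choice of `δ` suffices,
    -- and 1 ≤ g δ makes the inequality strict.
    hops-short : ∀ g δ N → 1 ≤ g * δ → 64 * (g * δ) ≤ N → 8 * δ * (2 * suc g) < N
    hops-short g δ N pos le = begin-strict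
      8 * δ * (2 * suc g)         ≡⟨ solve 2 (λ g δ → con 8 :* δ :* (con 2 :* (con 1 :+ g)) := con 16 :* (g :* δ) :+ con 16 :* δ) refl g δ ⟩
      16 * (g * δ) + 16 * δ       ≤⟨ +-monoʳ-≤ (16 * (g * δ)) (*-monoʳ-≤ 16 (δ≤gδ g δ pos)) ⟩
      16 * (g * δ) + 16 * (g * δ) ≡⟨ *-distribʳ-+ (g * δ) 16 16 ⟨
      32 * (g * δ)                <⟨ *-monoˡ-< (g * δ) {{>-nonZero pos}} (m≤m+n 33 31) ⟩
      64 * (g * δ)                ≤⟨ le ⟩
      N                           ∎
      where
      open ≤-Reasoning
      open +-*-Solver using (solve; _:=_; _:+_; _:*_; con)

    -- The first dart is within 4 δ of its pick; each of the `g` steps adds a segment of length at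
    -- most 2 N and a hop of at most 8 δ ≤ N. The total N (1 + 3 G) dictates the size of `R`.
    walk-radius : ∀ g δ N {G R} → 1 ≤ g * δ → 64 * (g * δ) ≤ N → g ≤ G → suc (3 * G) ≤ R →
                  4 * δ + g * (2 * N + 8 * δ) ≤ N * R
    walk-radius g δ N {G} {R} pos le g≤G G≤R = begin
      4 * δ + g * (2 * N + 8 * δ) ≤⟨ +-mono-≤ (≤-trans (*-monoˡ-≤ δ (m≤m+n 4 4)) (8δ≤ g δ N pos le))
                                       (*-mono-≤ g≤G (+-monoʳ-≤ (2 * N) (8δ≤ g δ N pos le))) ⟩
      N + G * (2 * N + N)         ≡⟨ solve 2 (λ N G → N :+ G :* (con 2 :* N :+ N) := N :* (con 1 :+ con 3 :* G)) refl N G ⟩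
      N * suc (3 * G)             ≤⟨ *-monoʳ-≤ N G≤R ⟩
      N * R                       ∎
      where
      open ≤-Reasoning
      open +-*-Solver using (solve; _:=_; _:+_; _:*_; con)

  module Density {n M : ℕ} (S : Potentials n M)
                 (seg-near : ∀ σ → Potentials.Near S (2 ^ suc (Potentials.lev S σ))
                                     (Potentials.src S (σ , false)) (Potentials.src S (σ , true))) where
    open Potentials S

    weight : Dart M → ℕ
    weight (σ , _) = 2 ^ lev σ

    allDarts : List (Dart M)
    allDarts = darts (allFin M)

    ∈-allDarts : ∀ e → e ∈ allDarts
    ∈-allDarts (σ , b) = ∈-darts⁺ b (∈-allFin σ)

    -- Lengths are rounded down to powers of two, and a segment counts once for each of its ends in
    -- the ball, whence the factor 2 in `κ≤`.
    κ : Fin n → ℕ → ℕ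
    κ u ρ = ∑ allDarts (λ e → ⟦ near? ρ u (src e) ⟧ * weight e)

    κ-filter : ∀ u ρ → κ u ρ ≡ ∑ (filter (λ e → near? ρ u (src e)) allDarts) weight
    κ-filter u ρ = sym (∑-filter (λ e → near? ρ u (src e)) allDarts weight)

    Unique-allDarts : Unique allDarts
    Unique-allDarts = Unique-darts (Unique.allFin⁺ M)

    κ-mono : ∀ {u u′ ρ ρ′} → (∀ {v} → Near ρ u v → Near ρ′ u′ v) → κ u ρ ≤ κ u′ ρ′
    κ-mono {u} {u′} {ρ} {ρ′} imp rewrite κ-filter u ρ | κ-filter u′ ρ′ =
      ∑-⊆ weight (Unique.filter⁺ (λ e → near? ρ u (src e)) Unique-allDarts)
        (λ i → let j , p = ∈-filter⁻ (λ e → near? ρ u (src e)) {xs = allDarts} i in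
               ∈-filter⁺ (λ e → near? ρ′ u′ (src e)) j (imp p))

    κ≤ : ∀ u ρ → κ u ρ ≤ 2 * ∑ (allFin M) (λ σ → 2 ^ lev σ)
    κ≤ u ρ = ≤-trans (∑-mono allDarts (λ {e} _ → le (does (near? ρ u (src e))) (weight e)))
                     (≤-reflexive (∑-darts (allFin M) (λ σ → 2 ^ lev σ)))
      where
      le : ∀ b k → (if b then 1 else 0) * k ≤ k
      le true  k = ≤-reflexive (+-identityʳ k)
      le false k = z≤n

    module _ (E : List (Fin M)) (i : ℕ) (lev≡i : ∀ {σ} → σ ∈ E → lev σ ≡ i) (uniqueE : Unique E)
             (q : Dart M → Fin n) (h : ℕ)
             (diam : ∀ {e e′} → proj₁ e ∈ E → proj₁ e′ ∈ E → q e ≡ q e′ → Near h (src e) (src e′))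
             (degree≥3 : ∀ {e} → proj₁ e ∈ E → 3 ≤ degree q E (q e)) where

      private
        module CG = ClusterGraph E i lev≡i q h diam
        module Gr = CG.Growth uniqueE (λ {e} → degree≥3 {e})

      seg : ∀ {e} → proj₁ e ∈ E → Near (2 ^ suc i) (src e) (tgt e)
      seg {τ , false} e∈ = subst (λ k → Near (2 ^ suc k) _ _) (lev≡i e∈) (seg-near τ)
      seg {τ , true}  e∈ = subst (λ k → Near (2 ^ suc k) _ _) (lev≡i e∈) (near-sym (seg-near τ))

      -- By `final-injective` the 2 ^ g words have distinct last darts; each of these weighs 2 ^ i,
      -- and `radius` keeps their sources inside the ball.
      growth : ∀ {u r ρ} g e₀ → proj₁ e₀ ∈ E → Near r u (src e₀) → h * (2 * suc g) < 2 ^ i →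
               r + g * (2 ^ suc i + h) ≤ ρ → 2 ^ (g + i) ≤ κ u ρ
      growth {u} {r} {ρ} g e₀ e₀∈ near₀ short radius = begin
        2 ^ (g + i)                    ≡⟨ ^-distribˡ-+-* 2 g i ⟩
        2 ^ g * 2 ^ i                  ≡⟨ cong (_* 2 ^ i) (length-words g) ⟨
        length (words g) * 2 ^ i       ≡⟨ ∑-const (2 ^ i) (words g) ⟨
        ∑ (words g) (λ _ → 2 ^ i)      ≡⟨ ∑-cong (words g) (λ {w} _ → cong (2 ^_) (sym (lev≡i (proj₂ (final w))))) ⟩
        ∑ (words g) (weight ∘ end)     ≡⟨ cong sum (map-∘ (words g)) ⟩
        ∑ (map end (words g)) weight   ≤⟨ ∑-⊆ weight (Unique-map-∈ end (Unique-words g) inj) sub ⟩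
        ∑ (filter (λ e → near? ρ u (src e)) allDarts) weight ≡⟨ κ-filter u ρ ⟨
        κ u ρ                          ∎
        where
        open ≤-Reasoning
        final : List Bool → Σ (Dart M) λ e → proj₁ e ∈ E
        final = Gr.final e₀ e₀∈
        end : List Bool → Dart M
        end w = proj₁ (final w)
        inj : ∀ {w w′} → w ∈ words g → w′ ∈ words g → end w ≡ end w′ → w ≡ w′
        inj {w} {w′} w∈ w′∈ = Gr.final-injective e₀ e₀∈ w w′
          (trans (∈-words g w∈) (sym (∈-words g w′∈)))
          (subst (λ k → h * (2 * suc k) < 2 ^ i) (sym (∈-words g w∈)) short)
        near : ∀ w → w ∈ words g → Near ρ u (src (end w))
        near w w∈ = near-mono radius (near-trans near₀
          (subst (λ k → Near (k * (2 ^ suc i + h)) (src e₀) (src (end w))) (∈-words g w∈)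
            (Gr.final-near e₀ e₀∈ (2 ^ suc i) seg w)))
        sub : ∀ {e} → e ∈ map end (words g) → e ∈ filter (λ e → near? ρ u (src e)) allDarts
        sub e∈ with ∈-map⁻ end e∈
        ... | w , w∈ , refl = ∈-filter⁺ (λ e → near? ρ u (src e)) (∈-allDarts (end w)) (near w w∈)

    module _ (i G R : ℕ) (E : List (Fin M)) (uniqueE : Unique E) (lev≡i : ∀ {σ} → σ ∈ E → lev σ ≡ i)
             (g δ : Fin n → ℕ) (g≤G : ∀ u → g u ≤ G) (G≤R : suc (3 * G) ≤ R)
             (1≤gδ : ∀ u → 1 ≤ g u * δ u) (gδ≤ : ∀ u → 64 * (g u * δ u) ≤ 2 ^ i)
             (sparse : ∀ u → κ u (2 ^ i * R) < 2 ^ (g u + i))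
             (U : List (Fin n))
             (cover : ∀ {e} → proj₁ e ∈ E → Any (λ u → Near (4 * δ u) u (src e)) U) where

      pick : Fin n → Fin n
      pick x with Any.any? (λ u → near? (4 * δ u) u x) U
      ... | yes p = proj₁ (find p)
      -- A default for points that no pick covers; the ends of the segments in `E` are all covered.
      ... | no  _ = x

      pick-∈ : ∀ {x} → Any (λ u → Near (4 * δ u) u x) U → pick x ∈ U
      pick-∈ {x} a with Any.any? (λ u → near? (4 * δ u) u x) U
      ... | yes p = proj₁ (proj₂ (find p))
      ... | no ¬p = contradiction a ¬p

      pick-near : ∀ {x} → Any (λ u → Near (4 * δ u) u x) U → Near (4 * δ (pick x)) (pick x) x
      pick-near {x} a with Any.any? (λ u → near? (4 * δ u) u x) U
      ... | yes p = proj₂ (proj₂ (find p))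
      ... | no ¬p = contradiction a ¬p

      q : Dart M → Fin n
      q = pick ∘ src

      length≤2picks : length E ≤ 2 * length U
      length≤2picks = ≮⇒≥ λ dense →
        let E′ , uniq′ , E′⊆ , ne , deg = prune q _ U E ≤-refl uniqueE (pick-∈ ∘ cover) dense
        in core E′ uniq′ E′⊆ ne deg
        where
        core : ∀ E′ → Unique E′ → (∀ {σ} → σ ∈ E′ → σ ∈ E) → 0 < length E′ →
               (∀ {e} → proj₁ e ∈ E′ → 3 ≤ degree q E′ (q e)) → ⊥
        -- The walks start in the cluster with the largest `δ`, so that 8 δ u bounds the diameter of
        -- every cluster they can meet, while `g` and `sparse` are taken at the same `u`.
        core (σ ∷ E₁) uniq′ E′⊆ ne deg with argmax (δ ∘ q) (σ , false) ((σ , true) ∷ darts E₁)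
        ... | e₀ , e₀∈ , top = <⇒≱ (sparse u)
                (growth (σ ∷ E₁) i (lev≡i ∘ E′⊆) uniq′ q h diam (λ {e} → deg {e}) (g u) e₀ (∈-darts⁻ e₀∈)
                  (pick-near (cover (E′⊆ (∈-darts⁻ e₀∈))))
                  (hops-short (g u) (δ u) (2 ^ i) (1≤gδ u) (gδ≤ u))
                  (walk-radius (g u) (δ u) (2 ^ i) (1≤gδ u) (gδ≤ u) (g≤G u) G≤R))
          where
          u = q e₀
          h = 8 * δ u
          diam : ∀ {e e′} → proj₁ e ∈ σ ∷ E₁ → proj₁ e′ ∈ σ ∷ E₁ → q e ≡ q e′ → Near h (src e) (src e′)
          diam {e} {e′} e∈ e′∈ eq = near-mono
            (≤-trans (≤-reflexive (sym (*-distribʳ-+ (δ (q e)) 4 4))) (*-monoʳ-≤ 8 (top (∈-darts⁺ (proj₂ e) e∈))))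
            (near-trans (near-sym (pick-near (cover (E′⊆ e∈))))
              (subst (λ v → Near (4 * δ v) v (src e′)) (sym eq) (pick-near (cover (E′⊆ e′∈)))))

  -- Telescoping over the levels, and the scale of a pick.

  Σ< : ℕ → (ℕ → ℕ) → ℕ
  Σ< m f = sum (applyUpTo f m)

  ∑-upTo : ∀ m (f : ℕ → ℕ) → ∑ (upTo m) f ≡ Σ< m f
  ∑-upTo m f = cong sum (map-upTo f m)

  Σ<-mono-length : ∀ {m m′} (f : ℕ → ℕ) → m ≤ m′ → Σ< m f ≤ Σ< m′ f
  Σ<-mono-length f z≤n      = z≤n
  Σ<-mono-length f (s≤s le) = +-monoʳ-≤ (f 0) (Σ<-mono-length (f ∘ suc) le)

  Σ<-+ : ∀ a b (f : ℕ → ℕ) → Σ< (a + b) f ≡ Σ< a f + Σ< b (λ j → f (a + j))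
  Σ<-+ zero    b f = refl
  Σ<-+ (suc a) b f = trans (cong (f 0 +_) (Σ<-+ a b (f ∘ suc))) (sym (+-assoc (f 0) _ _))

  Σ<-* : ∀ n s (f : ℕ → ℕ) → Σ< (n * s) f ≡ Σ< n (λ m → Σ< s (λ r → f (m * s + r)))
  Σ<-* zero    s f = refl
  Σ<-* (suc n) s f = begin
    Σ< (s + n * s) f                                 ≡⟨ Σ<-+ s (n * s) f ⟩
    Σ< s f + Σ< (n * s) (λ j → f (s + j))            ≡⟨ cong (Σ< s f +_) (Σ<-* n s (λ j → f (s + j))) ⟩
    Σ< s f + Σ< n (λ m → Σ< s (λ r → f (s + (m * s + r)))) ≡⟨ cong (Σ< s f +_) (Σ<-cong n (λ m → Σ<-cong s (λ r → cong f (sym (+-assoc s (m * s) r))))) ⟩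
    Σ< s f + Σ< n (λ m → Σ< s (λ r → f (s + m * s + r))) ∎
    where
    open ≡-Reasoning
    Σ<-cong : ∀ m {f g : ℕ → ℕ} → (∀ j → f j ≡ g j) → Σ< m f ≡ Σ< m g
    Σ<-cong zero    h = refl
    Σ<-cong (suc m) h = cong₂ _+_ (h 0) (Σ<-cong m (h ∘ suc))

  m<[1+m/n]*n : ∀ m n .{{_ : NonZero n}} → m < suc (m / n) * n
  m<[1+m/n]*n m n = subst (_< n + m / n * n) (sym (m≡m%n+[m/n]*n m n)) (+-monoˡ-< (m / n * n) (m%n<n m n))

  -- Nonzero terms bounded by the distance to the next nonzero term telescope.
  module _ (k s G : ℕ) where

    -- `a` is the first nonzero position found and `r` counts the positions from there on. A nonzero
    -- `h 0` costs at most `k` plus `s` times the gap to the next nonzero position; these gaps do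
    -- not overlap, and only the last nonzero term needs the bound `G`.
    gaps : ∀ N (h : ℕ → ℕ) → (∀ m → h m ≤ G) →
           (∀ m d → h m ≢ 0 → h (suc d + m) ≢ 0 → h m ≤ k + suc d * s) →
           (Σ< N h ≡ 0) ⊎
           (∃ λ a → ∃ λ r → a + r ≡ N × h a ≢ 0 × Σ< N h ≤ r * s + N * k + G)
    gaps zero    h _  _   = inj₁ refl
    gaps (suc N) h ≤G gap with h 0 ≟ 0 | gaps N (h ∘ suc) (≤G ∘ suc)
                                         (λ m d p p′ → gap (suc m) d p (subst (λ j → h j ≢ 0) (sym (+-suc (suc d) m)) p′))
    ... | yes h0 | inj₁ e = inj₁ (cong₂ _+_ h0 e)
    ... | no ¬h0 | inj₁ e = inj₂ (0 , suc N , refl , ¬h0 , (begin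
            h 0 + Σ< N (h ∘ suc)         ≡⟨ trans (cong (h 0 +_) e) (+-identityʳ (h 0)) ⟩
            h 0                          ≤⟨ ≤G 0 ⟩
            G                            ≤⟨ m≤n+m G _ ⟩
            suc N * s + suc N * k + G    ∎))
      where open ≤-Reasoning
    ... | yes h0 | inj₂ (a , r , eq , ha , le) = inj₂ (suc a , r , cong suc eq , ha , (begin
            h 0 + Σ< N (h ∘ suc)         ≡⟨ cong (_+ Σ< N (h ∘ suc)) h0 ⟩
            Σ< N (h ∘ suc)               ≤⟨ le ⟩
            r * s + N * k + G            ≤⟨ +-monoˡ-≤ G (+-monoʳ-≤ (r * s) (m≤n+m (N * k) k)) ⟩
            r * s + suc N * k + G        ∎))
      where open ≤-Reasoning
    ... | no ¬h0 | inj₂ (a , r , eq , ha , le) = inj₂ (0 , suc N , refl , ¬h0 , (begin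
            h 0 + Σ< N (h ∘ suc)                     ≤⟨ +-mono-≤ (gap 0 a ¬h0 (subst (λ j → h j ≢ 0) (cong suc (sym (+-identityʳ a))) ha)) le ⟩
            k + suc a * s + (r * s + N * k + G)      ≡⟨ solve 6 (λ k a s r N G → k :+ (con 1 :+ a) :* s :+ (r :* s :+ N :* k :+ G) :=
                                                          (con 1 :+ (a :+ r)) :* s :+ (con 1 :+ N) :* k :+ G) refl k a s r N G ⟩
            suc (a + r) * s + suc N * k + G          ≡⟨ cong (λ j → suc j * s + suc N * k + G) eq ⟩
            suc N * s + suc N * k + G                ∎))
      where
      open ≤-Reasoning
      open +-*-Solver using (solve; _:=_; _:+_; _:*_; con)

    gaps-≤ : ∀ N (h : ℕ → ℕ) → (∀ m → h m ≤ G) →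
             (∀ m d → h m ≢ 0 → h (suc d + m) ≢ 0 → h m ≤ k + suc d * s) →
             Σ< N h ≤ N * (k + s) + G
    gaps-≤ N h ≤G gap with gaps N h ≤G gap
    ... | inj₁ e = ≤-trans (≤-reflexive e) z≤n
    ... | inj₂ (a , r , eq , _ , le) = begin
      Σ< N h             ≤⟨ le ⟩
      r * s + N * k + G  ≤⟨ +-monoˡ-≤ G (+-monoˡ-≤ (N * k) (*-monoˡ-≤ s (subst (r ≤_) eq (m≤n+m r a)))) ⟩
      N * s + N * k + G  ≡⟨ cong (_+ G) (trans (+-comm (N * s) (N * k)) (sym (*-distribˡ-+ N k s))) ⟩
      N * (k + s) + G    ∎
      where open ≤-Reasoning

    -- Distinct positions in one residue class modulo `s` are at least `s` apart, as `gap` demands,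
    -- so `gaps-≤` applies to each class. Rounding the class length up to `suc (J / s)` turns `J`
    -- into `J + s`.
    spread : ∀ J (f : ℕ → ℕ) → .{{NonZero s}} → (∀ j → f j ≤ G) →
             (∀ i j → i + s ≤ j → f i ≢ 0 → f j ≢ 0 → f i ≤ k + (j ∸ i)) →
             Σ< J f ≤ (J + s) * (k + s) + s * G
    spread J f ≤G gap = begin
      Σ< J f                                                  ≤⟨ Σ<-mono-length f (<⇒≤ (m<[1+m/n]*n J s)) ⟩
      Σ< (N * s) f                                            ≡⟨ Σ<-* N s f ⟩
      Σ< N (λ m → Σ< s (λ r → f (m * s + r)))                 ≡⟨ trans (sym (∑-upTo N _)) (∑-cong (upTo N) (λ {m} _ → sym (∑-upTo s _))) ⟩
      ∑ (upTo N) (λ m → ∑ (upTo s) (λ r → f (m * s + r)))     ≡⟨ ∑-swap (upTo N) (upTo s) (λ m r → f (m * s + r)) ⟩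
      ∑ (upTo s) (λ r → ∑ (upTo N) (λ m → f (m * s + r)))     ≤⟨ ∑-≤ (N * (k + s) + G) (upTo s) (λ {r} _ →
                                                                   ≤-trans (≤-reflexive (∑-upTo N _)) (gaps-≤ N _ (λ _ → ≤G _) (class r))) ⟩
      List.length (upTo s) * (N * (k + s) + G)                ≡⟨ cong (_* (N * (k + s) + G)) (length-applyUpTo id s) ⟩
      s * (N * (k + s) + G)                                   ≡⟨ solve 4 (λ s N k G → s :* (N :* (k :+ s) :+ G) := N :* s :* (k :+ s) :+ s :* G) refl s N k G ⟩
      N * s * (k + s) + s * G                                 ≤⟨ +-monoˡ-≤ (s * G) (*-monoˡ-≤ (k + s) (≤-trans (+-monoʳ-≤ s (m/n*n≤m J s)) (≤-reflexive (+-comm s J)))) ⟩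
      (J + s) * (k + s) + s * G                               ∎
      where
      open ≤-Reasoning
      open +-*-Solver using (solve; _:=_; _:+_; _:*_; con)
      N = suc (J / s)
      class : ∀ r m d → f (m * s + r) ≢ 0 → f ((suc d + m) * s + r) ≢ 0 → f (m * s + r) ≤ k + suc d * s
      class r m d p p′ = ≤-trans
        (gap (m * s + r) ((suc d + m) * s + r)
          (subst (m * s + r + s ≤_) (sym eq) (+-monoʳ-≤ (m * s + r) (m≤m+n s (d * s)))) p p′)
        (≤-reflexive (cong (k +_) (trans (cong (_∸ (m * s + r)) eq) (m+n∸m≡n (m * s + r) (suc d * s)))))
        where
        eq : (suc d + m) * s + r ≡ m * s + r + suc d * s
        eq = solve 4 (λ d m s r → (con 1 :+ d :+ m) :* s :+ r := m :* s :+ r :+ (con 1 :+ d) :* s) refl d m s r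

  -- g is the least exponent ≥ k with K < 2 ^ (g + i), and δ ≈ 2 ^ i / (64 g).
  record Scale (k G R s i K : ℕ) : Set where
    field
      g δ     : ℕ
      k≤g     : k ≤ g
      g≤G     : g ≤ G
      sparse  : K < 2 ^ (g + i)
      minimal : g ≡ k ⊎ 2 ^ (g + i) ≤ 2 * K
      1≤gδ    : 1 ≤ g * δ
      gδ≤     : 64 * (g * δ) ≤ 2 ^ i
      ≤gδ     : 2 ^ i ≤ 128 * (g * δ)
      below   : ∀ j → j + s ≤ i → 2 ^ j * R ≤ δ

  leastExponent : ∀ d k i K → K < 2 ^ (d + k + i) →
                  ∃ λ g → k ≤ g × g ≤ d + k × K < 2 ^ (g + i) × (g ≡ k ⊎ 2 ^ (g + i) ≤ 2 * K)
  leastExponent zero    k i K K< = k , ≤-refl , ≤-refl , K< , inj₁ refl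
  leastExponent (suc d) k i K K< with K <? 2 ^ (k + i)
  ... | yes K<′ = k , ≤-refl , m≤n+m k (suc d) , K<′ , inj₁ refl
  ... | no  K≮ with leastExponent d (suc k) i K (subst (λ z → K < 2 ^ (z + i)) (sym (+-suc d k)) K<)
  ...   | g , k<g , g≤ , K<g , inj₁ refl = g , <⇒≤ k<g , subst (g ≤_) (+-suc d k) g≤ , K<g ,
                                           inj₂ (*-monoʳ-≤ 2 (≮⇒≥ K≮))
  ...   | g , k<g , g≤ , K<g , inj₂ le   = g , <⇒≤ k<g , subst (g ≤_) (+-suc d k) g≤ , K<g , inj₂ le

  -- As the quotient is at least 1, rounding it down loses at most a factor of two: hence 64 on one
  -- side and 128 on the other in `Scale`.
  quotient : ∀ c N → 0 < c → c ≤ N → ∃ λ δ → 1 ≤ δ × c * δ ≤ N × N ≤ c * (δ + δ) × (∀ x → x * c ≤ N → x ≤ δ)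
  quotient c N 0<c c≤N = N / c , m≥n⇒m/n>0 c≤N , subst (_≤ N) (*-comm (N / c) c) (m/n*n≤m N c) ,
    ≤-trans (<⇒≤ (m<[1+m/n]*n N c)) (≤-trans (≤-reflexive (*-comm (suc (N / c)) c))
      (*-monoʳ-≤ c (+-monoˡ-≤ (N / c) (m≥n⇒m/n>0 c≤N)))) ,
    λ x le → subst (_≤ N / c) (m*n/n≡m x c) (/-monoˡ-≤ c le)
    where instance _ = >-nonZero 0<c

  scale : ∀ {k G R s} i K → 1 ≤ k → k ≤ G → 64 * G ≤ 2 ^ i → 64 * (G * R) ≤ 2 ^ s → K < 2 ^ (G + i) →
          Scale k G R s i K
  scale {k} {G} {R} {s} i K 1≤k k≤G 64G≤ 64GR≤ K<
    with leastExponent (G ∸ k) k i K (subst (λ z → K < 2 ^ (z + i)) (sym (m∸n+n≡m k≤G)) K<)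
  ... | g , k≤g , g≤ , K<g , min
    with quotient (64 * g) (2 ^ i) (≤-trans (≤-trans 1≤k k≤g) (m≤n*m g 64))
           (≤-trans (*-monoʳ-≤ 64 (subst (g ≤_) (m∸n+n≡m k≤G) g≤)) 64G≤)
  ...   | δ , 1≤δ , le , ge , best = record
    { g = g ; δ = δ ; k≤g = k≤g ; g≤G = g≤G ; sparse = K<g ; minimal = min
    ; 1≤gδ = *-mono-≤ (≤-trans 1≤k k≤g) 1≤δ
    ; gδ≤ = subst (_≤ 2 ^ i) (*-assoc 64 g δ) le
    ; ≤gδ = subst (2 ^ i ≤_) (double 64 g δ) ge
    -- The spacing `s` is made for this: 64 G R ≤ 2 ^ s lets a radius of 2 ^ j R fit into `δ` once
    -- level `j` is `s` levels lower.
    ; below = λ j j+s≤i → best (2 ^ j * R) (begin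
        2 ^ j * R * (64 * g)    ≤⟨ *-monoʳ-≤ (2 ^ j * R) (*-monoʳ-≤ 64 g≤G) ⟩
        2 ^ j * R * (64 * G)    ≡⟨ shuffle 64 (2 ^ j) G R ⟩
        2 ^ j * (64 * (G * R))  ≤⟨ *-monoʳ-≤ (2 ^ j) 64GR≤ ⟩
        2 ^ j * 2 ^ s           ≡⟨ ^-distribˡ-+-* 2 j s ⟨
        2 ^ (j + s)             ≤⟨ ^-monoʳ-≤ 2 j+s≤i ⟩
        2 ^ i                   ∎) }
    where
    open ≤-Reasoning
    open +-*-Solver using (solve; _:=_; _:+_; _:*_; con)
    g≤G : g ≤ G
    g≤G = subst (g ≤_) (m∸n+n≡m k≤G) g≤
    double : ∀ c g δ → c * g * (δ + δ) ≡ (2 * c) * (g * δ)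
    double = solve 3 (λ c g δ → c :* g :* (δ :+ δ) := (con 2 :* c) :* (g :* δ)) refl
    shuffle : ∀ c N G R → N * R * (c * G) ≡ N * (c * (G * R))
    shuffle = solve 4 (λ c N G R → N :* R :* (c :* G) := N :* (c :* (G :* R))) refl

  -- Twice the hypothesis contains the term 8 J W, at most N W, which cancels one of the two copies
  -- of N W on the left. It is applied with N = 2 ^ k, so `k` has to be about log J.
  absorb : ∀ c J W N S → 8 * J ≤ N → 0 < N → N * W ≤ J * (4 * W) + N * (c * S) → W ≤ (2 * c) * S
  absorb c J W N S 8J≤N 0<N le = *-cancelˡ-≤ N {{>-nonZero 0<N}} (+-cancelˡ-≤ (N * W) _ _ (begin
    N * W + N * W                                       ≤⟨ +-mono-≤ le le ⟩
    J * (4 * W) + N * (c * S) + (J * (4 * W) + N * (c * S)) ≡⟨ solve 5 (λ c J W N S → J :* (con 4 :* W) :+ N :* (c :* S) :+ (J :* (con 4 :* W) :+ N :* (c :* S)) :=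
                                                            con 8 :* J :* W :+ N :* ((con 2 :* c) :* S)) refl c J W N S ⟩
    8 * J * W + N * ((2 * c) * S)                       ≤⟨ +-monoˡ-≤ _ (*-monoˡ-≤ W 8J≤N) ⟩
    N * W + N * ((2 * c) * S)                             ∎))
    where
    open ≤-Reasoning
    open +-*-Solver using (solve; _:=_; _:+_; _:*_; con)

  ⟦⟧-split : ∀ {P : Set} (d : Dec P) {N a b} → (¬ P → N ≤ a) → (P → N ≤ b) → N ≤ a + ⟦ d ⟧ * b
  ⟦⟧-split (yes p) {a = a} _ f = ≤-trans (f p) (≤-trans (≤-reflexive (sym (+-identityʳ _))) (m≤n+m _ a))
  ⟦⟧-split (no ¬p)         f _ = ≤-trans (f ¬p) (m≤m+n _ _)

  -- The point set On u δ stands for an interval of length δ starting at u.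
  record Line {n M : ℕ} (S : Potentials n M) : Set₁ where
    open Potentials S
    field
      Point    : Set
      points   : List Point
      On       : Fin n → ℕ → Point → Set
      on?      : ∀ u δ x → Dec (On u δ x)
      room     : Fin n → ℕ
      on-count : ∀ u δ → δ ≤ room u → δ ≤ ∑ points (λ x → ⟦ on? u δ x ⟧)
      on-near  : ∀ {u v δ δ′ x} → On u δ x → On v δ′ x → Near (δ ⊔ δ′) u v
      room-src : ∀ e → 2 ^ lev (proj₁ e) ≤ room (src e)

  -- Charging the picks to the tours and to the total cost.

  module Charging {n M : ℕ} (S : Potentials n M)
                  (seg-near : ∀ σ → Potentials.Near S (2 ^ suc (Potentials.lev S σ))
                                      (Potentials.src S (σ , false)) (Potentials.src S (σ , true)))
                  (line : Line S) (m J k G R s : ℕ)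
                  (m≤lev : ∀ σ → m ≤ Potentials.lev S σ) (lev<m+J : ∀ σ → Potentials.lev S σ < m + J)
                  (1≤k : 1 ≤ k) (k≤G : k ≤ G) (8J≤ : 8 * J ≤ 2 ^ k) (64G≤ : 64 * G ≤ 2 ^ m)
                  (3G<R : suc (3 * G) ≤ R) (64GR≤ : 64 * (G * R) ≤ 2 ^ s)
                  (total : 2 * ∑ (allFin M) (λ σ → 2 ^ Potentials.lev S σ) < 2 ^ G) where
    open Potentials S
    open Line line
    open Density S seg-near

    W : ℕ
    W = ∑ (allFin M) (λ σ → 2 ^ lev σ)

    level : ℕ → ℕ
    level j = m + j

    E : ℕ → List (Fin M)
    E j = filter (λ σ → lev σ ≟ level j) (allFin M)

    abstract
      sc : ∀ j u → Scale k G R s (level j) (κ u (2 ^ level j * R))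
      sc j u = scale (level j) (κ u (2 ^ level j * R)) 1≤k k≤G
        (≤-trans 64G≤ (^-monoʳ-≤ 2 (m≤m+n m j))) 64GR≤
        (≤-<-trans (κ≤ u _) (<-≤-trans total (^-monoʳ-≤ 2 (m≤m+n G (level j)))))

    g δ : ℕ → Fin n → ℕ
    g j u = Scale.g (sc j u)
    δ j u = Scale.δ (sc j u)

    E⁻ : ∀ j {σ} → σ ∈ E j → lev σ ≡ level j
    E⁻ j i = proj₂ (∈-filter⁻ (λ σ → lev σ ≟ level j) {xs = allFin M} i)

    abstract
      picks : ∀ j → ∃ λ U → (∀ {u} → u ∈ U → u ∈ map src (darts (E j))) ×
              Separated (δ j) Near near? near-refl U ×
              (∀ {x} → x ∈ map src (darts (E j)) → Any (λ u → Near (4 * δ j u) u x) U)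
      picks j = packing (δ j) Near near? near-refl _ (map src (darts (E j))) ≤-refl

    U : ℕ → List (Fin n)
    U j = proj₁ (picks j)

    U-separated : ∀ j → Separated (δ j) Near near? near-refl (U j)
    U-separated j = proj₁ (proj₂ (proj₂ (picks j)))

    U-room : ∀ j {u} → u ∈ U j → 2 ^ level j ≤ room u
    U-room j u∈ with ∈-map⁻ src (proj₁ (proj₂ (picks j)) u∈)
    ... | (σ , b) , e∈ , refl = subst (λ i → 2 ^ i ≤ room (src (σ , b))) (E⁻ j (∈-darts⁻ e∈)) (room-src (σ , b))

    length-E : ∀ j → length (E j) ≤ 2 * length (U j)
    length-E j = length≤2picks (level j) G R (E j)
      (Unique.filter⁺ (λ σ → lev σ ≟ level j) (Unique.allFin⁺ M)) (E⁻ j) (g j) (δ j)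
      (λ u → Scale.g≤G (sc j u)) 3G<R (λ u → Scale.1≤gδ (sc j u)) (λ u → Scale.gδ≤ (sc j u))
      (λ u → Scale.sparse (sc j u)) (U j)
      (λ {e} e∈ → proj₂ (proj₂ (proj₂ (picks j))) (∈-map⁺ src (∈-darts⁺ (proj₂ e) e∈)))

    poor? : ∀ j → Decidable (λ u → κ u (2 * δ j u) < 2 ^ (k + level j))
    poor? j u = κ u (2 * δ j u) <? 2 ^ (k + level j)

    P : ℕ → List (Fin n)
    P j = filter (poor? j) (U j)

    P-poor : ∀ j {u} → u ∈ P j → κ u (2 * δ j u) < 2 ^ (k + level j)
    P-poor j u∈ = proj₂ (∈-filter⁻ (poor? j) {xs = U j} u∈)

    -- The charge of level `j` at `x`: a poor pick owes 2 ^ level j, at most 128 g δ, which is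
    -- spread as density `g` over its interval of length `δ`. By `active` at most one term is
    -- nonzero.
    H : ℕ → Point → ℕ
    H j x = ∑ (P j) (λ u → ⟦ on? u (δ j u) x ⟧ * g j u)

    -- Separation by four times the larger radius makes the balls of radius 2 δ around the picks
    -- disjoint, so no dart is counted twice; the 2 comes from the two darts of a segment.
    κ-picks : ∀ j → ∑ (U j) (λ u → κ u (2 * δ j u)) ≤ 2 * W
    κ-picks j = begin
      ∑ (U j) (λ u → ∑ allDarts (λ e → ⟦ near? (2 * δ j u) u (src e) ⟧ * weight e))
        ≡⟨ ∑-swap (U j) allDarts (λ u e → ⟦ near? (2 * δ j u) u (src e) ⟧ * weight e) ⟩
      ∑ allDarts (λ e → ∑ (U j) (λ u → ⟦ near? (2 * δ j u) u (src e) ⟧ * weight e))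
        ≤⟨ ∑-mono allDarts (λ {e} _ → once e) ⟩
      ∑ allDarts weight
        ≡⟨ ∑-darts (allFin M) (λ σ → 2 ^ lev σ) ⟩
      2 * W ∎
      where
      open ≤-Reasoning
      radii : ∀ a b → 2 * a + 2 * b ≤ 4 * (a ⊔ b)
      radii a b = ≤-trans (+-mono-≤ (*-monoʳ-≤ 2 (m≤m⊔n a b)) (*-monoʳ-≤ 2 (m≤n⊔m a b)))
                          (≤-reflexive (sym (*-distribʳ-+ (a ⊔ b) 2 2)))
      once : ∀ e → ∑ (U j) (λ u → ⟦ near? (2 * δ j u) u (src e) ⟧ * weight e) ≤ weight e
      once e with ∑-atMostOne (λ u → near? (2 * δ j u) u (src e)) (U j) (λ _ → weight e)
                    (AllPairs.map (λ {u} {v} far (p , p′) → far (near-mono (radii (δ j u) (δ j v)) (near-trans p (near-sym p′)))) (U-separated j))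
      ... | inj₁ eq = ≤-trans (≤-reflexive eq) z≤n
      ... | inj₂ (_ , _ , _ , eq) = ≤-reflexive eq

    ∑-P : ∀ j → ∑ (P j) (λ u → g j u * δ j u) ≤ ∑ points (H j)
    ∑-P j = begin
      ∑ (P j) (λ u → g j u * δ j u)
        ≤⟨ ∑-mono (P j) (λ {u} u∈ → *-monoʳ-≤ (g j u) (on-count u (δ j u) (≤-trans (δ≤ u) (U-room j (proj₁ (∈-filter⁻ (poor? j) {xs = U j} u∈)))))) ⟩
      ∑ (P j) (λ u → g j u * ∑ points (λ x → ⟦ on? u (δ j u) x ⟧))
        ≡⟨ ∑-cong (P j) (λ {u} _ → trans (sym (∑-*ˡ (g j u) points (λ x → ⟦ on? u (δ j u) x ⟧)))
             (∑-cong points (λ {x} _ → *-comm (g j u) ⟦ on? u (δ j u) x ⟧))) ⟩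
      ∑ (P j) (λ u → ∑ points (λ x → ⟦ on? u (δ j u) x ⟧ * g j u))
        ≡⟨ ∑-swap (P j) points (λ u x → ⟦ on? u (δ j u) x ⟧ * g j u) ⟩
      ∑ points (H j) ∎
      where
      open ≤-Reasoning
      δ≤ : ∀ u → δ j u ≤ 2 ^ level j
      δ≤ u = ≤-trans (m≤n*m (δ j u) (g j u) {{>-nonZero (≤-trans 1≤k (Scale.k≤g (sc j u)))}})
                     (≤-trans (m≤n*m (g j u * δ j u) 64) (Scale.gδ≤ (sc j u)))

    -- A rich pick has mass at least 2 ^ (k + level j) in its own ball, and these balls are
    -- disjoint; a poor pick is paid by its interval. The rich picks leave 4 W at every level, which
    -- `absorb` removes after the sum over all levels.
    level-cost : ∀ j → 2 ^ k * (length (E j) * 2 ^ level j) ≤ 4 * W + 2 ^ k * (256 * ∑ points (H j))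
    level-cost j = begin
      2 ^ k * (length (E j) * 2 ^ level j)                  ≤⟨ *-monoʳ-≤ (2 ^ k) (*-monoˡ-≤ (2 ^ level j) (length-E j)) ⟩
      2 ^ k * (2 * length (U j) * 2 ^ level j)              ≡⟨ regroup (2 ^ k) (length (U j)) (2 ^ level j) ⟩
      2 * (length (U j) * (2 ^ k * 2 ^ level j))            ≡⟨ cong (λ z → 2 * (length (U j) * z)) (^-distribˡ-+-* 2 k (level j)) ⟨
      2 * (length (U j) * 2 ^ (k + level j))                ≡⟨ cong (2 *_) (∑-const _ (U j)) ⟨
      2 * ∑ (U j) (λ _ → 2 ^ (k + level j))                 ≤⟨ *-monoʳ-≤ 2 (∑-mono (U j) (λ {u} _ → pointwise u)) ⟩
      2 * ∑ (U j) (λ u → κ u (2 * δ j u) + ⟦ poor? j u ⟧ * (2 ^ k * (128 * (g j u * δ j u))))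
        ≡⟨ cong (2 *_) (∑-+ (U j) (λ u → κ u (2 * δ j u)) (λ u → ⟦ poor? j u ⟧ * (2 ^ k * (128 * (g j u * δ j u))))) ⟩
      2 * (∑ (U j) (λ u → κ u (2 * δ j u)) + ∑ (U j) (λ u → ⟦ poor? j u ⟧ * (2 ^ k * (128 * (g j u * δ j u)))))
        ≤⟨ *-monoʳ-≤ 2 (+-mono-≤ (κ-picks j) (≤-reflexive (poor-sum))) ⟩
      2 * (2 * W + 2 ^ k * (128 * ∑ (P j) (λ u → g j u * δ j u)))
        ≤⟨ *-monoʳ-≤ 2 (+-monoʳ-≤ (2 * W) (*-monoʳ-≤ (2 ^ k) (*-monoʳ-≤ 128 (∑-P j)))) ⟩
      2 * (2 * W + 2 ^ k * (128 * ∑ points (H j)))          ≡⟨ collect 128 W (2 ^ k) (∑ points (H j)) ⟩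
      4 * W + 2 ^ k * (256 * ∑ points (H j))                ∎
      where
      open ≤-Reasoning
      open +-*-Solver using (solve; _:=_; _:+_; _:*_; con)
      regroup : ∀ K u N → K * (2 * u * N) ≡ 2 * (u * (K * N))
      regroup = solve 3 (λ K u N → K :* (con 2 :* u :* N) := con 2 :* (u :* (K :* N))) refl
      collect : ∀ c W K S → 2 * (2 * W + K * (c * S)) ≡ 4 * W + K * ((2 * c) * S)
      collect = solve 4 (λ c W K S → con 2 :* (con 2 :* W :+ K :* (c :* S)) := con 4 :* W :+ K :* ((con 2 :* c) :* S)) refl
      pointwise : ∀ u → 2 ^ (k + level j) ≤ κ u (2 * δ j u) + ⟦ poor? j u ⟧ * (2 ^ k * (128 * (g j u * δ j u)))
      pointwise u = ⟦⟧-split (poor? j u) ≮⇒≥ (λ _ →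
        ≤-trans (≤-reflexive (^-distribˡ-+-* 2 k (level j))) (*-monoʳ-≤ (2 ^ k) (Scale.≤gδ (sc j u))))
      poor-sum : ∑ (U j) (λ u → ⟦ poor? j u ⟧ * (2 ^ k * (128 * (g j u * δ j u)))) ≡ 2 ^ k * (128 * ∑ (P j) (λ u → g j u * δ j u))
      poor-sum = trans (sym (∑-filter (poor? j) (U j) _)) (trans (∑-*ˡ (2 ^ k) (P j) _) (cong (2 ^ k *_) (∑-*ˡ 128 (P j) _)))

    W≤levels : W ≤ ∑ (upTo J) (λ j → length (E j) * 2 ^ level j)
    W≤levels = begin
      ∑ (allFin M) (λ σ → 2 ^ lev σ)
        ≤⟨ ∑-mono (allFin M) (λ {σ} _ → own σ) ⟩
      ∑ (allFin M) (λ σ → ∑ (upTo J) (λ j → ⟦ lev σ ≟ level j ⟧ * 2 ^ lev σ))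
        ≡⟨ ∑-swap (allFin M) (upTo J) (λ σ j → ⟦ lev σ ≟ level j ⟧ * 2 ^ lev σ) ⟩
      ∑ (upTo J) (λ j → ∑ (allFin M) (λ σ → ⟦ lev σ ≟ level j ⟧ * 2 ^ lev σ))
        ≡⟨ ∑-cong (upTo J) (λ {j} _ → sym (∑-filter (λ σ → lev σ ≟ level j) (allFin M) (λ σ → 2 ^ lev σ))) ⟩
      ∑ (upTo J) (λ j → ∑ (E j) (λ σ → 2 ^ lev σ))
        ≤⟨ ∑-mono (upTo J) (λ {j} _ → ∑-≤ (2 ^ level j) (E j) (λ i → ≤-reflexive (cong (2 ^_) (E⁻ j i)))) ⟩
      ∑ (upTo J) (λ j → length (E j) * 2 ^ level j) ∎
      where
      open ≤-Reasoning
      own : ∀ σ → 2 ^ lev σ ≤ ∑ (upTo J) (λ j → ⟦ lev σ ≟ level j ⟧ * 2 ^ lev σ)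
      own σ = ≤-trans (⟦⟧-split (lev σ ≟ level (lev σ ∸ m)) {a = 0} (contradiction (sym eq)) (λ _ → ≤-refl))
                (∈⇒≤∑ (λ j → ⟦ lev σ ≟ level j ⟧ * 2 ^ lev σ) (∈-upTo⁺ j<J))
        where
        eq : m + (lev σ ∸ m) ≡ lev σ
        eq = m+[n∸m]≡n (m≤lev σ)
        j<J : lev σ ∸ m < J
        j<J = +-cancelˡ-< m _ _ (subst (_< m + J) (sym eq) (lev<m+J σ))

    module _ (x : Point) where

      -- Intervals with a common point start at picks within the larger `δ` of each other, which the
      -- separation excludes.
      active : ∀ j → H j x ≡ 0 ⊎ ∃ λ u → u ∈ P j × On u (δ j u) x × H j x ≡ g j u
      active j = ∑-atMostOne (λ u → on? u (δ j u) x) (P j) (g j)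
        (AllPairs.map (λ {u} {v} far (p , p′) → far (near-mono (m≤n*m (δ j u ⊔ δ j v) 4) (on-near p p′)))
          (AllPairs.filter⁺ (poor? j) (U-separated j)))

      H≤G : ∀ j → H j x ≤ G
      H≤G j with active j
      ... | inj₁ eq               = ≤-trans (≤-reflexive eq) z≤n
      ... | inj₂ (u , _ , _ , eq) = ≤-trans (≤-reflexive eq) (Scale.g≤G (sc j u))

      -- The ball that makes u dense at level i lies in the ball that is poor at level j.
      H-gap : ∀ i j → i + s ≤ j → H i x ≢ 0 → H j x ≢ 0 → H i x ≤ k + (j ∸ i)
      H-gap i j i+s≤j Hi Hj with active i | active j
      ... | inj₁ eq | _       = contradiction eq Hi
      ... | inj₂ _  | inj₁ eq = contradiction eq Hj
      ... | inj₂ (u , _ , on , eq) | inj₂ (v , v∈ , on′ , _) with Scale.minimal (sc i u)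
      ...   | inj₁ g≡k = ≤-trans (≤-reflexive (trans eq g≡k)) (m≤m+n k _)
      ...   | inj₂ dense = ≤-trans (≤-reflexive eq) (+-cancelʳ-≤ i _ _ (≤-pred (≰⇒> λ k+j<g+i →
                <⇒≱ (P-poor j v∈) (begin
                  2 ^ (k + level j)       ≤⟨ *-cancelˡ-≤ 2 (≤-trans (^-monoʳ-≤ 2 (exponents k+j<g+i)) dense) ⟩
                  κ u (2 ^ level i * R)   ≤⟨ κ-mono (λ p → near-mono bound (near-trans (near-sym uv) p)) ⟩
                  κ v (2 * δ j v)         ∎))))
        where
        open ≤-Reasoning
        i≤j : i ≤ j
        i≤j = ≤-trans (m≤m+n i s) i+s≤j
        below : 2 ^ level i * R ≤ δ j v
        below = Scale.below (sc j v) (level i) (subst (_≤ level j) (sym (+-assoc m i s)) (+-monoʳ-≤ m i+s≤j))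
        δ≤ : δ i u ≤ δ j v
        δ≤ = ≤-trans (≤-trans (m≤n*m (δ i u) (g i u) {{>-nonZero (≤-trans 1≤k (Scale.k≤g (sc i u)))}})
               (≤-trans (m≤n*m (g i u * δ i u) 64) (Scale.gδ≤ (sc i u))))
               (≤-trans (m≤m*n (2 ^ level i) R {{>-nonZero (≤-trans (s≤s z≤n) 3G<R)}}) below)
        uv : Near (δ j v) u v
        uv = near-mono (≤-reflexive (m≤n⇒m⊔n≡n δ≤)) (on-near on on′)
        bound : δ j v + 2 ^ level i * R ≤ 2 * δ j v
        bound = +-monoʳ-≤ (δ j v) (≤-trans below (≤-reflexive (sym (+-identityʳ _))))
        exponents : k + (j ∸ i) + i < g i u + i → suc (k + level j) ≤ g i u + level i
        exponents lt = begin
          suc (k + (m + j))             ≡⟨ cong (λ z → suc (k + (m + z))) (m∸n+n≡m i≤j) ⟨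
          suc (k + (m + (j ∸ i + i)))   ≡⟨ solve 4 (λ k m d i → con 1 :+ (k :+ (m :+ (d :+ i))) := m :+ (con 1 :+ (k :+ d :+ i))) refl k m (j ∸ i) i ⟩
          m + suc (k + (j ∸ i) + i)     ≤⟨ +-monoʳ-≤ m lt ⟩
          m + (g i u + i)               ≡⟨ solve 3 (λ m g i → m :+ (g :+ i) := g :+ (m :+ i)) refl m (g i u) i ⟩
          g i u + (m + i)               ∎
          where open +-*-Solver using (solve; _:=_; _:+_; _:*_; con)

    W≤ : .{{_ : NonZero s}} → W ≤ 512 * (length points * ((J + s) * (k + s) + s * G))
    W≤ = ≤-trans (absorb 256 J W (2 ^ k) (∑ (upTo J) (λ j → ∑ points (H j))) 8J≤ (m^n>0 2 k) (begin
        2 ^ k * W                                                         ≤⟨ *-monoʳ-≤ (2 ^ k) W≤levels ⟩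
        2 ^ k * ∑ (upTo J) (λ j → length (E j) * 2 ^ level j)             ≡⟨ ∑-*ˡ (2 ^ k) (upTo J) _ ⟨
        ∑ (upTo J) (λ j → 2 ^ k * (length (E j) * 2 ^ level j))           ≤⟨ ∑-mono (upTo J) (λ {j} _ → level-cost j) ⟩
        ∑ (upTo J) (λ j → 4 * W + 2 ^ k * (256 * ∑ points (H j)))         ≡⟨ ∑-+ (upTo J) (λ _ → 4 * W) (λ j → 2 ^ k * (256 * ∑ points (H j))) ⟩
        ∑ (upTo J) (λ _ → 4 * W) + ∑ (upTo J) (λ j → 2 ^ k * (256 * ∑ points (H j)))
          ≡⟨ cong₂ _+_ (trans (∑-const (4 * W) (upTo J)) (cong (_* (4 * W)) (length-applyUpTo id J)))
               (trans (∑-*ˡ (2 ^ k) (upTo J) _) (cong (2 ^ k *_) (∑-*ˡ 256 (upTo J) _))) ⟩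
        J * (4 * W) + 2 ^ k * (256 * ∑ (upTo J) (λ j → ∑ points (H j)))  ∎))
      (*-monoʳ-≤ 512 (begin
        ∑ (upTo J) (λ j → ∑ points (H j))               ≡⟨ ∑-swap (upTo J) points H ⟩
        ∑ points (λ x → ∑ (upTo J) (λ j → H j x))       ≤⟨ ∑-≤ ((J + s) * (k + s) + s * G) points (λ {x} _ → ≤-trans (≤-reflexive (∑-upTo J (λ j → H j x)))
                                                             (spread k s G J (λ j → H j x) (H≤G x) (H-gap x))) ⟩
        length points * ((J + s) * (k + s) + s * G)     ∎))
      where open ≤-Reasoning

import Algebra.Definitions.RawSemiring as RawSemiringDefinitions
import Algebra.Properties.CommutativeSemigroup as CommutativeSemigroupProperties
import Algebra.Properties.Monoid.Mult as Mult
import Algebra.Properties.Ring as RingProperties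
import Algebra.Properties.Semiring.Mult as SemiringMult
open import Algebra.Bundles using (Semiring)
open import Data.Bool.Base using (true; false)
open import Data.Fin.Base as Fin using (Fin)
import Data.Fin.Properties as Fin
open import Data.List.Base as List
  using (List; []; _∷_; _++_; filter; zip; drop; map; foldr; allFin; concatMap; upTo)
import Data.List.Properties as List
import Data.List.Membership.DecPropositional as DecMembership
open import Data.List.Membership.Propositional using (_∈_; lose)
open import Data.List.Membership.Propositional.Properties
  using (∈-++⁻; ∈-++⁺ˡ; ∈-++⁺ʳ; ∈-filter⁺; ∈-filter⁻; ∈-map⁺; ∈-map⁻; ∈-allFin; ∈-concatMap⁺; ∈-upTo⁺; ∈-upTo⁻; ∈-lookup)
import Data.List.Relation.Binary.Sublist.Propositional as Sublist
open import Data.List.Relation.Unary.All as All using (All; []; _∷_)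
import Data.List.Relation.Unary.All.Properties as All
open import Data.List.Relation.Unary.AllPairs using (AllPairs; []; _∷_)
import Data.List.Relation.Unary.AllPairs.Properties as AllPairs
open import Data.List.Relation.Unary.Any as Any using (here; there)
open import Data.List.Relation.Unary.Unique.Propositional using (Unique)
import Data.List.Relation.Unary.Unique.Propositional.Properties as Unique
open import Data.Nat.Base using (zero; suc)
import Data.Nat.ListAction as ListAction
import Data.Nat.Properties as ℕ
open import Data.Nat.Solver using (module +-*-Solver)
open import Data.Product.Base using (∃; _,_; proj₁; proj₂; uncurry)
open import Data.Product.Properties using (,-injectiveʳ)
open import Data.Sum.Base using (inj₁; inj₂)
open import Data.Vec.Base using ([]; _∷_)
open import Data.Vec.Relation.Binary.Pointwise.Inductive as Pointwise using (Pointwise; []; _∷_)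
open import Data.Vec.Relation.Unary.All as VecAll using ([]; _∷_)
open import Data.Vec.Relation.Unary.Linked using (Linked; [-]; _∷_)
open import Function.Base using (_∘_; id; case_of_)
open import Relation.Binary.Bundles using (Poset)
open import Relation.Binary.PropositionalEquality as ≡ using (_≡_; _≢_)
import Relation.Binary.Reasoning.PartialOrder as PartialOrderReasoning
open import Relation.Binary.Structures using (IsDecTotalOrder)
open import Relation.Nullary using (¬_; Dec; yes; no; contradiction)
open import Relation.Nullary.Decidable using (decidable-stable; _×-dec_)
open import Relation.Unary using (Decidable)
open Combinatorics using (∑; ∑-++; ⟦_⟧; ∑-filter-length; ∑-*ˡ; ∑-≤; length-⊆; Potentials; Dart; Line; module Charging)

-- Ordered field arithmetic and decidability from suprema.

module OrderedField (R : RealNumbers) where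
  open RealNumbers R public renaming (Carrier to ℝ) hiding (zero)
  open RawSemiringDefinitions (Semiring.rawSemiring semiring) public using (_^_) renaming (_×_ to _·_)
  open IsDecTotalOrder isDecTotalOrder public
    using (_≤?_; total) renaming (refl to ≤-refl; reflexive to ≤-reflexive; trans to ≤-trans; antisym to ≤-antisym)
  open Mult +-monoid public using (×-congʳ; ×-homo-+; ×-assocˡ)
  open RingProperties ring using (-‿distribˡ-*; -‿involutive)

  poset : Poset _ _ _
  poset = record { isPartialOrder = IsDecTotalOrder.isPartialOrder isDecTotalOrder }

  module ≤-Reasoning = PartialOrderReasoning poset

  +-mono-≤ : ∀ {a b c d} → a ≤ b → c ≤ d → a + c ≤ b + d
  +-mono-≤ {a} {b} {c} {d} a≤b c≤d = begin
    a + c ≤⟨ +-monoʳ-≤ a c≤d ⟩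
    a + d ≈⟨ +-comm a d ⟩
    d + a ≤⟨ +-monoʳ-≤ d a≤b ⟩
    d + b ≈⟨ +-comm d b ⟩
    b + d ∎
    where open ≤-Reasoning

  +-monoˡ-≤ : ∀ z {x y} → x ≤ y → x + z ≤ y + z
  +-monoˡ-≤ z x≤y = +-mono-≤ x≤y ≤-refl

  +-cancelˡ-≤ : ∀ z {x y} → z + x ≤ z + y → x ≤ y
  +-cancelˡ-≤ z {x} {y} h = begin
    x             ≈⟨ undo x ⟨
    - z + (z + x) ≤⟨ +-monoʳ-≤ (- z) h ⟩
    - z + (z + y) ≈⟨ undo y ⟩
    y             ∎
    where
    open ≤-Reasoning
    undo : ∀ u → - z + (z + u) ≈ u
    undo u = trans (sym (+-assoc (- z) z u)) (trans (+-congʳ (-‿inverseˡ z)) (+-identityˡ u))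

  +-cancelʳ-≤ : ∀ z {x y} → x + z ≤ y + z → x ≤ y
  +-cancelʳ-≤ z {x} {y} h = +-cancelˡ-≤ z (begin
    z + x ≈⟨ +-comm z x ⟩
    x + z ≤⟨ h ⟩
    y + z ≈⟨ +-comm y z ⟩
    z + y ∎)
    where open ≤-Reasoning

  x≤x+y : ∀ {x y} → 0# ≤ y → x ≤ x + y
  x≤x+y {x} {y} 0≤y = begin
    x      ≈⟨ +-identityʳ x ⟨
    x + 0# ≤⟨ +-monoʳ-≤ x 0≤y ⟩
    x + y  ∎
    where open ≤-Reasoning

  x≤y+x : ∀ {x y} → 0# ≤ y → x ≤ y + x
  x≤y+x {x} {y} 0≤y = ≤-trans (x≤x+y 0≤y) (≤-reflexive (+-comm x y))

  0≤+ : ∀ {x y} → 0# ≤ x → 0# ≤ y → 0# ≤ x + y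
  0≤+ 0≤x 0≤y = ≤-trans 0≤x (x≤x+y 0≤y)

  x≤y⇒0≤y-x : ∀ {x y} → x ≤ y → 0# ≤ y - x
  x≤y⇒0≤y-x {x} {y} h = ≤-trans (≤-reflexive (sym (-‿inverseʳ x))) (+-monoˡ-≤ (- x) h)

  *-monoˡ-≤ : ∀ {z x y} → 0# ≤ z → x ≤ y → z * x ≤ z * y
  *-monoˡ-≤ {z} {x} {y} 0≤z x≤y = begin
    z * x                 ≤⟨ x≤x+y (*-nonNegative 0≤z (x≤y⇒0≤y-x x≤y)) ⟩
    z * x + z * (y - x)   ≈⟨ distribˡ z x (y - x) ⟨
    z * (x + (y - x))     ≈⟨ *-congˡ (trans (+-comm x (y - x)) (trans (+-assoc y (- x) x) (trans (+-congˡ (-‿inverseˡ x)) (+-identityʳ y)))) ⟩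
    z * y                 ∎
    where open ≤-Reasoning

  *-mono-≤ : ∀ {a b c d} → 0# ≤ b → 0# ≤ c → a ≤ b → c ≤ d → a * c ≤ b * d
  *-mono-≤ {a} {b} {c} {d} 0≤b 0≤c a≤b c≤d = begin
    a * c ≈⟨ *-comm a c ⟩
    c * a ≤⟨ *-monoˡ-≤ 0≤c a≤b ⟩
    c * b ≈⟨ *-comm c b ⟩
    b * c ≤⟨ *-monoˡ-≤ 0≤b c≤d ⟩
    b * d ∎
    where open ≤-Reasoning

  0≤1 : 0# ≤ 1#
  0≤1 with total 0# 1#
  ... | inj₁ h = h
  ... | inj₂ h = begin
    0#            ≤⟨ *-nonNegative 0≤-1 0≤-1 ⟩
    - 1# * - 1#   ≈⟨ -‿distribˡ-* 1# (- 1#) ⟨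
    - (1# * - 1#) ≈⟨ -‿cong (*-identityˡ (- 1#)) ⟩
    - - 1#        ≈⟨ -‿involutive 1# ⟩
    1#            ∎
    where
    open ≤-Reasoning
    0≤-1 : 0# ≤ - 1#
    0≤-1 = ≤-trans (x≤y⇒0≤y-x h) (≤-reflexive (+-identityˡ (- 1#)))

  1≰0 : ¬ (1# ≤ 0#)
  1≰0 h = 0≉1 (≤-antisym 0≤1 h)

  ≰⇒≥ : ∀ {x y} → ¬ (x ≤ y) → y ≤ x
  ≰⇒≥ {x} {y} h with total x y
  ... | inj₁ p = contradiction p h
  ... | inj₂ p = p

  <⇒≱ : ∀ {x y} → x < y → ¬ (y ≤ x)
  <⇒≱ (h , ne) p = ne (≤-antisym h p)

  ≰⇒> : ∀ {x y} → ¬ (x ≤ y) → y < x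
  ≰⇒> h = ≰⇒≥ h , λ eq → h (≤-reflexive (sym eq))

  ·-nonNeg : ∀ m {ε} → 0# ≤ ε → 0# ≤ m · ε
  ·-nonNeg zero    h = ≤-refl
  ·-nonNeg (suc m) h = 0≤+ h (·-nonNeg m h)

  ·-monoˡ-≤ : ∀ {ε m m′} → 0# ≤ ε → m ℕ.≤ m′ → m · ε ≤ m′ · ε
  ·-monoˡ-≤ {m′ = m′} h ℕ.z≤n      = ·-nonNeg m′ h
  ·-monoˡ-≤           h (ℕ.s≤s le) = +-monoʳ-≤ _ (·-monoˡ-≤ h le)

  ·-monoʳ-≤ : ∀ m {x y} → x ≤ y → m · x ≤ m · y
  ·-monoʳ-≤ zero    h = ≤-refl
  ·-monoʳ-≤ (suc m) h = +-mono-≤ h (·-monoʳ-≤ m h)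

  ·-cancel-≤ : ∀ {ε m m′} → 0# < ε → m · ε ≤ m′ · ε → m ℕ.≤ m′
  ·-cancel-≤ {ε} {m} {m′} 0<ε h = ℕ.≮⇒≥ λ lt → <⇒≱ 0<ε (+-cancelʳ-≤ (m′ · ε) (begin
    ε + m′ · ε  ≤⟨ ·-monoˡ-≤ (proj₁ 0<ε) lt ⟩
    m · ε       ≤⟨ h ⟩
    m′ · ε      ≈⟨ +-identityˡ (m′ · ε) ⟨
    0# + m′ · ε ∎))
    where open ≤-Reasoning

  fromℕ-* : ∀ m x → fromℕ m * x ≈ m · x
  fromℕ-* zero    x = zeroˡ x
  fromℕ-* (suc m) x = trans (distribʳ x 1# (m · 1#)) (+-cong (*-identityˡ x) (fromℕ-* m x))

  -- The supremum of {0} ∪ {1 | A} decides ¬ A.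
  dec-¬ : (A : Set) → Dec (¬ A)
  dec-¬ A = decide (sup P ≤? 0#)
    where
    P : ℝ → Set
    P x = x ≈ 0# ⊎ (x ≈ 1# × A)
    ≤1 : IsUpperBound P 1#
    ≤1 x (inj₁ e)       = ≤-trans (≤-reflexive e) 0≤1
    ≤1 x (inj₂ (e , _)) = ≤-reflexive e
    decide : Dec (sup P ≤ 0#) → Dec (¬ A)
    decide (yes h) = yes λ a → 1≰0 (≤-trans (sup-upperBound P (0# , inj₁ refl) (1# , ≤1) 1# (inj₂ (refl , a))) h)
    decide (no h)  = no λ ¬a → h (sup-least P (0# , inj₁ refl) 0# λ
      { x (inj₁ e) → ≤-reflexive e ; x (inj₂ (_ , a)) → contradiction a ¬a })

  -- Stability of `P` reduces the universal statement to the absence of counterexamples, which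
  -- `dec-¬` decides. This makes comparison with all walks, an infinite family, decidable.
  ∀? : {X : Set} {P : X → Set} → Decidable P → Dec (∀ x → P x)
  ∀? {X} {P} P? = decide (dec-¬ (∃ λ x → ¬ P x))
    where
    decide : Dec (¬ ∃ λ x → ¬ P x) → Dec (∀ x → P x)
    decide (yes h) = yes λ x → decidable-stable (P? x) (λ ¬p → h (x , ¬p))
    decide (no h)  = no λ all → h (λ (x , ¬p) → ¬p (all x))

  module _ {P : ℕ → Set} (P? : Decidable P) where

    -- The value is also 0 when no positive number up to the bound satisfies `P`; hence the premise
    -- `0 < largest m` of `largest-holds`.
    largest : ℕ → ℕ
    largest zero    = zero
    largest (suc m) with P? (suc m)
    ... | yes _ = suc m
    ... | no  _ = largest m

    largest-≤ : ∀ m → largest m ℕ.≤ m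
    largest-≤ zero    = ℕ.z≤n
    largest-≤ (suc m) with P? (suc m)
    ... | yes _ = ℕ.≤-refl
    ... | no  _ = ℕ.m≤n⇒m≤1+n (largest-≤ m)

    largest-holds : ∀ m → 0 ℕ.< largest m → P (largest m)
    largest-holds (suc m) h with P? (suc m)
    ... | yes p = p
    ... | no  _ = largest-holds m h

    ≤-largest : ∀ {m b} → m ℕ.≤ b → P m → m ℕ.≤ largest b
    ≤-largest {zero}  _ _ = ℕ.z≤n
    ≤-largest {suc m} {suc b} le p with P? (suc b)
    ... | yes _ = le
    ... | no ¬p with ℕ.m≤n⇒m<n∨m≡n le
    ...   | inj₁ lt     = ≤-largest (ℕ.≤-pred lt) p
    ...   | inj₂ ≡.refl = contradiction p ¬p

-- Walks, their lengths and loop erasure.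

module Walks (R : RealNumbers) where
  open OrderedField R
  open SteinerForest R

  module _ {n : ℕ} where

    NonNegative : Edges n → Set
    NonNegative E = All (λ e → 0# ≤ weight e) E

    ConnectsWithin : ℝ → Edges n → Edges n → Set
    ConnectsWithin x F E = ∀ {u v} → Walk F u v → ∃ λ (w : Walk E u v) → length w < x

    joins-sym : ∀ {e : Edge n} {u v} → Joins e u v → Joins e v u
    joins-sym (inj₁ (p , q)) = inj₂ (p , q)
    joins-sym (inj₂ (p , q)) = inj₁ (p , q)

    module _ {E : Edges n} where

      infixr 5 _▷_

      _▷_ : ∀ {u v t} → Walk E u v → Walk E v t → Walk E u t
      stop         ▷ q = q
      step e i j p ▷ q = step e i j (p ▷ q)

      length-▷ : ∀ {u v t} (p : Walk E u v) (q : Walk E v t) → length (p ▷ q) ≈ length p + length q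
      length-▷ stop           q = sym (+-identityˡ _)
      length-▷ (step e i j p) q = trans (+-congˡ (length-▷ p q)) (sym (+-assoc _ _ _))

      single : ∀ {u v} (e : Edge n) → e ∈ E → Joins e u v → Walk E u v
      single e i j = step e i j stop

      reverse : ∀ {u v} → Walk E u v → Walk E v u
      reverse stop           = stop
      reverse (step e i j p) = reverse p ▷ single e i (joins-sym {e = e} j)

      length-reverse : ∀ {u v} (p : Walk E u v) → length (reverse p) ≈ length p
      length-reverse stop           = refl
      length-reverse (step e i j p) = trans (length-▷ (reverse p) _)
        (trans (+-cong (length-reverse p) (+-identityʳ _)) (+-comm _ _))

      length-nonNeg : NonNegative E → ∀ {u v} (p : Walk E u v) → 0# ≤ length p
      length-nonNeg nn stop           = ≤-refl
      length-nonNeg nn (step e i j p) = 0≤+ (All.lookup nn i) (length-nonNeg nn p)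

      start∈ : ∀ {u v} (p : Walk E u v) → u ∈ vertices p
      start∈ stop           = here ≡.refl
      start∈ (step _ _ _ _) = here ≡.refl

      record Split {u t} (p : Walk E u t) (v : Fin n) : Set where
        field
          prefix : Walk E u v
          suffix : Walk E v t
          exact  : length prefix + length suffix ≈ length p
          covers : ∀ {x} → x ∈ vertices p → x ∈ vertices prefix ⊎ x ∈ vertices suffix
          unique : IsPath p → IsPath suffix

      split : ∀ {u t v} (p : Walk E u t) → v ∈ vertices p → Split p v
      split stop (here ≡.refl) = record
        { prefix = stop ; suffix = stop ; exact = +-identityˡ _ ; covers = inj₁ ; unique = id }
      split p@(step _ _ _ _) (here ≡.refl) = record
        { prefix = stop ; suffix = p ; exact = +-identityˡ _ ; covers = inj₂ ; unique = id }
      split (step e i j p) (there v∈) = record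
        { prefix = step e i j s.prefix ; suffix = s.suffix
        ; exact  = trans (+-assoc _ _ _) (+-congˡ s.exact)
        ; covers = λ { (here eq) → inj₁ (here eq) ; (there x∈) → case s.covers x∈ of λ
                         { (inj₁ k) → inj₁ (there k) ; (inj₂ k) → inj₂ k } }
        ; unique = λ { (_ ∷ uniq) → s.unique uniq } }
        where module s = Split (split p v∈)

      erase : NonNegative E → ∀ {u v} (p : Walk E u v) →
              ∃ λ (q : Walk E u v) → IsPath q × length q ≤ length p
      erase nn stop = stop , [] ∷ [] , ≤-refl
      erase nn {u} (step e i j p) with erase nn p
      ... | q , path , le with Any.any? (u Fin.≟_) (vertices q)
      ...   | no u∉  = step e i j q , All.¬Any⇒All¬ _ u∉ ∷ path , +-monoʳ-≤ _ le
      ...   | yes u∈ = s.suffix , s.unique path ,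
                       ≤-trans (x≤y+x (length-nonNeg nn s.prefix))
                         (≤-trans (≤-reflexive s.exact) (≤-trans le (x≤y+x (All.lookup nn i))))
        where module s = Split (split q u∈)

    embed : ∀ {E E′ : Edges n} → (∀ {e} → e ∈ E → e ∈ E′) → ∀ {u v} → Walk E u v → Walk E′ u v
    embed sub stop           = stop
    embed sub (step e i j p) = step e (sub i) j (embed sub p)

    length-embed : ∀ {E E′ : Edges n} (sub : ∀ {e} → e ∈ E → e ∈ E′) {u v} (p : Walk E u v) →
                   length (embed {E} {E′} sub p) ≈ length p
    length-embed sub stop           = refl
    length-embed sub (step e i j p) = +-congˡ (length-embed sub p)

    -- A shortest path is minimal among paths by definition; loop erasure extends this to walks, so
    -- that concatenations can be compared with it directly.
    shortest-≤ : ∀ {E : Edges n} → NonNegative E → ∀ {s t} {p : Walk E s t} →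
                 IsShortestPath p → ∀ (q : Walk E s t) → length p ≤ length q
    shortest-≤ nn (_ , best) q = let q′ , path , le = erase nn q in ≤-trans (best q′ path) le

module _ {A B : Set} where

  ∈-zip⁻ : ∀ (xs : List A) (ys : List B) {x y} → (x , y) ∈ zip xs ys → x ∈ xs × y ∈ ys
  ∈-zip⁻ (x ∷ xs) (y ∷ ys) (here ≡.refl) = here ≡.refl , here ≡.refl
  ∈-zip⁻ (x ∷ xs) (y ∷ ys) (there i) = let j , k = ∈-zip⁻ xs ys i in there j , there k

∈-drop₁ : {A : Set} (xs : List A) {x : A} → x ∈ drop 1 xs → x ∈ xs
∈-drop₁ (_ ∷ xs) i = there i

-- Cutting a served path into segments with potentials.

module Segments (R : RealNumbers) {n : ℕ}
                (E F : SteinerForest.Edges R n) (nonNeg : Walks.NonNegative R E)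
                (ε : RealNumbers.Carrier R) (0<ε : RealNumbers._<_ R (RealNumbers.0# R) ε) (m J : ℕ) where
  open SteinerForest R
  open OrderedField R
  open Walks R
  open DecMembership (Fin._≟_ {n}) using (_∈?_)

  0≤ε : 0# ≤ ε
  0≤ε = proj₁ 0<ε

  -- Its purpose is a lower bound for the tour through `v`: that tour also visits the mate, so it is
  -- at least `x` long.
  Mated : ℝ → Fin n → Set
  Mated x v = ∃ λ v′ → Walk F v v′ × (∀ (w : Walk E v v′) → x ≤ length w)

  mated-mono : ∀ {x y v} → x ≤ y → Mated y v → Mated x v
  mated-mono le (v′ , w , far) = v′ , w , λ p → ≤-trans le (far p)

  -- Of the length of the segment, the lower bound survives as `ψ-b` and the upper bound as `mid≤`.
  -- Although `ψ` comes from the graph with the shortcuts of its time, `lip` refers to the original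
  -- graph, which all segments share.
  record Segment : Set where
    field
      a b     : Fin n
      lev     : ℕ
      ψ       : Fin n → ℕ
      m≤lev   : m ℕ.≤ lev
      lev<m+J : lev ℕ.< m ℕ.+ J
      ψ-a     : ψ a ≡ 0
      ψ-b     : ψ b ≡ 2 ℕ.^ lev
      lip     : ∀ {u v} (w : Walk E u v) j → length w ≤ j · ε → ψ v ℕ.≤ ψ u ℕ.+ j
      mid     : Walk E a b
      mid≤    : length mid ≤ (2 ℕ.^ suc lev) · ε
      mated-a : Mated ((2 ℕ.^ lev) · ε) a
      mated-b : Mated ((2 ℕ.^ lev) · ε) b

  Collapses : Segment → Fin n → Fin n → Set
  Collapses τ u v = Segment.ψ τ u ≡ Segment.ψ τ v

  Dominates : Segment → Segment → Set
  Dominates τ σ = Collapses τ (Segment.a σ) (Segment.b σ)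

  weights : List Segment → ℕ
  weights segs = ∑ segs (λ σ → 2 ℕ.^ suc (Segment.lev σ))

  findLevel : ∀ d {ℓ} → (2 ℕ.^ m) · ε ≤ ℓ → ℓ < (2 ℕ.^ (m ℕ.+ d)) · ε →
              ∃ λ l → m ℕ.≤ l × l ℕ.< m ℕ.+ d × (2 ℕ.^ l) · ε ≤ ℓ × ℓ ≤ (2 ℕ.^ suc l) · ε
  findLevel zero    {ℓ} lo hi = contradiction lo (<⇒≱ (≡.subst (λ z → ℓ < (2 ℕ.^ z) · ε) (ℕ.+-identityʳ m) hi))
  findLevel (suc d) {ℓ} lo hi with (2 ℕ.^ (m ℕ.+ d)) · ε ≤? ℓ
  ... | yes p = m ℕ.+ d , ℕ.m≤m+n m d , ℕ.+-monoʳ-< m (ℕ.n<1+n d) , p ,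
                ≡.subst (λ z → ℓ ≤ (2 ℕ.^ z) · ε) (ℕ.+-suc m d) (proj₁ hi)
  ... | no ¬p with findLevel d lo (≰⇒> ¬p)
  ...   | l , m≤l , l< , p , q = l , m≤l , ℕ.<-trans l< (ℕ.+-monoʳ-< m (ℕ.n<1+n d)) , p , q

  module Serve (S : Edges n) (seen : List (Fin n)) {s t : Fin n}
               (S-ends : ∀ {e} → e ∈ S → end₁ e ∈ seen × end₂ e ∈ seen)
               (S-free : ∀ {e} → e ∈ S → weight e ≈ 0#)
               (p : Walk (E ++ S) s t) (shortest : ∀ (q : Walk (E ++ S) s t) → length p ≤ length q)
               (short : length p < (2 ℕ.^ (m ℕ.+ J)) · ε)
               (mated : ∀ {v} → v ∈ s ∷ t ∷ seen → Mated (length p) v) where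

    marks : List (Fin n)
    marks = s ∷ t ∷ seen

    nonNeg⁺ : NonNegative (E ++ S)
    nonNeg⁺ = All.++⁺ nonNeg (All.tabulate (λ i → ≤-reflexive (sym (S-free i))))

    0≤length : ∀ {u v} (w : Walk (E ++ S) u v) → 0# ≤ length w
    0≤length = length-nonNeg nonNeg⁺

    widen : ∀ {u v} → Walk E u v → Walk (E ++ S) u v
    widen = embed ∈-++⁺ˡ

    length-widen : ∀ {u v} (w : Walk E u v) → length (widen w) ≈ length w
    length-widen = length-embed ∈-++⁺ˡ

    record Piece : Set where
      field
        a b   : Fin n
        pre   : Walk (E ++ S) s a
        mid   : Walk E a b
        post  : Walk (E ++ S) b t
        exact : length pre + (length mid + length post) ≈ length p
        a∈    : a ∈ marks
        b∈    : b ∈ marks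

    open Piece

    Before : Piece → Piece → Set
    Before x y = length (pre x) + length (mid x) ≤ length (pre y)

    total-mid : List Piece → ℝ
    total-mid = foldr (λ x r → length (mid x) + r) 0#

    after : ∀ {x} → Walk (E ++ S) x t → List (Fin n)
    after w = filter (_∈? marks) (drop 1 (vertices w))

    vertices-head : ∀ {x} (w : Walk (E ++ S) x t) → vertices w ≡ x ∷ drop 1 (vertices w)
    vertices-head stop           = ≡.refl
    vertices-head (step _ _ _ _) = ≡.refl

    -- `M` lists the marks still ahead and `lo` is the length already behind. `chain` puts the ends
    -- of every piece at consecutive marks, which is where `rule₃` adds its shortcuts.
    record Decomposition (u : Fin n) (M : List (Fin n)) (lo tot : ℝ) : Set where
      field
        pieces  : List Piece
        sum     : tot ≈ total-mid pieces
        count   : List.length pieces ℕ.≤ List.length M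
        ordered : AllPairs Before pieces
        lower   : ∀ {x} → x ∈ pieces → lo ≤ length (pre x)
        chain   : ∀ {x} → x ∈ pieces → (a x , b x) ∈ zip (u ∷ M) M

    after-step-∈ : ∀ {x y} (e : Edge n) i (j : Joins e x y) (w : Walk (E ++ S) y t) → y ∈ marks →
                   after (step e i j w) ≡ y ∷ after w
    after-step-∈ e i j w y∈ = ≡.trans (≡.cong (filter (_∈? marks)) (vertices-head w))
                                      (List.filter-accept (_∈? marks) y∈)

    after-step-∉ : ∀ {x y} (e : Edge n) i (j : Joins e x y) (w : Walk (E ++ S) y t) → ¬ (y ∈ marks) →
                   after (step e i j w) ≡ after w
    after-step-∉ e i j w y∉ = ≡.trans (≡.cong (filter (_∈? marks)) (vertices-head w))
                                      (List.filter-reject (_∈? marks) y∉)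

    ends : ∀ {e x y} → e ∈ S → Joins e x y → x ∈ marks × y ∈ marks
    ends i (inj₁ (≡.refl , ≡.refl)) = there (there (proj₁ (S-ends i))) , there (there (proj₂ (S-ends i)))
    ends i (inj₂ (≡.refl , ≡.refl)) = there (there (proj₂ (S-ends i))) , there (there (proj₁ (S-ends i)))

    -- `mid` is the stretch since the last mark `u`. Both ends of a shortcut are marks, so a
    -- shortcut is only met when that stretch is trivial: pieces consist of edges of `E` alone, and
    -- shortcuts add no length.
    decompose : ∀ {u x} (pre : Walk (E ++ S) s u) (mid : Walk E u x) (rest : Walk (E ++ S) x t) →
                length pre + (length mid + length rest) ≈ length p → u ∈ marks →
                ¬ (x ∈ marks) ⊎ (u ≡ x × length mid ≈ 0#) →
                Decomposition u (after rest) (length pre) (length mid + length rest)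
    decompose pre mid stop eq u∈ (inj₁ t∉) = contradiction (there (here ≡.refl)) t∉
    decompose pre mid stop eq u∈ (inj₂ (_ , mid≈0)) = record
      { pieces = [] ; sum = trans (+-identityʳ _) mid≈0 ; count = ℕ.z≤n ; ordered = []
      ; lower = λ () ; chain = λ () }
    decompose {u} {x} pre mid (step {v = y} e i j rest) eq u∈ fresh
      with ∈-++⁻ E i | y ∈? marks
    ... | inj₂ e∈S | no y∉  = contradiction (proj₂ (ends e∈S j)) y∉
    ... | inj₂ e∈S | yes y∈ = case fresh of λ
            { (inj₁ x∉) → contradiction (proj₁ (ends e∈S j)) x∉
            ; (inj₂ (≡.refl , mid≈0)) → through mid≈0 }
      where
      through : length mid ≈ 0# → Decomposition u (after (step e i j rest)) (length pre) (length mid + (weight e + length rest))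
      through mid≈0 = record
        { pieces = D.pieces ; sum = trans tot D.sum
        ; count = ≡.subst (λ M → List.length D.pieces ℕ.≤ List.length M) (≡.sym M≡) (ℕ.m≤n⇒m≤1+n D.count)
        ; ordered = D.ordered
        ; lower = λ k → ≤-trans (x≤x+y (0≤length (widen mid ▷ single e i j))) (≤-trans (≤-reflexive (sym (length-▷ pre _))) (D.lower k))
        ; chain = λ {z} k → ≡.subst (λ M → (a z , b z) ∈ zip (u ∷ M) M) (≡.sym M≡) (there (D.chain k)) }
        where
        M≡ = after-step-∈ e i j rest y∈
        pre′ = pre ▷ (widen mid ▷ single e i j)
        tot : length mid + (weight e + length rest) ≈ 0# + length rest
        tot = trans (+-cong mid≈0 (trans (+-congʳ (S-free e∈S)) (+-identityˡ _))) refl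
        eq′ : length pre′ + (0# + length rest) ≈ length p
        eq′ = trans (+-cong (length-▷ pre _) (sym tot)) (trans (+-congʳ (trans (+-congˡ free) (+-identityʳ _))) eq)
          where
          free : length (widen mid ▷ single e i j) ≈ 0#
          free = trans (length-▷ (widen mid) _) (trans (+-cong (trans (length-widen mid) mid≈0)
                   (trans (+-identityʳ _) (S-free e∈S))) (+-identityʳ _))
        module D = Decomposition (decompose pre′ stop rest eq′ y∈ (inj₂ (≡.refl , refl)))
    ... | inj₁ e∈E | no y∉ = record
            { pieces = D.pieces ; sum = trans (sym assoc′) D.sum
            ; count = ≡.subst (λ M → List.length D.pieces ℕ.≤ List.length M) (≡.sym M≡) D.count
            ; ordered = D.ordered ; lower = D.lower
            ; chain = λ {z} k → ≡.subst (λ M → (a z , b z) ∈ zip (u ∷ M) M) (≡.sym M≡) (D.chain k) }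
      where
      M≡ = after-step-∉ e i j rest y∉
      mid′ = mid ▷ single e e∈E j
      assoc′ : length mid′ + length rest ≈ length mid + (weight e + length rest)
      assoc′ = trans (+-congʳ (trans (length-▷ mid _) (+-congˡ (+-identityʳ _)))) (+-assoc _ _ _)
      module D = Decomposition (decompose pre mid′ rest (trans (+-congˡ assoc′) eq) u∈ (inj₁ y∉))
    ... | inj₁ e∈E | yes y∈ = record
            { pieces = piece ∷ D.pieces
            ; sum = trans (sym assoc′) (+-congˡ (trans (sym (+-identityˡ _)) D.sum))
            ; count = ≡.subst (λ M → suc (List.length D.pieces) ℕ.≤ List.length M) (≡.sym M≡) (ℕ.s≤s D.count)
            ; ordered = All.tabulate (λ k → ≤-trans (≤-reflexive (sym pre′≈)) (D.lower k)) ∷ D.ordered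
            ; lower = λ { (here ≡.refl) → ≤-refl
                        ; (there k) → ≤-trans (x≤x+y (0≤length (widen mid′))) (≤-trans (≤-reflexive (sym (length-▷ pre _))) (D.lower k)) }
            ; chain = λ {z} k → ≡.subst (λ M → (a z , b z) ∈ zip (u ∷ M) M) (≡.sym M≡) (chain k) }
      where
      M≡ = after-step-∈ e i j rest y∈
      mid′ = mid ▷ single e e∈E j
      assoc′ : length mid′ + length rest ≈ length mid + (weight e + length rest)
      assoc′ = trans (+-congʳ (trans (length-▷ mid _) (+-congˡ (+-identityʳ _)))) (+-assoc _ _ _)
      piece : Piece
      piece = record { a = u ; b = y ; pre = pre ; mid = mid′ ; post = rest
                     ; exact = trans (+-congˡ assoc′) eq ; a∈ = u∈ ; b∈ = y∈ }
      pre′ = pre ▷ widen mid′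
      pre′≈ : length pre′ ≈ length pre + length mid′
      pre′≈ = trans (length-▷ pre _) (+-congˡ (length-widen mid′))
      eq′ : length pre′ + (0# + length rest) ≈ length p
      eq′ = trans (+-cong pre′≈ (+-identityˡ _)) (trans (+-assoc _ _ _) (exact piece))
      module D = Decomposition (decompose pre′ stop rest eq′ y∈ (inj₂ (≡.refl , refl)))
      chain : ∀ {z} → z ∈ piece ∷ D.pieces → (a z , b z) ∈ zip (u ∷ y ∷ after rest) (y ∷ after rest)
      chain (here ≡.refl) = here ≡.refl
      chain (there k)     = there (D.chain k)

    whole : Decomposition s (after p) 0# (0# + length p)
    whole = decompose stop stop p (trans (+-identityˡ _) (+-identityˡ _)) (here ≡.refl) (inj₂ (≡.refl , refl))
    open Decomposition whole public

    marked≡ : filter (_∈? marks) (vertices p) ≡ s ∷ after p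
    marked≡ = ≡.trans (≡.cong (filter (_∈? marks)) (vertices-head p)) (List.filter-accept (_∈? marks) (here ≡.refl))

    rule₃≡ : rule₃ seen p ≡ map shortcut (zip (s ∷ after p) (after p))
    rule₃≡ = ≡.cong (λ M → map shortcut (zip M (drop 1 M))) marked≡

    shortcut∈ : ∀ {x} → x ∈ pieces → shortcut (a x , b x) ∈ rule₃ seen p
    shortcut∈ x∈ = ≡.subst (_ ∈_) (≡.sym rule₃≡) (∈-map⁺ shortcut (Decomposition.chain whole x∈))

    rule₃-ends : ∀ {e} → e ∈ rule₃ seen p → end₁ e ∈ marks × end₂ e ∈ marks
    rule₃-ends e∈ with ∈-map⁻ shortcut e∈
    ... | (u , v) , uv∈ , ≡.refl with ∈-zip⁻ (filter (_∈? marks) (vertices p)) _ uv∈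
    ...   | u∈ , v∈ = proj₂ (∈-filter⁻ (_∈? marks) {xs = vertices p} u∈) ,
                      proj₂ (∈-filter⁻ (_∈? marks) {xs = vertices p} (∈-drop₁ _ v∈))

    rule₃-free : ∀ {e} → e ∈ rule₃ seen p → weight e ≈ 0#
    rule₃-free e∈ with ∈-map⁻ shortcut e∈
    ... | _ , _ , ≡.refl = refl

    count-pieces : IsPath p → List.length pieces ℕ.≤ List.length marks
    count-pieces path = ℕ.≤-trans count (ℕ.≤-trans (ℕ.n≤1+n _) (≡.subst (λ M → List.length M ℕ.≤ List.length marks) marked≡
      (length-⊆ (Unique.filter⁺ (_∈? marks) path) (λ i → proj₂ (∈-filter⁻ (_∈? marks) {xs = vertices p} i)))))

    -- The distance from s in excess of α, in units of ε, rounded down and truncated at cap.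
    module Potential (α : ℝ) (cap : ℕ) where

      Beyond : Fin n → ℕ → Set
      Beyond u k = ∀ (w : Walk (E ++ S) s u) → α + k · ε ≤ length w

      beyond? : ∀ u k → Dec (Beyond u k)
      beyond? u k = ∀? (λ w → α + k · ε ≤? length w)

      ψ : Fin n → ℕ
      ψ u = largest (beyond? u) cap

      -- A walk from `s` to `u` continued by `w` reaches `v`, so whatever multiple is guaranteed at
      -- `v` is guaranteed at `u` up to `j` units. Since `j` is an integer, rounding down adds no
      -- error.
      ψ-lip : ∀ {u v} (w : Walk (E ++ S) u v) j → length w ≤ j · ε → ψ v ℕ.≤ ψ u ℕ.+ j
      ψ-lip {u} {v} w j w≤ with ψ v ℕ.≤? j
      ... | yes le = ℕ.≤-trans le (ℕ.m≤n+m j (ψ u))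
      ... | no  gt = ℕ.≤-trans (ℕ.≤-reflexive (≡.sym (ℕ.m∸n+n≡m j≤)))
              (ℕ.+-monoˡ-≤ j (≤-largest (beyond? u) (ℕ.≤-trans (ℕ.m∸n≤m (ψ v) j) (largest-≤ (beyond? v) cap)) beyond))
        where
        j≤ = ℕ.<⇒≤ (ℕ.≰⇒> gt)
        beyond : Beyond u (ψ v ℕ.∸ j)
        beyond q = +-cancelʳ-≤ (j · ε) (begin
          α + (ψ v ℕ.∸ j) · ε + j · ε      ≈⟨ +-assoc _ _ _ ⟩
          α + ((ψ v ℕ.∸ j) · ε + j · ε)    ≈⟨ +-congˡ (×-homo-+ ε (ψ v ℕ.∸ j) j) ⟨
          α + (ψ v ℕ.∸ j ℕ.+ j) · ε        ≡⟨ ≡.cong (λ k → α + k · ε) (ℕ.m∸n+n≡m j≤) ⟩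
          α + ψ v · ε                      ≤⟨ largest-holds (beyond? v) cap (ℕ.≤-<-trans ℕ.z≤n (ℕ.≰⇒> gt)) (q ▷ w) ⟩
          length (q ▷ w)                   ≈⟨ length-▷ q w ⟩
          length q + length w              ≤⟨ +-monoʳ-≤ _ w≤ ⟩
          length q + j · ε                 ∎)
          where open ≤-Reasoning

      ψ-low : ∀ {u} (w : Walk (E ++ S) s u) → length w ≤ α → ψ u ≡ 0
      ψ-low {u} w w≤ with ψ u ℕ.≟ 0
      ... | yes e = e
      ... | no ne = contradiction (·-monoˡ-≤ 0≤ε (ℕ.n≢0⇒n>0 ne)) (λ 1ε≤ → <⇒≱ 0<ε (begin
              ε               ≈⟨ +-identityʳ ε ⟨
              1 · ε           ≤⟨ 1ε≤ ⟩
              ψ u · ε         ≤⟨ +-cancelˡ-≤ α (begin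
                α + ψ u · ε     ≤⟨ largest-holds (beyond? u) cap (ℕ.n≢0⇒n>0 ne) w ⟩
                length w        ≤⟨ w≤ ⟩
                α               ≈⟨ +-identityʳ α ⟨
                α + 0#          ∎) ⟩
              0#              ∎))
        where open ≤-Reasoning

      ψ-high : ∀ {u} → Beyond u cap → ψ u ≡ cap
      ψ-high {u} h = ℕ.≤-antisym (largest-≤ (beyond? u) cap) (≤-largest (beyond? u) ℕ.≤-refl h)

      ψ-shortcut : ∀ {e} → e ∈ S → ψ (end₁ e) ≡ ψ (end₂ e)
      ψ-shortcut {e} e∈ = ℕ.≤-antisym
        (≡.subst (ψ (end₁ e) ℕ.≤_) (ℕ.+-identityʳ _) (ψ-lip (single e (∈-++⁺ʳ E e∈) (inj₂ (≡.refl , ≡.refl))) 0 free))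
        (≡.subst (ψ (end₂ e) ℕ.≤_) (ℕ.+-identityʳ _) (ψ-lip (single e (∈-++⁺ʳ E e∈) (inj₁ (≡.refl , ≡.refl))) 0 free))
        where
        free : weight e + 0# ≤ 0#
        free = ≤-reflexive (trans (+-identityʳ _) (S-free e∈))

    mid≤p : ∀ x → length (mid x) ≤ length p
    mid≤p x = begin
      length (mid x)                                         ≤⟨ x≤x+y (0≤length (post x)) ⟩
      length (mid x) + length (post x)                       ≤⟨ x≤y+x (0≤length (pre x)) ⟩
      length (pre x) + (length (mid x) + length (post x))    ≈⟨ exact x ⟩
      length p                                               ∎
      where open ≤-Reasoning

    pre-shortest : ∀ x (w : Walk (E ++ S) s (a x)) → length (pre x) ≤ length w
    pre-shortest x w = +-cancelʳ-≤ (length (mid x) + length (post x)) (begin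
      length (pre x) + (length (mid x) + length (post x))  ≈⟨ exact x ⟩
      length p                                             ≤⟨ shortest (w ▷ (widen (mid x) ▷ post x)) ⟩
      length (w ▷ (widen (mid x) ▷ post x))                ≈⟨ trans (length-▷ w _) (+-congˡ (trans (length-▷ (widen (mid x)) _) (+-congʳ (length-widen (mid x))))) ⟩
      length w + (length (mid x) + length (post x))        ∎)
      where open ≤-Reasoning

    mid-shortest : ∀ x (w : Walk (E ++ S) s (b x)) → length (pre x) + length (mid x) ≤ length w
    mid-shortest x w = +-cancelʳ-≤ (length (post x)) (begin
      length (pre x) + length (mid x) + length (post x)    ≈⟨ trans (+-assoc _ _ _) (exact x) ⟩
      length p                                             ≤⟨ shortest (w ▷ post x) ⟩
      length (w ▷ post x)                                  ≈⟨ length-▷ w _ ⟩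
      length w + length (post x)                           ∎)
      where open ≤-Reasoning

    Big : Piece → Set
    Big x = (2 ℕ.^ m) · ε ≤ length (mid x)

    level : ∀ x → Big x → ∃ λ l → m ℕ.≤ l × l ℕ.< m ℕ.+ J × (2 ℕ.^ l) · ε ≤ length (mid x) × length (mid x) ≤ (2 ℕ.^ suc l) · ε
    level x big = findLevel J big (≤-trans (mid≤p x) (proj₁ short) , λ e → proj₂ short (≤-antisym (proj₁ short) (≤-trans (≤-reflexive (sym e)) (mid≤p x))))

    module Pot (x : Piece) (big : Big x) = Potential (length (pre x)) (2 ℕ.^ proj₁ (level x big))

    reach : ∀ x big {u} → (∀ (w : Walk (E ++ S) s u) → length (pre x) + length (mid x) ≤ length w) →
            Pot.ψ x big u ≡ 2 ℕ.^ proj₁ (level x big)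
    reach x big far = Pot.ψ-high x big (λ w → ≤-trans (+-monoʳ-≤ _ (proj₁ (proj₂ (proj₂ (proj₂ (level x big)))))) (far w))

    segment : ∀ x → Big x → Segment
    segment x big = record
      { a = a x ; b = b x ; lev = proj₁ l ; ψ = Pot.ψ x big
      ; m≤lev = proj₁ (proj₂ l) ; lev<m+J = proj₁ (proj₂ (proj₂ l))
      ; ψ-a = Pot.ψ-low x big (pre x) ≤-refl
      ; ψ-b = reach x big (mid-shortest x)
      ; lip = λ w j le → Pot.ψ-lip x big (widen w) j (≤-trans (≤-reflexive (length-widen w)) le)
      ; mid = mid x ; mid≤ = proj₂ (proj₂ (proj₂ (proj₂ l)))
      ; mated-a = mated-mono (≤-trans (proj₁ (proj₂ (proj₂ (proj₂ l)))) (mid≤p x)) (mated (a∈ x))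
      ; mated-b = mated-mono (≤-trans (proj₁ (proj₂ (proj₂ (proj₂ l)))) (mid≤p x)) (mated (b∈ x)) }
      where l = level x big

    -- Both ends of the later piece are at least as far from `s` as the end of `x`, and from that
    -- distance on the potential of `x` stays at its cap.
    dominates : ∀ x y bigx bigy → Before x y → Dominates (segment x bigx) (segment y bigy)
    dominates x y bigx bigy before = ≡.trans
      (reach x bigx (λ w → ≤-trans before (pre-shortest y w)))
      (≡.sym (reach x bigx (λ w → ≤-trans (≤-trans before (x≤x+y (≤-trans (0≤length (widen (mid y))) (≤-reflexive (length-widen (mid y))))))
                                  (mid-shortest y w))))

    -- Pieces shorter than 2 ^ m units yield no segment; the summand `List.length xs * 2 ^ m` in
    -- `covered` pays for them.
    record Extracted (xs : List Piece) : Set where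
      field
        segs     : List Segment
        origin   : ∀ {σ} → σ ∈ segs → ∃ λ x → ∃ λ big → x ∈ xs × σ ≡ segment x big
        dominate : AllPairs Dominates segs
        number   : List.length segs ℕ.≤ List.length xs
        covered  : total-mid xs ≤ (weights segs ℕ.+ List.length xs ℕ.* 2 ℕ.^ m) · ε

    extract : ∀ {xs} → AllPairs Before xs → Extracted xs
    extract [] = record { segs = [] ; origin = λ () ; dominate = [] ; number = ℕ.z≤n ; covered = ≤-refl }
    extract {x ∷ xs} (before ∷ ord) with (2 ℕ.^ m) · ε ≤? length (mid x) | extract ord
    ... | no small | X = record
      { segs = X.segs ; origin = λ k → let y , big , y∈ , e = X.origin k in y , big , there y∈ , e
      ; dominate = X.dominate ; number = ℕ.m≤n⇒m≤1+n X.number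
      ; covered = ≤-trans (+-mono-≤ (≰⇒≥ small) X.covered) (≤-reflexive
          (trans (sym (×-homo-+ ε (2 ℕ.^ m) _)) (reflexive (≡.cong (_· ε) (rearrange (2 ℕ.^ m) (weights X.segs) (List.length xs ℕ.* 2 ℕ.^ m)))))) }
      where
      module X = Extracted X
      rearrange : ∀ a b c → a ℕ.+ (b ℕ.+ c) ≡ b ℕ.+ (a ℕ.+ c)
      rearrange a b c = ≡.trans (≡.sym (ℕ.+-assoc a b c)) (≡.trans (≡.cong (ℕ._+ c) (ℕ.+-comm a b)) (ℕ.+-assoc b a c))
    ... | yes big | X = record
      { segs = segment x big ∷ X.segs
      ; origin = λ { (here ≡.refl) → x , big , here ≡.refl , ≡.refl
                   ; (there k) → let y , big′ , y∈ , e = X.origin k in y , big′ , there y∈ , e }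
      ; dominate = All.tabulate (λ k → let y , big′ , y∈ , e = X.origin k in
                     ≡.subst (Dominates (segment x big)) (≡.sym e) (dominates x y big big′ (All.lookup before y∈))) ∷ X.dominate
      ; number = ℕ.s≤s X.number
      ; covered = ≤-trans (+-mono-≤ (proj₂ (proj₂ (proj₂ (proj₂ (level x big))))) X.covered) (≤-trans (≤-reflexive
          (trans (sym (×-homo-+ ε N _)) (reflexive (≡.cong (_· ε) (≡.sym (ℕ.+-assoc N (weights X.segs) _))))))
          (·-monoˡ-≤ 0≤ε (ℕ.+-monoʳ-≤ (N ℕ.+ weights X.segs) (ℕ.m≤n+m (List.length xs ℕ.* 2 ℕ.^ m) (2 ℕ.^ m))))) }
      where
      module X = Extracted X
      N = 2 ℕ.^ suc (proj₁ (level x big))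

    served : Extracted pieces
    served = extract ordered

    served-S : ∀ {σ} → σ ∈ Extracted.segs served → ∀ {e} → e ∈ S → Collapses σ (end₁ e) (end₂ e)
    served-S σ∈ e∈ with Extracted.origin served σ∈
    ... | x , big , _ , ≡.refl = Pot.ψ-shortcut x big e∈

    served-shortcut : ∀ {σ} → σ ∈ Extracted.segs served → shortcut (Segment.a σ , Segment.b σ) ∈ rule₃ seen p
    served-shortcut σ∈ with Extracted.origin served σ∈
    ... | x , big , x∈ , ≡.refl = shortcut∈ x∈

    served-covered : length p ≤ (weights (Extracted.segs served) ℕ.+ List.length pieces ℕ.* 2 ℕ.^ m) · ε
    served-covered = ≤-trans (≤-reflexive (trans (sym (+-identityˡ _)) sum)) (Extracted.covered served)

-- Collecting the segments of a whole run.

module Runs (R : RealNumbers) {n : ℕ}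
            (E F : SteinerForest.Edges R n) (nonNeg : Walks.NonNegative R E)
            (ε : RealNumbers.Carrier R) (0<ε : RealNumbers._<_ R (RealNumbers.0# R) ε) (m J X : ℕ)
            (within : Walks.ConnectsWithin R (OrderedField._·_ R (2 ℕ.^ (m ℕ.+ J)) ε) F E) where
  open SteinerForest R
  open OrderedField R
  open Walks R
  open Segments R E F nonNeg ε 0<ε m J

  Far : Fin n × Fin n → ℝ → Set
  Far (s , t) β = Walk F s t × (∀ (w : Walk E s t) → β ≤ length w)

  -- `frees` is the invariant behind the priorities: the potentials of the pairs still to come are
  -- computed with the shortcuts of `S` present, hence are constant along them, and every older
  -- segment has its shortcut in `S` by then.
  record Outcome {k : ℕ} (S : Edges n) (cs : Vec ℝ k) : Set where
    field
      segs     : List Segment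
      dominate : AllPairs Dominates segs
      frees    : ∀ {σ} → σ ∈ segs → ∀ {e} → e ∈ S → Collapses σ (end₁ e) (end₂ e)
      number   : List.length segs ℕ.≤ k ℕ.* X
      covered  : cost cs ≤ (weights segs ℕ.+ k ℕ.* X ℕ.* 2 ℕ.^ m) · ε

  -- Newer segments come first in the list. All terminals seen so far have mates at distance at
  -- least `y`, the latest bound; as the bounds do not increase, this covers the present cost too.
  -- The last premise limits the number of marks on any path to `X`.
  run : ∀ {k seen S} {ps : Vec (Fin n × Fin n) k} {cs} {βs : Vec ℝ k} {y} → Greedy₃ E seen S ps cs →
        (∀ {e} → e ∈ S → end₁ e ∈ seen × end₂ e ∈ seen) → (∀ {e} → e ∈ S → weight e ≈ 0#) →
        (∀ {v} → v ∈ seen → Mated y v) → Linked (λ x y → y ≤ x) (y ∷ βs) →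
        Pointwise _≤_ cs βs → Pointwise Far ps βs → List.length seen ℕ.+ 2 ℕ.* k ℕ.≤ X →
        Outcome S cs
  run done _ _ _ _ _ _ _ = record
    { segs = [] ; dominate = [] ; frees = λ () ; number = ℕ.z≤n ; covered = ≤-refl }
  run {suc k} {seen} {S} {cs = c ∷ cs} {βs = β ∷ βs} {y} (serve {s = s} {t = t} p best rest)
      S-ends S-free mated (β≤y ∷ noninc) (c≤β ∷ cs≤) ((wF , far) ∷ fars) room = record
    { segs     = O.segs ++ X.segs
    ; dominate = AllPairs.++⁺ O.dominate X.dominate
                   (All.tabulate (λ τ∈ → All.tabulate (λ σ∈ → O.frees τ∈ (∈-++⁺ˡ (served-shortcut σ∈)))))
    ; frees    = λ σ∈ e∈ → case ∈-++⁻ O.segs σ∈ of λ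
                   { (inj₁ i) → O.frees i (∈-++⁺ʳ (rule₃ seen p) e∈) ; (inj₂ i) → served-S i e∈ }
    ; number   = begin
        List.length (O.segs ++ X.segs)             ≡⟨ List.length-++ O.segs ⟩
        List.length O.segs ℕ.+ List.length X.segs  ≤⟨ ℕ.+-mono-≤ O.number (ℕ.≤-trans X.number few) ⟩
        k ℕ.* X ℕ.+ X                              ≡⟨ ℕ.+-comm (k ℕ.* X) X ⟩
        suc k ℕ.* X                                ∎
    ; covered  = ≤-trans (+-mono-≤ (≤-trans served-covered (·-monoˡ-≤ 0≤ε (ℕ.+-monoʳ-≤ (weights X.segs) (ℕ.*-monoˡ-≤ (2 ℕ.^ m) few)))) O.covered)
                   (≤-reflexive (trans (sym (×-homo-+ ε (weights X.segs ℕ.+ X ℕ.* 2 ℕ.^ m) (weights O.segs ℕ.+ k ℕ.* X ℕ.* 2 ℕ.^ m)))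
                     (reflexive (≡.cong (_· ε) summed)))) }
    where
    open ℕ.≤-Reasoning
    c≤ : ∀ (w : Walk E s t) → length p ≤ length w
    c≤ w = ≤-trans c≤β (far w)
    nonNeg′ : NonNegative (E ++ S)
    nonNeg′ = All.tabulate (λ i → case ∈-++⁻ E i of λ
      { (inj₁ j) → All.lookup nonNeg j ; (inj₂ j) → ≤-reflexive (sym (S-free j)) })
    short : length p < (2 ℕ.^ (m ℕ.+ J)) · ε
    short = let w , le , ne = within wF in
      ≤-trans (c≤ w) le , λ e → ne (≤-antisym le (≤-trans (≤-reflexive (sym e)) (c≤ w)))
    mated′ : ∀ {v} → v ∈ s ∷ t ∷ seen → Mated β v
    mated′ (here ≡.refl)         = t , wF , far
    mated′ (there (here ≡.refl)) = s , reverse wF , λ w → ≤-trans (far (reverse w)) (≤-reflexive (length-reverse w))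
    mated′ (there (there v∈))    = mated-mono β≤y (mated v∈)
    open Serve S seen S-ends S-free p (shortest-≤ nonNeg′ best) short (λ v∈ → mated-mono c≤β (mated′ v∈))
    module X = Extracted served
    few : List.length pieces ℕ.≤ X
    few = ℕ.≤-trans (count-pieces (proj₁ best)) (ℕ.≤-trans
      (ℕ.≤-trans (ℕ.≤-reflexive (ℕ.+-comm 2 (List.length seen))) (ℕ.+-monoʳ-≤ (List.length seen) (ℕ.m≤m*n 2 (suc k)))) room)
    room′ : List.length (s ∷ t ∷ seen) ℕ.+ 2 ℕ.* k ℕ.≤ X
    room′ = ℕ.≤-trans (ℕ.≤-reflexive shift) room
      where
      shift : suc (suc (List.length seen)) ℕ.+ 2 ℕ.* k ≡ List.length seen ℕ.+ 2 ℕ.* suc k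
      shift = solve 2 (λ a k → con 2 :+ a :+ con 2 :* k := a :+ con 2 :* (con 1 :+ k)) ≡.refl (List.length seen) k
        where open +-*-Solver
    ends′ : ∀ {e} → e ∈ rule₃ seen p ++ S → end₁ e ∈ s ∷ t ∷ seen × end₂ e ∈ s ∷ t ∷ seen
    ends′ e∈ = case ∈-++⁻ (rule₃ seen p) e∈ of λ
      { (inj₁ i) → rule₃-ends i ; (inj₂ i) → there (there (proj₁ (S-ends i))) , there (there (proj₂ (S-ends i))) }
    free′ : ∀ {e} → e ∈ rule₃ seen p ++ S → weight e ≈ 0#
    free′ e∈ = case ∈-++⁻ (rule₃ seen p) e∈ of λ { (inj₁ i) → rule₃-free i ; (inj₂ i) → S-free i }
    module O = Outcome (run rest ends′ free′ mated′ noninc cs≤ fars room′)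
    summed : weights X.segs ℕ.+ X ℕ.* 2 ℕ.^ m ℕ.+ (weights O.segs ℕ.+ k ℕ.* X ℕ.* 2 ℕ.^ m) ≡
            weights (O.segs ++ X.segs) ℕ.+ suc k ℕ.* X ℕ.* 2 ℕ.^ m
    summed = ≡.trans
      (solve 5 (λ a x N b k → a :+ x :* N :+ (b :+ k :* x :* N) := b :+ a :+ (x :+ k :* x) :* N) ≡.refl
        (weights X.segs) X (2 ℕ.^ m) (weights O.segs) k)
      (≡.cong (ℕ._+ suc k ℕ.* X ℕ.* 2 ℕ.^ m) (≡.sym (∑-++ O.segs X.segs _)))
      where open +-*-Solver

-- Closed tours of a subgraph and positions on them.

module Tours (R : RealNumbers) where
  open SteinerForest R
  open OrderedField R
  open Walks R

  sumOver : {A : Set} → List A → (A → ℝ) → ℝ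
  sumOver xs f = foldr (λ x r → f x + r) 0# xs

  module _ {A : Set} where

    +-interchange : ∀ a b c d → (a + b) + (c + d) ≈ (a + c) + (b + d)
    +-interchange a b c d = trans (+-assoc a b _) (trans (+-congˡ (trans (sym (+-assoc b c d))
      (trans (+-congʳ (+-comm b c)) (+-assoc c b d)))) (sym (+-assoc a c _)))

    sumOver-+ : ∀ (xs : List A) f g → sumOver xs (λ x → f x + g x) ≈ sumOver xs f + sumOver xs g
    sumOver-+ []       f g = sym (+-identityˡ 0#)
    sumOver-+ (x ∷ xs) f g = trans (+-congˡ (sumOver-+ xs f g)) (+-interchange (f x) (g x) _ _)

    sumOver-cong : ∀ (xs : List A) {f g} → (∀ x → f x ≈ g x) → sumOver xs f ≈ sumOver xs g
    sumOver-cong []       h = refl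
    sumOver-cong (x ∷ xs) h = +-cong (h x) (sumOver-cong xs h)

    ≤-sumOver : ∀ {xs : List A} {f} → (∀ x → 0# ≤ f x) → ∀ {x} → x ∈ xs → f x ≤ sumOver xs f
    ≤-sumOver {y ∷ xs} {f} nn (here ≡.refl) = x≤x+y (nonNeg xs)
      where
      nonNeg : ∀ xs → 0# ≤ sumOver xs f
      nonNeg []       = ≤-refl
      nonNeg (x ∷ xs) = 0≤+ (nn x) (nonNeg xs)
    ≤-sumOver {y ∷ xs} nn (there i) = ≤-trans (≤-sumOver nn i) (x≤y+x (nn y))

  module _ {n : ℕ} where

    at : Fin n → ℝ → Fin n → ℝ
    at r x v with v Fin.≟ r
    ... | yes _ = x
    ... | no  _ = 0#

    sumOver-at-∉ : ∀ {xs r x} → All (r ≢_) xs → sumOver xs (at r x) ≈ 0#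
    sumOver-at-∉ [] = refl
    sumOver-at-∉ {v ∷ xs} {r} (ne ∷ nes) with v Fin.≟ r
    ... | yes eq = contradiction (≡.sym eq) ne
    ... | no  _  = trans (+-identityˡ _) (sumOver-at-∉ nes)

    sumOver-at : ∀ {xs r x} → Unique xs → r ∈ xs → sumOver xs (at r x) ≈ x
    sumOver-at {v ∷ xs} (ne ∷ u) (here ≡.refl) with v Fin.≟ v
    ... | yes _ = trans (+-congˡ (sumOver-at-∉ ne)) (+-identityʳ _)
    ... | no ¬e = contradiction ≡.refl ¬e
    sumOver-at {v ∷ xs} {r} (ne ∷ u) (there i) with v Fin.≟ r
    ... | yes ≡.refl = contradiction ≡.refl (All.lookup ne i)
    ... | no  _  = trans (+-identityˡ _) (sumOver-at u i)

    ∈-▷ˡ : ∀ {E : Edges n} {u v t x} (p : Walk E u v) (q : Walk E v t) → x ∈ vertices p → x ∈ vertices (p ▷ q)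
    ∈-▷ˡ stop           q (here ≡.refl) = start∈ q
    ∈-▷ˡ (step e i j p) q (here ≡.refl) = here ≡.refl
    ∈-▷ˡ (step e i j p) q (there k)     = there (∈-▷ˡ p q k)

    ∈-▷ʳ : ∀ {E : Edges n} {u v t x} (p : Walk E u v) (q : Walk E v t) → x ∈ vertices q → x ∈ vertices (p ▷ q)
    ∈-▷ʳ stop           q k = k
    ∈-▷ʳ (step e i j p) q k = there (∈-▷ʳ p q k)

    vertices-embed : ∀ {E E′ : Edges n} (sub : ∀ {e} → e ∈ E → e ∈ E′) {u v} (p : Walk E u v) →
                     vertices (embed {E = E} {E′} sub p) ≡ vertices p
    vertices-embed sub stop               = ≡.refl
    vertices-embed sub (step {u} e i j p) = ≡.cong (u ∷_) (vertices-embed sub p)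

    -- Closed walks, one for each component of F, that together traverse every edge at most twice.
    record Touring (F : Edges n) : Set where
      field
        comp   : Fin n → Fin n
        tour   : ∀ r → Walk F r r
        on     : ∀ v → v ∈ vertices (tour (comp v))
        joined : ∀ {e} → e ∈ F → comp (end₁ e) ≡ comp (end₂ e)
        twice  : sumOver (allFin n) (length ∘ tour) ≤ totalWeight F + totalWeight F

      connected⇒≡ : ∀ {u v} → Walk F u v → comp u ≡ comp v
      connected⇒≡ stop = ≡.refl
      connected⇒≡ (step e i (inj₁ (≡.refl , ≡.refl)) p) = ≡.trans (joined i) (connected⇒≡ p)
      connected⇒≡ (step e i (inj₂ (≡.refl , ≡.refl)) p) = ≡.trans (≡.sym (joined i)) (connected⇒≡ p)

    sumOver-0 : ∀ (xs : List (Fin n)) → sumOver xs (λ _ → 0#) ≈ 0#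
    sumOver-0 []       = refl
    sumOver-0 (x ∷ xs) = trans (+-identityˡ _) (sumOver-0 xs)

    module Merge (e : Edge n) (F : Edges n) (T : Touring F)
                 (apart : Touring.comp T (end₁ e) ≢ Touring.comp T (end₂ e)) where
      open Touring T

      a b ra rb : Fin n
      a = end₁ e
      b = end₂ e
      ra = comp a
      rb = comp b

      lift : ∀ {u v} → Walk F u v → Walk (e ∷ F) u v
      lift = embed there

      module A = Split (split (tour ra) (on a))
      module B = Split (split (tour rb) (on b))

      there-and-back : Walk (e ∷ F) a a
      there-and-back = step e (here ≡.refl) (inj₁ (≡.refl , ≡.refl))
        (lift B.suffix ▷ (lift B.prefix ▷ single e (here ≡.refl) (inj₂ (≡.refl , ≡.refl))))

      merged : Walk (e ∷ F) ra ra
      merged = lift A.prefix ▷ (there-and-back ▷ lift A.suffix)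

      extra : ℝ
      extra = length (tour rb) + (weight e + weight e)

      length-lift : ∀ {u v} (p : Walk F u v) → length (lift p) ≈ length p
      length-lift = length-embed there

      length-there-and-back : length there-and-back ≈ extra
      length-there-and-back = begin
        weight e + length (lift B.suffix ▷ (lift B.prefix ▷ back))
          ≈⟨ +-congˡ (trans (length-▷ (lift B.suffix) _) (+-cong (length-lift B.suffix) (trans (length-▷ (lift B.prefix) back) (+-cong (length-lift B.prefix) (+-identityʳ _))))) ⟩
        weight e + (length B.suffix + (length B.prefix + weight e))
          ≈⟨ +-congˡ (trans (sym (+-assoc _ _ _)) (+-congʳ (trans (+-comm _ _) B.exact))) ⟩
        weight e + (length (tour rb) + weight e)
          ≈⟨ trans (sym (+-assoc _ _ _)) (trans (+-congʳ (+-comm _ _)) (+-assoc _ _ _)) ⟩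
        extra ∎
        where
        open import Relation.Binary.Reasoning.Setoid setoid
        back = single e (here ≡.refl) (inj₂ (≡.refl , ≡.refl))

      length-merged : length merged ≈ length (tour ra) + extra
      length-merged = trans (length-▷ (lift A.prefix) _) (trans
        (+-cong (length-lift A.prefix) (trans (length-▷ there-and-back _) (+-cong length-there-and-back (length-lift A.suffix))))
        (trans (+-congˡ (+-comm _ _)) (trans (sym (+-assoc _ _ _)) (+-congʳ A.exact))))

      comp′ : Fin n → Fin n
      comp′ v with comp v Fin.≟ rb
      ... | yes _ = ra
      ... | no  _ = comp v

      tour′ : ∀ r → Walk (e ∷ F) r r
      tour′ r with r Fin.≟ ra | r Fin.≟ rb
      ... | yes ≡.refl | _     = merged
      ... | no _       | yes _ = stop
      ... | no _       | no _  = lift (tour r)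

      tour′-ra : tour′ ra ≡ merged
      tour′-ra with ra Fin.≟ ra | ra Fin.≟ rb
      ... | yes ≡.refl | _ = ≡.refl
      ... | no ne      | _ = contradiction ≡.refl ne

      ∈-lift : ∀ {u v x} (p : Walk F u v) → x ∈ vertices p → x ∈ vertices (lift p)
      ∈-lift p = ≡.subst (_ ∈_) (≡.sym (vertices-embed there p))

      merged-A : ∀ {x} → x ∈ vertices (tour ra) → x ∈ vertices merged
      merged-A x∈ = case A.covers x∈ of λ
        { (inj₁ k) → ∈-▷ˡ (lift A.prefix) _ (∈-lift A.prefix k)
        ; (inj₂ k) → ∈-▷ʳ (lift A.prefix) _ (∈-▷ʳ there-and-back _ (∈-lift A.suffix k)) }

      merged-B : ∀ {x} → x ∈ vertices (tour rb) → x ∈ vertices merged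
      merged-B x∈ = ∈-▷ʳ (lift A.prefix) _ (∈-▷ˡ there-and-back _ (there (case B.covers x∈ of λ
        { (inj₁ k) → ∈-▷ʳ (lift B.suffix) _ (∈-▷ˡ (lift B.prefix) _ (∈-lift B.prefix k))
        ; (inj₂ k) → ∈-▷ˡ (lift B.suffix) _ (∈-lift B.suffix k) })))

      tour′-∈ : ∀ r {x} → r ≢ rb → x ∈ vertices (tour r) → x ∈ vertices (tour′ r)
      tour′-∈ r ne x∈ with r Fin.≟ ra | r Fin.≟ rb
      ... | yes ≡.refl | _     = merged-A x∈
      ... | no _       | yes q = contradiction q ne
      ... | no _       | no _  = ∈-lift (tour r) x∈

      on′ : ∀ v → v ∈ vertices (tour′ (comp′ v))
      on′ v with comp v Fin.≟ rb
      ... | yes eq = ≡.subst (λ w → v ∈ vertices w) (≡.sym tour′-ra)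
                       (merged-B (≡.subst (λ r → v ∈ vertices (tour r)) eq (on v)))
      ... | no ne = tour′-∈ (comp v) ne (on v)

      joined′ : ∀ {f} → f ∈ e ∷ F → comp′ (end₁ f) ≡ comp′ (end₂ f)
      joined′ (here ≡.refl) with comp a Fin.≟ rb | comp b Fin.≟ rb
      ... | yes eq | _      = contradiction eq apart
      ... | no _   | yes _  = ≡.refl
      ... | no _   | no ne  = contradiction ≡.refl ne
      joined′ {f} (there i) with comp (end₁ f) Fin.≟ rb | comp (end₂ f) Fin.≟ rb
      ... | yes _ | yes _ = ≡.refl
      ... | no _  | no _  = joined i
      ... | yes p | no ne = contradiction (≡.trans (≡.sym (joined i)) p) ne
      ... | no ne | yes p = contradiction (≡.trans (joined i) p) ne

      -- The absorbed tour of `rb` is added on the left and the detour on the right, so that no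
      -- subtraction occurs; summed over all roots this yields `twice′`.
      balance : ∀ r → length (tour′ r) + at rb (length (tour rb)) r ≈ length (tour r) + at ra extra r
      balance r with r Fin.≟ ra | r Fin.≟ rb
      ... | yes ≡.refl | yes eq     = contradiction eq apart
      ... | yes ≡.refl | no _       = trans (+-identityʳ _) length-merged
      ... | no _       | yes ≡.refl = trans (+-identityˡ _) (sym (+-identityʳ _))
      ... | no _       | no _       = +-congʳ (length-lift (tour r))

      twice′ : sumOver (allFin n) (length ∘ tour′) ≤ totalWeight (e ∷ F) + totalWeight (e ∷ F)
      twice′ = +-cancelʳ-≤ (length (tour rb)) (begin
        Σ′ + length (tour rb)                        ≈⟨ +-congˡ (sumOver-at (Unique.allFin⁺ n) (∈-allFin rb)) ⟨
        Σ′ + sumOver (allFin n) (at rb (length (tour rb))) ≈⟨ sumOver-+ (allFin n) _ _ ⟨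
        sumOver (allFin n) (λ r → length (tour′ r) + at rb (length (tour rb)) r) ≈⟨ sumOver-cong (allFin n) balance ⟩
        sumOver (allFin n) (λ r → length (tour r) + at ra extra r) ≈⟨ sumOver-+ (allFin n) _ _ ⟩
        sumOver (allFin n) (length ∘ tour) + sumOver (allFin n) (at ra extra) ≤⟨ +-mono-≤ twice (≤-reflexive (sumOver-at (Unique.allFin⁺ n) (∈-allFin ra))) ⟩
        W + W + extra                                ≈⟨ +-congˡ (+-comm _ _) ⟩
        W + W + (weight e + weight e + length (tour rb)) ≈⟨ +-assoc _ _ _ ⟨
        W + W + (weight e + weight e) + length (tour rb) ≈⟨ +-congʳ (trans (+-comm _ _) (+-interchange {A = ℝ} (weight e) (weight e) W W)) ⟩
        (weight e + W) + (weight e + W) + length (tour rb) ∎)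
        where
        open ≤-Reasoning
        W = totalWeight F
        Σ′ = sumOver (allFin n) (length ∘ tour′)

      touring′ : Touring (e ∷ F)
      touring′ = record { comp = comp′ ; tour = tour′ ; on = on′ ; joined = joined′ ; twice = twice′ }

    touring : ∀ (F : Edges n) → NonNegative F → Touring F
    touring [] _ = record
      { comp = id ; tour = λ _ → stop ; on = λ _ → here ≡.refl ; joined = λ ()
      ; twice = ≤-reflexive (trans (sumOver-0 (allFin n)) (sym (+-identityˡ 0#))) }
    touring (e ∷ F) (0≤w ∷ nn) with touring F nn
    ... | T with Touring.comp T (end₁ e) Fin.≟ Touring.comp T (end₂ e)
    ...   | no apart = Merge.touring′ e F T apart
    -- An edge inside a component is left out of the tours; it only enlarges the bound.
    ...   | yes same = record
      { comp = comp ; tour = λ r → embed there (tour r)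
      ; on = λ v → ≡.subst (v ∈_) (≡.sym (vertices-embed there (tour (comp v)))) (on v)
      ; joined = λ { (here ≡.refl) → same ; (there i) → joined i }
      ; twice = ≤-trans (≤-reflexive (sumOver-cong (allFin n) (λ r → length-embed there (tour r))))
                  (≤-trans twice (+-mono-≤ (x≤y+x 0≤w) (x≤y+x 0≤w))) }
      where open Touring T

    offset : ∀ {E : Edges n} {u t v} (p : Walk E u t) → v ∈ vertices p → ℝ
    offset p v∈ = length (Split.prefix (split p v∈))

    between : ∀ {E : Edges n} {r t u v} (p : Walk E r t) (u∈ : u ∈ vertices p) (v∈ : v ∈ vertices p) →
              (∃ λ (w : Walk E u v) → offset p u∈ + length w ≈ offset p v∈) ⊎
              (∃ λ (w : Walk E v u) → offset p v∈ + length w ≈ offset p u∈)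
    between stop             (here ≡.refl) (here ≡.refl) = inj₁ (stop , +-identityˡ _)
    between (step e i j p) (here ≡.refl) (here ≡.refl) = inj₁ (stop , +-identityˡ _)
    between (step e i j p) (here ≡.refl) (there v∈)    = inj₁ (step e i j (Split.prefix (split p v∈)) , +-identityˡ _)
    between (step e i j p) (there u∈)    (here ≡.refl) = inj₂ (step e i j (Split.prefix (split p u∈)) , +-identityˡ _)
    between (step e i j p) (there u∈)    (there v∈)    = case between p u∈ v∈ of λ
      { (inj₁ (w , eq)) → inj₁ (w , trans (+-assoc _ _ _) (+-congˡ eq))
      ; (inj₂ (w , eq)) → inj₂ (w , trans (+-assoc _ _ _) (+-congˡ eq)) }

    offset≤ : ∀ {E : Edges n} → NonNegative E → ∀ {u t v} (p : Walk E u t) (v∈ : v ∈ vertices p) →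
              offset p v∈ ≤ length p
    offset≤ nn p v∈ = ≤-trans (x≤x+y (length-nonNeg nn (Split.suffix (split p v∈)))) (≤-reflexive (Split.exact (split p v∈)))

AllPairs-lookup : {A : Set} {R : A → A → Set} {xs : List A} → AllPairs R xs →
                  ∀ {i j} → i Fin.< j → R (List.lookup xs i) (List.lookup xs j)
AllPairs-lookup (a ∷ _)  {Fin.zero}  {Fin.suc j} _          = All.lookup a (∈-lookup j)
AllPairs-lookup (_ ∷ ps) {Fin.suc i} {Fin.suc j} (ℕ.s≤s lt) = AllPairs-lookup ps lt

∑-lookup : {A : Set} (xs : List A) (f : A → ℕ) → ∑ (allFin (List.length xs)) (f ∘ List.lookup xs) ≡ ∑ xs f
∑-lookup xs f = ≡.cong ListAction.sum (≡.trans (List.map-tabulate id (f ∘ List.lookup xs))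
  (≡.trans (≡.sym (List.map-tabulate (List.lookup xs) f)) (≡.cong (map f) (List.tabulate-lookup xs))))

-- Discretised positions and intervals on the tours.

module Positions (R : RealNumbers) {n : ℕ}
                 (E F : SteinerForest.Edges R n) (nonNegF : Walks.NonNegative R F) (F⊆E : ∀ {e} → e ∈ F → e ∈ E)
                 (ε : RealNumbers.Carrier R) (0<ε : RealNumbers._<_ R (RealNumbers.0# R) ε) (B : ℕ) (T≤ : RealNumbers._≤_ R (SteinerForest.totalWeight R F) (OrderedField._·_ R B ε)) where
  open SteinerForest R
  open OrderedField R
  open Walks R
  open Tours R
  open Touring (touring F nonNegF) public

  0≤ε : 0# ≤ ε
  0≤ε = proj₁ 0<ε

  multiple? : ∀ x k → Dec (k · ε ≤ x)
  multiple? x k = k · ε ≤? x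

  -- The cut-off 2 B is the bound on all tour lengths in units of `ε`.
  floor : ℝ → ℕ
  floor x = largest (multiple? x) (2 ℕ.* B)

  floor≤ : ∀ {x} → 0# ≤ x → floor x · ε ≤ x
  floor≤ {x} 0≤x with floor x ℕ.≟ 0
  ... | yes e = ≤-trans (≤-reflexive (reflexive (≡.cong (_· ε) e))) 0≤x
  ... | no ne = largest-holds (multiple? x) (2 ℕ.* B) (ℕ.n≢0⇒n>0 ne)

  <floor : ∀ {x} → x ≤ (2 ℕ.* B) · ε → x < suc (floor x) · ε
  <floor {x} x≤ with suc (floor x) · ε ≤? x
  ... | no ¬p = ≰⇒> ¬p
  ... | yes p = contradiction (≤-largest (multiple? x) {b = 2 ℕ.* B} (·-cancel-≤ 0<ε (≤-trans p x≤)) p) (ℕ.<⇒≱ (ℕ.n<1+n _))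

  ≤floor : ∀ {x k} → x ≤ (2 ℕ.* B) · ε → k · ε ≤ x → k ℕ.≤ floor x
  ≤floor {x} x≤ p = ≤-largest (multiple? x) {b = 2 ℕ.* B} (·-cancel-≤ 0<ε (≤-trans p x≤)) p

  twice≤ : totalWeight F + totalWeight F ≤ (2 ℕ.* B) · ε
  twice≤ = ≤-trans (+-mono-≤ T≤ T≤) (≤-reflexive (trans (sym (×-homo-+ ε B B))
             (reflexive (≡.cong (λ k → (B ℕ.+ k) · ε) (≡.sym (ℕ.+-identityʳ B))))))

  tour≤ : ∀ r → length (tour r) ≤ (2 ℕ.* B) · ε
  tour≤ r = ≤-trans (≤-sumOver (λ r → length-nonNeg nonNegF (tour r)) (∈-allFin r)) (≤-trans twice twice≤)

  offsetOf : Fin n → ℝ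
  offsetOf v = offset (tour (comp v)) (on v)

  offsetOf≤ : ∀ v → offsetOf v ≤ length (tour (comp v))
  offsetOf≤ v = offset≤ nonNegF (tour (comp v)) (on v)

  0≤offsetOf : ∀ v → 0# ≤ offsetOf v
  0≤offsetOf v = length-nonNeg nonNegF (Split.prefix (split (tour (comp v)) (on v)))

  P : Fin n → ℕ
  P v = floor (offsetOf v)

  N : Fin n → ℕ
  N r = floor (length (tour r))

  P≤N : ∀ v → P v ℕ.≤ N (comp v)
  P≤N v = ≤floor (tour≤ (comp v)) (≤-trans (floor≤ (0≤offsetOf v)) (offsetOf≤ v))

  ∑N≤ : ∑ (allFin n) N ℕ.≤ 2 ℕ.* B
  ∑N≤ = ·-cancel-≤ 0<ε (≤-trans (spread (allFin n)) (≤-trans twice twice≤))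
    where
    spread : ∀ xs → ∑ xs N · ε ≤ sumOver xs (length ∘ tour)
    spread []       = ≤-refl
    spread (r ∷ xs) = ≤-trans (≤-reflexive (×-homo-+ ε (N r) (∑ xs N)))
                        (+-mono-≤ (floor≤ (length-nonNeg nonNegF (tour r))) (spread xs))

  along : ∀ {u v} → comp u ≡ comp v →
          (∃ λ (w : Walk F u v) → offsetOf u + length w ≈ offsetOf v) ⊎
          (∃ λ (w : Walk F v u) → offsetOf v + length w ≈ offsetOf u)
  -- The two memberships refer to the tours of `comp u` and `comp v`; both roots become variables
  -- before they are identified.
  along {u} {v} same = go (comp u) (comp v) same (on u) (on v)
    where
    go : ∀ r r′ → r ≡ r′ → (u∈ : u ∈ vertices (tour r)) (v∈ : v ∈ vertices (tour r′)) →
         (∃ λ (w : Walk F u v) → offset (tour r) u∈ + length w ≈ offset (tour r′) v∈) ⊎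
         (∃ λ (w : Walk F v u) → offset (tour r′) v∈ + length w ≈ offset (tour r) u∈)
    go r _ ≡.refl u∈ v∈ = between (tour r) u∈ v∈

  along-≤ : ∀ {u v} (w : Walk F u v) → offsetOf u + length w ≈ offsetOf v → length w ≤ length (tour (comp v))
  along-≤ {u} {v} w eq = ≤-trans (x≤y+x (0≤offsetOf u)) (≤-trans (≤-reflexive eq) (offsetOf≤ v))

  -- Rounding positions down costs less than one unit, and the successor in the hypothesis pays for
  -- it. Half-open intervals with a common point provide exactly this successor.
  along-floor : ∀ {u v d} (w : Walk F u v) → offsetOf u + length w ≈ offsetOf v →
                suc (P v) ℕ.≤ P u ℕ.+ d → length w ≤ d · ε
  along-floor {u} {v} {d} w eq le = +-cancelˡ-≤ (P u · ε) (begin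
    P u · ε + length w      ≤⟨ +-monoˡ-≤ _ (floor≤ (0≤offsetOf u)) ⟩
    offsetOf u + length w   ≈⟨ eq ⟩
    offsetOf v              ≤⟨ proj₁ (<floor (≤-trans (offsetOf≤ v) (tour≤ (comp v)))) ⟩
    suc (P v) · ε           ≤⟨ ·-monoˡ-≤ 0≤ε le ⟩
    (P u ℕ.+ d) · ε         ≈⟨ ×-homo-+ ε (P u) d ⟩
    P u · ε + d · ε         ∎)
    where open ≤-Reasoning

  close : ∀ {u v d} → comp u ≡ comp v → suc (P v) ℕ.≤ P u ℕ.+ d → suc (P u) ℕ.≤ P v ℕ.+ d →
          ∃ λ (w : Walk E u v) → length w ≤ d · ε
  close same le le′ = case along same of λ
    { (inj₁ (w , eq)) → embed F⊆E w , ≤-trans (≤-reflexive (length-embed F⊆E w)) (along-floor w eq le)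
    ; (inj₂ (w , eq)) → embed F⊆E (reverse w) ,
        ≤-trans (≤-reflexive (trans (length-embed F⊆E (reverse w)) (length-reverse w))) (along-floor w eq le′) }

  shortWalk : ∀ {u v} → Walk F u v → ∃ λ (w : Walk E u v) → length w ≤ length (tour (comp u))
  shortWalk {u} {v} p = case along (connected⇒≡ p) of λ
    { (inj₁ (w , eq)) → embed F⊆E w , ≤-trans (≤-reflexive (length-embed F⊆E w))
                          (≡.subst (λ r → length w ≤ length (tour r)) (≡.sym (connected⇒≡ p)) (along-≤ w eq))
    ; (inj₂ (w , eq)) → embed F⊆E (reverse w) ,
        ≤-trans (≤-reflexive (trans (length-embed F⊆E (reverse w)) (length-reverse w))) (along-≤ w eq) }

  Point : Set
  Point = Fin n × ℕ

  -- Each tour gets twice its length in points, so an interval that starts on the tour and is no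
  -- longer than it fits without wrapping around.
  points : List Point
  points = concatMap (λ r → map (r ,_) (upTo (2 ℕ.* N r))) (allFin n)

  length-points : List.length points ℕ.≤ 4 ℕ.* B
  length-points = begin
    List.length points                      ≡⟨ count (allFin n) ⟩
    ∑ (allFin n) (λ r → 2 ℕ.* N r)          ≡⟨ ∑-*ˡ 2 (allFin n) N ⟩
    2 ℕ.* ∑ (allFin n) N                    ≤⟨ ℕ.*-monoʳ-≤ 2 ∑N≤ ⟩
    2 ℕ.* (2 ℕ.* B)                         ≡⟨ ℕ.*-assoc 2 2 B ⟨
    4 ℕ.* B                                 ∎
    where
    open ℕ.≤-Reasoning
    count : ∀ rs → List.length (concatMap (λ r → map (r ,_) (upTo (2 ℕ.* N r))) rs) ≡ ∑ rs (λ r → 2 ℕ.* N r)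
    count []       = ≡.refl
    count (r ∷ rs) = ≡.trans (List.length-++ (map (r ,_) (upTo (2 ℕ.* N r))))
      (≡.cong₂ ℕ._+_ (≡.trans (List.length-map (r ,_) (upTo (2 ℕ.* N r))) (List.length-applyUpTo id (2 ℕ.* N r))) (count rs))

  On : Fin n → ℕ → Point → Set
  On u δ (r , y) = comp u ≡ r × P u ℕ.≤ y × y ℕ.< P u ℕ.+ δ

  on? : ∀ u δ x → Dec (On u δ x)
  on? u δ (r , y) = (comp u Fin.≟ r) ×-dec (P u ℕ.≤? y) ×-dec (y ℕ.<? P u ℕ.+ δ)

  on-count : ∀ u δ → δ ℕ.≤ N (comp u) → δ ℕ.≤ ∑ points (λ x → ⟦ on? u δ x ⟧)
  on-count u δ δ≤ = begin
    δ                                            ≡⟨ ≡.trans (List.length-map put (upTo δ)) (List.length-applyUpTo id δ) ⟨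
    List.length (map put (upTo δ))               ≤⟨ length-⊆ (Unique.map⁺ (λ e → ℕ.+-cancelˡ-≡ (P u) _ _ (,-injectiveʳ e)) (Unique.upTo⁺ δ)) inside ⟩
    List.length (filter (on? u δ) points)        ≡⟨ ∑-filter-length (on? u δ) points ⟨
    ∑ points (λ x → ⟦ on? u δ x ⟧)               ∎
    where
    open ℕ.≤-Reasoning
    put : ℕ → Point
    put i = comp u , P u ℕ.+ i
    inside : ∀ {x} → x ∈ map put (upTo δ) → x ∈ filter (on? u δ) points
    inside x∈ with ∈-map⁻ put x∈
    ... | i , i∈ , ≡.refl = ∈-filter⁺ (on? u δ)
      (∈-concatMap⁺ (λ r → map (r ,_) (upTo (2 ℕ.* N r))) {xs = allFin n}
        (lose (∈-allFin (comp u)) (∈-map⁺ (comp u ,_) (∈-upTo⁺ (begin-strict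
          P u ℕ.+ i                          <⟨ ℕ.+-monoʳ-< (P u) (∈-upTo⁻ i∈) ⟩
          P u ℕ.+ δ                          ≤⟨ ℕ.+-mono-≤ (P≤N u) δ≤ ⟩
          N (comp u) ℕ.+ N (comp u)          ≡⟨ ≡.cong (N (comp u) ℕ.+_) (ℕ.+-identityʳ _) ⟨
          2 ℕ.* N (comp u)                   ∎)))))
      (≡.refl , ℕ.m≤m+n (P u) i , ℕ.+-monoʳ-< (P u) (∈-upTo⁻ i∈))

  on-close : ∀ {u v δ δ′ x} → On u δ x → On v δ′ x → ∃ λ (w : Walk E u v) → length w ≤ (δ ℕ.⊔ δ′) · ε
  on-close {u} {v} {δ} {δ′} (≡.refl , Pu≤ , <Pu) (same , Pv≤ , <Pv) = close (≡.sym same)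
    (ℕ.≤-trans (ℕ.s≤s Pv≤) (ℕ.≤-trans <Pu (ℕ.+-monoʳ-≤ (P u) (ℕ.m≤m⊔n δ δ′))))
    (ℕ.≤-trans (ℕ.s≤s Pu≤) (ℕ.≤-trans <Pv (ℕ.+-monoʳ-≤ (P v) (ℕ.m≤n⊔m δ δ′))))

-- The bound on the cost in units, for admissible parameters.

module Assembly (R : RealNumbers) {n : ℕ}
                (E F : SteinerForest.Edges R n) (nonNeg : Walks.NonNegative R E)
                (nonNegF : Walks.NonNegative R F) (F⊆E : ∀ {e} → e ∈ F → e ∈ E)
                (ε : RealNumbers.Carrier R) (0<ε : RealNumbers._<_ R (RealNumbers.0# R) ε)
                (K B m J k G ρ s : ℕ) (T≤ : RealNumbers._≤_ R (SteinerForest.totalWeight R F) (OrderedField._·_ R B ε))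
                (2B< : 2 ℕ.* B ℕ.< 2 ℕ.^ (m ℕ.+ J)) (small : K ℕ.* (2 ℕ.* K) ℕ.* 2 ℕ.^ m ℕ.≤ B)
                (1≤k : 1 ℕ.≤ k) (k≤G : k ℕ.≤ G) (8J≤ : 8 ℕ.* J ℕ.≤ 2 ℕ.^ k) (64G≤ : 64 ℕ.* G ℕ.≤ 2 ℕ.^ m)
                (3G<ρ : suc (3 ℕ.* G) ℕ.≤ ρ) (64Gρ≤ : 64 ℕ.* (G ℕ.* ρ) ℕ.≤ 2 ℕ.^ s) (1≤s : 1 ℕ.≤ s)
                (many : 2 ℕ.* (K ℕ.* (2 ℕ.* K) ℕ.* 2 ℕ.^ (m ℕ.+ J)) ℕ.< 2 ℕ.^ G) where
  open SteinerForest R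
  open OrderedField R
  open Walks R
  open Positions R E F nonNegF F⊆E ε 0<ε B T≤
  open Segments R E F nonNeg ε 0<ε m J using (Segment; Dominates; Collapses; Mated; weights; module Segment)
  open Segment

  within : ConnectsWithin ((2 ℕ.^ (m ℕ.+ J)) · ε) F E
  within {u} p = let w , w≤ = shortWalk p in w ,
    ≤-trans (≤-trans w≤ (tour≤ (comp u))) (·-monoˡ-≤ 0≤ε (ℕ.<⇒≤ 2B<)) ,
    λ e → ℕ.<⇒≱ 2B< (·-cancel-≤ 0<ε (≤-trans (≤-reflexive (sym e)) (≤-trans w≤ (tour≤ (comp u)))))

  open Runs R E F nonNeg ε 0<ε m J (2 ℕ.* K) within public

  module _ (segs : List Segment) (dominate : AllPairs Dominates segs)
           (number : List.length segs ℕ.≤ K ℕ.* (2 ℕ.* K)) where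

    M : ℕ
    M = List.length segs

    seg : Fin M → Segment
    seg = List.lookup segs

    ends : Dart M → Fin n
    ends (σ , false) = a (seg σ)
    ends (σ , true)  = b (seg σ)

    potentials : Potentials n M
    potentials = record
      { src = ends ; lev = lev ∘ seg ; ψ = ψ ∘ seg
      ; ψ-src = ψ-a ∘ seg ; ψ-tgt = ψ-b ∘ seg ; ψ-old = AllPairs-lookup dominate }

    open Potentials potentials using (Near)

    walk⇒near : ∀ {u v} (w : Walk E u v) {d} → length w ≤ d · ε → Near d u v
    walk⇒near w {d} w≤ τ = lip (seg τ) (reverse w) d (≤-trans (≤-reflexive (length-reverse w)) w≤) , lip (seg τ) w d w≤

    room≤ : ∀ {v} i → Mated ((2 ℕ.^ i) · ε) v → 2 ℕ.^ i ℕ.≤ N (comp v)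
    room≤ {v} i (v′ , w , far) = let w′ , w′≤ = shortWalk w in
      ≤floor (tour≤ (comp v)) (≤-trans (far w′) w′≤)

    line : Line potentials
    line = record
      { Point = Point ; points = points ; On = On ; on? = on? ; room = N ∘ comp
      ; on-count = on-count
      ; on-near = λ {u} {v} {δ} {δ′} {x} p q → let w , w≤ = on-close {u} {v} {δ} {δ′} {x} p q in walk⇒near w w≤
      ; room-src = λ { (σ , false) → room≤ (lev (seg σ)) (mated-a (seg σ)) ; (σ , true) → room≤ (lev (seg σ)) (mated-b (seg σ)) } }

    W : ℕ
    W = ∑ (allFin M) (λ σ → 2 ℕ.^ lev (seg σ))

    few : 2 ℕ.* W ℕ.< 2 ℕ.^ G
    few = ℕ.≤-<-trans (ℕ.*-monoʳ-≤ 2 (ℕ.≤-trans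
      (∑-≤ (2 ℕ.^ (m ℕ.+ J)) (allFin M) (λ {σ} _ → ℕ.^-monoʳ-≤ 2 (ℕ.<⇒≤ (lev<m+J (seg σ)))))
      (ℕ.*-monoˡ-≤ (2 ℕ.^ (m ℕ.+ J)) (≡.subst (ℕ._≤ K ℕ.* (2 ℕ.* K)) (≡.sym (List.length-tabulate id)) number)))) many

    W≤ : W ℕ.≤ 512 ℕ.* (List.length points ℕ.* ((J ℕ.+ s) ℕ.* (k ℕ.+ s) ℕ.+ s ℕ.* G))
    W≤ = Charging.W≤ potentials (λ σ → walk⇒near (mid (seg σ)) (mid≤ (seg σ))) line m J k G ρ s
           (m≤lev ∘ seg) (lev<m+J ∘ seg) 1≤k k≤G 8J≤ 64G≤ 3G<ρ 64Gρ≤ few {{ℕ.>-nonZero 1≤s}}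

    weights≡ : weights segs ≡ 2 ℕ.* W
    weights≡ = ≡.trans (∑-*ˡ 2 segs (λ σ → 2 ℕ.^ lev σ)) (≡.cong (2 ℕ.*_) (≡.sym (∑-lookup segs (λ σ → 2 ℕ.^ lev σ))))

  -- 512 comes from the charging, 4 from the 4 B points and 2 from rounding lengths up to 2 ^ suc
  -- lev; the successor pays for the short pieces, which cost at most `B` units together.
  factor : ℕ
  factor = suc (2 ℕ.* (512 ℕ.* (4 ℕ.* ((J ℕ.+ s) ℕ.* (k ℕ.+ s) ℕ.+ s ℕ.* G))))

  cost≤ : ∀ {ps : Vec (Fin n × Fin n) K} {cs} {βs : Vec ℝ K} {y} → Greedy₃ E [] [] ps cs →
          Linked (λ x y → y ≤ x) (y ∷ βs) → Pointwise _≤_ cs βs → Pointwise Far ps βs → cost cs ≤ (factor ℕ.* B) · ε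
  cost≤ {cs = cs} greedy noninc cs≤ fars = ≤-trans O.covered (·-monoˡ-≤ 0≤ε (begin
    weights O.segs ℕ.+ K ℕ.* (2 ℕ.* K) ℕ.* 2 ℕ.^ m ≤⟨ ℕ.+-mono-≤ (ℕ.≤-trans (ℕ.≤-reflexive (weights≡ O.segs O.dominate O.number))
                                                    (ℕ.*-monoʳ-≤ 2 (ℕ.≤-trans (W≤ O.segs O.dominate O.number)
                                                      (ℕ.*-monoʳ-≤ 512 (ℕ.*-monoˡ-≤ bnd length-points))))) small ⟩
    2 ℕ.* (512 ℕ.* (4 ℕ.* B ℕ.* bnd)) ℕ.+ B        ≡⟨ regroup 512 4 B bnd ⟩
    factor ℕ.* B                                   ∎))
    where
    open ℕ.≤-Reasoning
    bnd = (J ℕ.+ s) ℕ.* (k ℕ.+ s) ℕ.+ s ℕ.* G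
    module O = Outcome (run {y = _} greedy (λ ()) (λ ()) (λ ()) noninc cs≤ fars ℕ.≤-refl)
    regroup : ∀ c d B x → 2 ℕ.* (c ℕ.* (d ℕ.* B ℕ.* x)) ℕ.+ B ≡ suc (2 ℕ.* (c ℕ.* (d ℕ.* x))) ℕ.* B
    regroup = solve 4 (λ c d B x → con 2 :* (c :* (d :* B :* x)) :+ B := (con 1 :+ con 2 :* (c :* (d :* x))) :* B) ≡.refl
      where open +-*-Solver

-- Choice of the parameters.

2^-cancel-≤ : ∀ {a b} → 2 ℕ.^ a ℕ.≤ 2 ℕ.^ b → a ℕ.≤ b
2^-cancel-≤ le = ℕ.≮⇒≥ λ b<a → ℕ.<⇒≱ (ℕ.^-monoʳ-< 2 (ℕ.s≤s (ℕ.s≤s ℕ.z≤n)) b<a) le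

bracket : ∀ n → 2 ℕ.≤ n → ∃ λ l → 2 ℕ.^ l ℕ.< n × n ℕ.≤ 2 ℕ.^ suc l
bracket 1 (ℕ.s≤s ())
bracket (suc (suc zero)) _ = 0 , ℕ.≤-refl , ℕ.≤-refl
bracket (suc (suc (suc n))) _ with bracket (suc (suc n)) (ℕ.s≤s (ℕ.s≤s ℕ.z≤n))
... | l , lo , hi with suc (suc (suc n)) ℕ.≤? 2 ℕ.^ suc l
...   | yes le = l , ℕ.m≤n⇒m≤1+n lo , le
...   | no gt  = suc l , ℕ.≰⇒> gt , ℕ.≤-trans (ℕ.s≤s hi)
                   (ℕ.+-mono-≤ (ℕ.m^n>0 2 (suc l)) (ℕ.≤-reflexive (≡.sym (ℕ.+-identityʳ _))))

n<2^n : ∀ n → n ℕ.< 2 ℕ.^ n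
n<2^n zero    = ℕ.≤-refl
n<2^n (suc n) = ℕ.+-mono-≤ (ℕ.m^n>0 2 n) (ℕ.≤-trans (n<2^n n) (ℕ.≤-reflexive (≡.sym (ℕ.+-identityʳ _))))

module Parameters (K L l : ℕ) (K≤ : K ℕ.≤ 2 ℕ.^ L) (2≤L : 2 ℕ.≤ L) (1≤l : 1 ℕ.≤ l) (l≤L : l ℕ.≤ L) (L≤ : L ℕ.≤ 2 ℕ.^ l) where
  open import Data.Nat.Base
  open import Data.Nat.Properties
  open +-*-Solver using (solve; _:=_; _:+_; _:*_; con)

  -- `L` and `l` bound log K and log L from above. OPT consists of `B` units, enough to pay for K (2
  -- K) pieces of 2 ^ m units; the `J` levels reach beyond the longest tour, at most 2 B; and 2 ^ G
  -- exceeds twice the mass of K (2 K) segments of top length. The additive constants in `m`, `k`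
  -- and `s` secure `64G≤`, `8J≤` and `64Gρ≤`.
  m J G ρ k s B : ℕ
  m = L + 10
  J = 2 * L + 3
  G = 5 * L + 16
  ρ = suc (3 * G)
  k = l + 6
  s = 2 * l + 16
  B = 2 ^ (L + suc L + m)

  1≤L : 1 ≤ L
  1≤L = ≤-trans (s≤s z≤n) 2≤L

  KK≤ : K * (2 * K) ≤ 2 ^ (L + suc L)
  KK≤ = ≤-trans (*-mono-≤ K≤ (*-monoʳ-≤ 2 K≤)) (≤-reflexive (sym (^-distribˡ-+-* 2 L (suc L))))
    where open ≡ using (sym)

  small : K * (2 * K) * 2 ^ m ≤ B
  small = ≤-trans (*-monoˡ-≤ (2 ^ m) KK≤) (≤-reflexive (≡.sym (^-distribˡ-+-* 2 (L + suc L) m)))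

  2B< : 2 * B < 2 ^ (m + J)
  2B< = ^-monoʳ-< 2 (s≤s (s≤s z≤n)) (≤-reflexive
    (solve 1 (λ L → con 2 :+ (L :+ (con 1 :+ L) :+ (L :+ con 10)) := L :+ con 10 :+ (con 2 :* L :+ con 3)) ≡.refl L))

  many : 2 * (K * (2 * K) * 2 ^ (m + J)) < 2 ^ G
  many = ≤-<-trans (*-monoʳ-≤ 2 (≤-trans (*-monoˡ-≤ (2 ^ (m + J)) KK≤)
           (≤-reflexive (≡.sym (^-distribˡ-+-* 2 (L + suc L) (m + J))))))
         (^-monoʳ-< 2 (s≤s (s≤s z≤n)) (≤-reflexive
           (solve 1 (λ L → con 2 :+ (L :+ (con 1 :+ L) :+ (L :+ con 10 :+ (con 2 :* L :+ con 3))) := con 5 :* L :+ con 16) ≡.refl L)))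

  k≤G : k ≤ G
  k≤G = +-mono-≤ (≤-trans l≤L (m≤n*m L 5)) (m≤m+n 6 10)

  J≤ : J ≤ 5 * L
  J≤ = ≤-trans (+-monoʳ-≤ (2 * L) (*-monoʳ-≤ 3 1≤L)) (≤-reflexive (≡.sym (*-distribʳ-+ L 2 3)))

  8J≤ : 8 * J ≤ 2 ^ k
  8J≤ = begin
    8 * J           ≤⟨ *-monoʳ-≤ 8 (≤-trans J≤ (*-monoˡ-≤ L (m≤m+n 5 3))) ⟩
    8 * (8 * L)     ≡⟨ ≡.trans (≡.sym (*-assoc 8 8 L)) (*-comm 64 L) ⟩
    L * 2 ^ 6       ≤⟨ *-monoˡ-≤ 64 L≤ ⟩
    2 ^ l * 2 ^ 6   ≡⟨ ^-distribˡ-+-* 2 l 6 ⟨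
    2 ^ k           ∎
    where open ≤-Reasoning

  64G≤ : 64 * G ≤ 2 ^ m
  64G≤ = begin
    64 * (5 * L + 16)        ≤⟨ *-monoʳ-≤ 64 (+-monoˡ-≤ 16 (*-monoˡ-≤ L (m≤m+n 5 11))) ⟩
    64 * (16 * L + 16)       ≡⟨ solve 1 (λ L → con 64 :* (con 16 :* L :+ con 16) := (con 1 :+ L) :* con 1024) ≡.refl L ⟩
    suc L * 2 ^ 10           ≤⟨ *-monoˡ-≤ (2 ^ 10) (n<2^n L) ⟩
    2 ^ L * 2 ^ 10           ≡⟨ ^-distribˡ-+-* 2 L 10 ⟨
    2 ^ m                    ∎
    where open ≤-Reasoning

  G≤ : G ≤ 13 * L
  G≤ = ≤-trans (+-monoʳ-≤ (5 * L) (*-monoʳ-≤ 8 2≤L)) (≤-reflexive (≡.sym (*-distribʳ-+ L 5 8)))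

  64Gρ≤ : 64 * (G * ρ) ≤ 2 ^ s
  64Gρ≤ = begin
    64 * (G * ρ)                        ≤⟨ *-monoʳ-≤ 64 (*-mono-≤ G≤′ ρ≤) ⟩
    64 * (16 * 2 ^ l * (64 * 2 ^ l))    ≡⟨ solve 1 (λ x → con 64 :* (con 16 :* x :* (con 64 :* x)) := x :* x :* con 65536) ≡.refl (2 ^ l) ⟩
    2 ^ l * 2 ^ l * 2 ^ 16              ≡⟨ ≡.cong (_* 2 ^ 16) (≡.trans (≡.sym (^-distribˡ-+-* 2 l l)) (≡.cong (λ z → 2 ^ (l + z)) (≡.sym (+-identityʳ l)))) ⟩
    2 ^ (2 * l) * 2 ^ 16                ≡⟨ ^-distribˡ-+-* 2 (2 * l) 16 ⟨
    2 ^ s                               ∎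
    where
    open ≤-Reasoning
    G≤′ : G ≤ 16 * 2 ^ l
    G≤′ = ≤-trans G≤ (*-mono-≤ (m≤m+n 13 3) L≤)
    ρ≤ : ρ ≤ 64 * 2 ^ l
    ρ≤ = ≤-trans (+-monoˡ-≤ (3 * G) (≤-trans (s≤s z≤n) (m≤n+m 16 (5 * L)))) (≤-trans (*-monoʳ-≤ 4 G≤′) (≤-reflexive (≡.sym (*-assoc 4 16 (2 ^ l)))))

  1≤s : 1 ≤ s
  1≤s = ≤-trans (s≤s z≤n) (m≤n+m 16 (2 * l))

  1≤k : 1 ≤ k
  1≤k = ≤-trans (s≤s z≤n) (m≤n+m 6 l)

  s≤ : s ≤ 18 * l
  s≤ = ≤-trans (+-monoʳ-≤ (2 * l) (*-monoʳ-≤ 16 1≤l)) (≤-reflexive (≡.sym (*-distribʳ-+ l 2 16)))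

  load : ℕ
  load = (J + s) * (k + s) + s * G

  -- Each parameter is at most a constant times `L` or `l`, and 809 = 23 · 25 + 18 · 13.
  load≤ : load ≤ 809 * (L * l)
  load≤ = begin
    (J + s) * (k + s) + s * G                 ≤⟨ +-mono-≤ (*-mono-≤ (+-mono-≤ J≤ (≤-trans s≤ (*-monoʳ-≤ 18 l≤L))) (+-mono-≤ k≤ s≤)) (*-mono-≤ s≤ G≤) ⟩
    (5 * L + 18 * L) * (7 * l + 18 * l) + 18 * l * (13 * L) ≡⟨ solve 2 (λ L l → (con 5 :* L :+ con 18 :* L) :* (con 7 :* l :+ con 18 :* l) :+ con 18 :* l :* (con 13 :* L) := con 809 :* (L :* l)) ≡.refl L l ⟩
    809 * (L * l)                             ∎
    where
    open ≤-Reasoning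
    k≤ : k ≤ 7 * l
    k≤ = +-monoʳ-≤ l (*-monoʳ-≤ 6 1≤l)

  scaled : ∀ c d x y → x ≤ d * y → 1 ≤ y → suc (c * x) ≤ suc (c * d) * y
  scaled c d x y x≤ 1≤y = +-mono-≤ 1≤y (≤-trans (*-monoʳ-≤ c x≤) (≤-reflexive (≡.sym (*-assoc c d y))))

abstract
  bound : ∃ λ c → 1 ℕ.≤ c × (∀ K L l K≤ 2≤L 1≤l l≤L L≤ → let open Parameters K L l K≤ 2≤L 1≤l l≤L L≤ in
          suc (2 ℕ.* (512 ℕ.* (4 ℕ.* load))) ℕ.≤ c ℕ.* (L ℕ.* l))
  bound = suc (4096 ℕ.* 809) , ℕ.s≤s ℕ.z≤n , λ K L l K≤ 2≤L 1≤l l≤L L≤ →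
    let open Parameters K L l K≤ 2≤L 1≤l l≤L L≤ in
    ℕ.≤-trans (ℕ.≤-reflexive (≡.cong suc (assoc load)))
      (scaled 4096 809 load (L ℕ.* l) load≤ (ℕ.*-mono-≤ 1≤L 1≤l))
    where
    assoc : ∀ x → 2 ℕ.* (512 ℕ.* (4 ℕ.* x)) ≡ 4096 ℕ.* x
    assoc x = ≡.trans (≡.cong (2 ℕ.*_) (≡.sym (ℕ.*-assoc 512 4 x))) (≡.sym (ℕ.*-assoc 2 2048 x))

-- Bounds on the iterated logarithm defined by suprema.

module Logarithm (R : RealNumbers) where
  open OrderedField R
  open SemiringMult semiring using (×1-homo-*)

  fromℕ-+ : ∀ a b → fromℕ (a ℕ.+ b) ≈ fromℕ a + fromℕ b
  fromℕ-+ = ×-homo-+ 1#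

  fromℕ-^ : ∀ a b → fromℕ a ^ b ≈ fromℕ (a ℕ.^ b)
  fromℕ-^ a zero    = sym (+-identityʳ 1#)
  fromℕ-^ a (suc b) = trans (*-congˡ (fromℕ-^ a b)) (sym (×1-homo-* a (a ℕ.^ b)))

  0<1 : 0# < 1#
  0<1 = 0≤1 , 0≉1

  fromℕ-mono-≤ : ∀ {a b} → a ℕ.≤ b → fromℕ a ≤ fromℕ b
  fromℕ-mono-≤ = ·-monoˡ-≤ 0≤1

  fromℕ-cancel-≤ : ∀ {a b} → fromℕ a ≤ fromℕ b → a ℕ.≤ b
  fromℕ-cancel-≤ = ·-cancel-≤ 0<1

  0≤fromℕ : ∀ a → 0# ≤ fromℕ a
  0≤fromℕ a = ·-nonNeg a 0≤1

  ^-nonNeg : ∀ n {x} → 0# ≤ x → 0# ≤ x ^ n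
  ^-nonNeg zero    h = 0≤1
  ^-nonNeg (suc n) h = *-nonNegative h (^-nonNeg n h)

  ^-mono-≤ : ∀ n {x y} → 0# ≤ x → x ≤ y → x ^ n ≤ y ^ n
  ^-mono-≤ zero    0≤x h = ≤-refl
  ^-mono-≤ (suc n) 0≤x h = *-mono-≤ (≤-trans 0≤x h) (^-nonNeg n 0≤x) h (^-mono-≤ n 0≤x h)

  ·-cancelˡ-≤ : ∀ m {x y} → suc m · x ≤ suc m · y → x ≤ y
  ·-cancelˡ-≤ m {x} {y} h with total x y
  ... | inj₁ p = p
  ... | inj₂ y≤x = +-cancelʳ-≤ (m · y) (≤-trans (+-monoʳ-≤ x (·-monoʳ-≤ m y≤x)) h)

  Candidate : ℝ → ℝ → Set
  Candidate x r = Σ ℕ λ a → Σ ℕ λ b → Σ ℕ λ q →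
    (fromℕ (suc q) * r ≈ fromℕ a - fromℕ b) × (fromℕ 2 ^ a ≤ fromℕ 2 ^ b * x ^ suc q)

  -- With q + 1 as the denominator, 2 ^ a ≤ 2 ^ b x ^ (q + 1) ≤ 2 ^ ((q + 1) N + b) gives a - b ≤ (q
  -- + 1) N. This is the upper bound without which `sup` carries no information.
  candidate-≤ : ∀ {x} N → 0# ≤ x → x ≤ fromℕ (2 ℕ.^ N) → ∀ r → Candidate x r → r ≤ fromℕ N
  candidate-≤ {x} N 0≤x x≤ r (a , b , q , eq , le) = ·-cancelˡ-≤ q (begin
    suc q · r                        ≈⟨ fromℕ-* (suc q) r ⟨
    fromℕ (suc q) * r                ≈⟨ eq ⟩
    fromℕ a - fromℕ b                ≤⟨ +-monoˡ-≤ _ (fromℕ-mono-≤ a≤) ⟩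
    fromℕ (suc q ℕ.* N ℕ.+ b) - fromℕ b ≈⟨ +-congʳ (fromℕ-+ (suc q ℕ.* N) b) ⟩
    fromℕ (suc q ℕ.* N) + fromℕ b - fromℕ b ≈⟨ trans (+-assoc _ _ _) (trans (+-congˡ (-‿inverseʳ _)) (+-identityʳ _)) ⟩
    fromℕ (suc q ℕ.* N)              ≈⟨ ×1-homo-* (suc q) N ⟩
    fromℕ (suc q) * fromℕ N          ≈⟨ fromℕ-* (suc q) (fromℕ N) ⟩
    suc q · fromℕ N                  ∎)
    where
    open ≤-Reasoning
    a≤ : a ℕ.≤ suc q ℕ.* N ℕ.+ b
    a≤ = 2^-cancel-≤ (fromℕ-cancel-≤ (begin
      fromℕ (2 ℕ.^ a)                              ≈⟨ fromℕ-^ 2 a ⟨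
      fromℕ 2 ^ a                                  ≤⟨ le ⟩
      fromℕ 2 ^ b * x ^ suc q                      ≤⟨ *-monoˡ-≤ (^-nonNeg b (0≤fromℕ 2)) (^-mono-≤ (suc q) 0≤x x≤) ⟩
      fromℕ 2 ^ b * fromℕ (2 ℕ.^ N) ^ suc q        ≈⟨ *-cong (fromℕ-^ 2 b) (fromℕ-^ (2 ℕ.^ N) (suc q)) ⟩
      fromℕ (2 ℕ.^ b) * fromℕ ((2 ℕ.^ N) ℕ.^ suc q) ≈⟨ ×1-homo-* (2 ℕ.^ b) ((2 ℕ.^ N) ℕ.^ suc q) ⟨
      fromℕ (2 ℕ.^ b ℕ.* (2 ℕ.^ N) ℕ.^ suc q)      ≡⟨ ≡.cong fromℕ exponents ⟩
      fromℕ (2 ℕ.^ (suc q ℕ.* N ℕ.+ b))            ∎))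
      where
      exponents : 2 ℕ.^ b ℕ.* (2 ℕ.^ N) ℕ.^ suc q ≡ 2 ℕ.^ (suc q ℕ.* N ℕ.+ b)
      exponents = ≡.trans (≡.cong (2 ℕ.^ b ℕ.*_) (≡.trans (ℕ.^-*-assoc 2 N (suc q)) (≡.cong (2 ℕ.^_) (ℕ.*-comm N (suc q)))))
        (≡.trans (ℕ.*-comm (2 ℕ.^ b) (2 ℕ.^ (suc q ℕ.* N))) (≡.sym (ℕ.^-distribˡ-+-* 2 (suc q ℕ.* N) b)))

  ≤-log₂ : ∀ {x r} N → 0# ≤ x → x ≤ fromℕ (2 ℕ.^ N) → Candidate x r → r ≤ log₂ x
  ≤-log₂ {x} {r} N 0≤x x≤ c = sup-upperBound (Candidate x) (r , c) (fromℕ N , candidate-≤ N 0≤x x≤) r c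

  log₂-≤ : ∀ {x r} N → 0# ≤ x → x ≤ fromℕ (2 ℕ.^ N) → Candidate x r → log₂ x ≤ fromℕ N
  log₂-≤ {x} {r} N 0≤x x≤ c = sup-least (Candidate x) (r , c) (fromℕ N) (candidate-≤ N 0≤x x≤)

  power-candidate : ∀ {x} a → fromℕ (2 ℕ.^ a) ≤ x → Candidate x (fromℕ a)
  power-candidate {x} a h = a , 0 , 0 ,
    trans (*-congʳ (+-identityʳ 1#)) (trans (*-identityˡ _) (sym (trans (+-congˡ -0≈0) (+-identityʳ _)))) ,
    ≤-trans (≤-reflexive (fromℕ-^ 2 a)) (≤-trans h (≤-reflexive (sym (trans (*-identityˡ _) (*-identityʳ x)))))
    where
    -0≈0 : - 0# ≈ 0#
    -0≈0 = trans (sym (+-identityˡ _)) (-‿inverseʳ 0#)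

  half : ∃ λ h → fromℕ 2 * h ≈ 1#
  half = inverse (fromℕ 2) (λ e → 1≰0 (begin
    1#       ≤⟨ x≤x+y (0≤fromℕ 1) ⟩
    fromℕ 2  ≈⟨ e ⟩
    0#       ∎))
    where open ≤-Reasoning

  -- The exponent a / 2 is tested on the square of `x`; integer exponents are too coarse for the
  -- iterated logarithm of 3.
  halves-candidate : ∀ {x} a → fromℕ (2 ℕ.^ a) ≤ x * x → Candidate x (fromℕ a * proj₁ half)
  halves-candidate {x} a h = a , 0 , 1 ,
    trans (trans (*-congˡ (*-comm _ _)) (trans (sym (*-assoc _ _ _)) (trans (*-congʳ (proj₂ half)) (*-identityˡ _))))
      (sym (trans (+-congˡ (trans (sym (+-identityˡ _)) (-‿inverseʳ 0#))) (+-identityʳ _))) ,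
    ≤-trans (≤-reflexive (fromℕ-^ 2 a)) (≤-trans h (≤-reflexive (sym (trans (*-identityˡ _) (*-congˡ (*-identityʳ x))))))

  double-half : ∀ x → x * proj₁ half + x * proj₁ half ≈ x
  double-half x = begin
    x * h + x * h         ≈⟨ distribˡ x h h ⟨
    x * (h + h)           ≈⟨ *-congˡ (+-congˡ (sym (+-identityʳ h))) ⟩
    x * (2 · h)           ≈⟨ *-congˡ (fromℕ-* 2 h) ⟨
    x * (fromℕ 2 * h)     ≈⟨ *-congˡ (proj₂ half) ⟩
    x * 1#                ≈⟨ *-identityʳ x ⟩
    x                     ∎
    where
    open import Relation.Binary.Reasoning.Setoid setoid
    h = proj₁ half

  module _ (k l l′ : ℕ) (3≤k : 3 ℕ.≤ k) (2^l<k : 2 ℕ.^ l ℕ.< k) (k≤ : k ℕ.≤ 2 ℕ.^ suc l)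
           (2^l′< : 2 ℕ.^ l′ ℕ.< suc l) (≤2^l′ : suc l ℕ.≤ 2 ℕ.^ suc l′) (1≤l : 1 ℕ.≤ l) where

    y z : ℝ
    y = log₂ (fromℕ k)
    z = log₂ y

    l≤y : fromℕ l ≤ y
    l≤y = ≤-log₂ (suc l) (0≤fromℕ k) (fromℕ-mono-≤ k≤) (power-candidate l (fromℕ-mono-≤ (ℕ.<⇒≤ 2^l<k)))

    0≤y : 0# ≤ y
    0≤y = ≤-trans (0≤fromℕ l) l≤y

    y≤ : y ≤ fromℕ (2 ℕ.^ suc l′)
    y≤ = ≤-trans (log₂-≤ (suc l) (0≤fromℕ k) (fromℕ-mono-≤ k≤) (power-candidate l (fromℕ-mono-≤ (ℕ.<⇒≤ 2^l<k))))
                 (fromℕ-mono-≤ ≤2^l′)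

    L≤2y : fromℕ (suc l) ≤ y + y
    L≤2y = ≤-trans (fromℕ-mono-≤ (ℕ.+-monoˡ-≤ l 1≤l)) (≤-trans (≤-reflexive (fromℕ-+ l l)) (+-mono-≤ l≤y l≤y))

    -- log₂ 3 ≥ 3/2 and (3/2)² ≥ 2.
    z-small : 1# ≤ z + z
    z-small = ≤-trans (≤-reflexive (sym (trans (double-half (fromℕ 1)) (+-identityʳ 1#)))) (+-mono-≤ half≤z half≤z)
      where
      open ≤-Reasoning
      w = fromℕ 3 * proj₁ half
      w≤y : w ≤ y
      w≤y = ≤-log₂ (suc l) (0≤fromℕ k) (fromℕ-mono-≤ k≤) (halves-candidate 3 (begin
        fromℕ 8            ≤⟨ fromℕ-mono-≤ (ℕ.≤-trans (ℕ.n≤1+n 8) (ℕ.*-mono-≤ 3≤k 3≤k)) ⟩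
        fromℕ (k ℕ.* k)    ≈⟨ ×1-homo-* k k ⟩
        fromℕ k * fromℕ k  ∎))
      3≤2y : fromℕ 3 ≤ y + y
      3≤2y = ≤-trans (≤-reflexive (sym (double-half (fromℕ 3)))) (+-mono-≤ w≤y w≤y)
      2y≈ : y + y ≈ fromℕ 2 * y
      2y≈ = trans (+-congˡ (sym (+-identityʳ y))) (sym (fromℕ-* 2 y))
      2≤yy : fromℕ 2 ≤ y * y
      2≤yy = ·-cancelˡ-≤ 3 (begin
        4 · fromℕ 2                    ≈⟨ ×-assocˡ 1# 4 2 ⟩
        fromℕ 8                        ≤⟨ fromℕ-mono-≤ (ℕ.n≤1+n 8) ⟩
        fromℕ (3 ℕ.* 3)                ≈⟨ ×1-homo-* 3 3 ⟩
        fromℕ 3 * fromℕ 3              ≤⟨ *-mono-≤ (≤-trans (0≤fromℕ 3) 3≤2y) (0≤fromℕ 3) 3≤2y 3≤2y ⟩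
        (y + y) * (y + y)              ≈⟨ *-cong 2y≈ 2y≈ ⟩
        (fromℕ 2 * y) * (fromℕ 2 * y)  ≈⟨ interchange (fromℕ 2) y (fromℕ 2) y ⟩
        (fromℕ 2 * fromℕ 2) * (y * y)  ≈⟨ *-congʳ (×1-homo-* 2 2) ⟨
        fromℕ 4 * (y * y)              ≈⟨ fromℕ-* 4 (y * y) ⟩
        4 · (y * y)                    ∎)
        where open CommutativeSemigroupProperties *-commutativeSemigroup using (interchange)
      half≤z : fromℕ 1 * proj₁ half ≤ z
      half≤z = ≤-log₂ (suc l′) 0≤y y≤ (halves-candidate 1 2≤yy)

    l′≤z : fromℕ l′ ≤ z
    l′≤z = ≤-log₂ (suc l′) 0≤y y≤ (power-candidate l′ (≤-trans (fromℕ-mono-≤ (ℕ.≤-pred 2^l′<)) l≤y))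

    -- If `l′` is 0, then `k` is 3 or 4 and `l′≤z` says only that `z` is nonnegative, so `z-small`
    -- takes over; otherwise suc l′ ≤ 2 l′.
    ℓ≤2z : fromℕ (suc l′) ≤ z + z
    ℓ≤2z with l′ ℕ.≟ 0
    ... | yes e = ≤-trans (≤-reflexive (reflexive (≡.cong (fromℕ ∘ suc) e))) (≤-trans (≤-reflexive (+-identityʳ 1#)) z-small)
    ... | no ne = ≤-trans (fromℕ-mono-≤ (ℕ.+-monoˡ-≤ l′ (ℕ.n≢0⇒n>0 ne))) (≤-trans (≤-reflexive (fromℕ-+ l′ l′)) (+-mono-≤ l′≤z l′≤z))

    product-≤ : ∀ c T → 0# ≤ T → (c ℕ.* (suc l ℕ.* suc l′)) · T ≤ fromℕ c * (fromℕ 2 * fromℕ 2) * y * z * T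
    product-≤ c T 0≤T = begin
      (c ℕ.* (suc l ℕ.* suc l′)) · T                           ≈⟨ fromℕ-* (c ℕ.* (suc l ℕ.* suc l′)) T ⟨
      fromℕ (c ℕ.* (suc l ℕ.* suc l′)) * T                     ≈⟨ *-congʳ (trans (×1-homo-* c _) (*-congˡ (×1-homo-* (suc l) (suc l′)))) ⟩
      fromℕ c * (fromℕ (suc l) * fromℕ (suc l′)) * T           ≤⟨ *-mono-≤ 0≤′ 0≤T (*-monoˡ-≤ (0≤fromℕ c) (*-mono-≤ 0≤2y (0≤fromℕ (suc l′)) L≤2y ℓ≤2z)) ≤-refl ⟩
      fromℕ c * ((y + y) * (z + z)) * T                        ≈⟨ *-congʳ (*-congˡ (trans (*-cong (2x≈ y) (2x≈ z)) (interchange (fromℕ 2) y (fromℕ 2) z))) ⟩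
      fromℕ c * ((fromℕ 2 * fromℕ 2) * (y * z)) * T            ≈⟨ *-congʳ (trans (sym (*-assoc _ _ _)) (sym (*-assoc _ y z))) ⟩
      fromℕ c * (fromℕ 2 * fromℕ 2) * y * z * T                ∎
      where
      open ≤-Reasoning
      open CommutativeSemigroupProperties *-commutativeSemigroup using (interchange)
      0≤2y : 0# ≤ y + y
      0≤2y = ≤-trans (0≤fromℕ (suc l)) L≤2y
      0≤′ : 0# ≤ fromℕ c * ((y + y) * (z + z))
      0≤′ = *-nonNegative (0≤fromℕ c) (*-nonNegative 0≤2y (≤-trans (0≤fromℕ (suc l′)) ℓ≤2z))
      2x≈ : ∀ x → x + x ≈ fromℕ 2 * x
      2x≈ x = trans (+-congˡ (sym (+-identityʳ x))) (sym (fromℕ-* 2 x))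

-- Instances, the choice of the unit and the conclusion.

module Competitive (R : RealNumbers) where
  open OrderedField R
  open SteinerForest R
  open Walks R

  module _ {n : ℕ} {E : Edges n} (nonNeg : NonNegative E) where

    Within : Fin n × Fin n → ℝ → Set
    Within (s , t) c = ∀ (w : Walk E s t) → c ≤ length w

    -- Every walk of the original graph remains available to the algorithm after shortcuts have been
    -- added.
    greedy≤ : ∀ {k seen S} {ps : Vec (Fin n × Fin n) k} {cs : Vec ℝ k} → Greedy₃ E seen S ps cs →
              (∀ {e} → e ∈ S → weight e ≈ 0#) → Pointwise Within ps cs
    greedy≤ done free = []
    greedy≤ {seen = seen} {S} (serve p best rest) free =
      (λ w → ≤-trans (shortest-≤ nonNeg′ best (embed ∈-++⁺ˡ w)) (≤-reflexive (length-embed ∈-++⁺ˡ w))) ∷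
      greedy≤ rest free′
      where
      nonNeg′ : NonNegative (E ++ S)
      nonNeg′ = All.tabulate (λ i → case ∈-++⁻ E i of λ
        { (inj₁ j) → All.lookup nonNeg j ; (inj₂ j) → ≤-reflexive (sym (free j)) })
      free′ : ∀ {e} → e ∈ rule₃ seen p ++ S → weight e ≈ 0#
      free′ e∈ with ∈-++⁻ (rule₃ seen p) e∈
      ... | inj₂ j = free j
      ... | inj₁ j with ∈-map⁻ shortcut j
      ...   | _ , _ , ≡.refl = refl

    distances-within : ∀ {k} {ps : Vec (Fin n × Fin n) k} {ds : Vec ℝ k} → Pointwise (uncurry (IsDistance E)) ps ds → Pointwise Within ps ds
    distances-within [] = []
    distances-within ((p , best , d≈) ∷ rest) = (λ w → ≤-trans (≤-reflexive d≈) (shortest-≤ nonNeg best w)) ∷ distances-within rest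

    costs≤distances : ∀ {k} {ps : Vec (Fin n × Fin n) k} {cs ds : Vec ℝ k} → Pointwise Within ps cs →
                      Pointwise (uncurry (IsDistance E)) ps ds → Pointwise _≤_ cs ds
    costs≤distances [] [] = []
    costs≤distances (c≤ ∷ cs≤) ((p , _ , d≈) ∷ ds) = ≤-trans (c≤ p) (≤-reflexive (sym d≈)) ∷ costs≤distances cs≤ ds

  module _ {n K : ℕ} (I : Instance n K) (F : Edges n) (feasible : Feasible I F) where
    E : Edges n
    E = edges (graph I)

    nonNegE : NonNegative E
    nonNegE = nonNegative (graph I)

    F⊆E : ∀ {e} → e ∈ F → e ∈ E
    F⊆E = Sublist.lookup (proj₁ feasible)

    nonNegF : NonNegative F
    nonNegF = All.tabulate (λ i → All.lookup nonNegE (F⊆E i))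

    T : ℝ
    T = totalWeight F

    0≤T : 0# ≤ T
    0≤T = go nonNegF
      where
      go : ∀ {F} → NonNegative F → 0# ≤ totalWeight F
      go []       = ≤-refl
      go (p ∷ ps) = 0≤+ p (go ps)

    free : ∀ {e : Edge n} → e ∈ [] → weight e ≈ 0#
    free ()

    -- β is whichever of the two sequences is non-increasing.
    record Schedule (cs : Vec ℝ K) : Set where
      field
        βs     : Vec ℝ K
        top    : ℝ
        noninc : Linked (λ x y → y ≤ x) (top ∷ βs)
        cs≤βs  : Pointwise _≤_ cs βs
        βs≤    : Pointwise (Within nonNegE) (pairs I) βs

    withTop : ∀ {k} {xs : Vec ℝ k} → NonIncreasing xs → ∃ λ y → Linked (λ x y → y ≤ x) (y ∷ xs)
    withTop {xs = []}     _ = 0# , [-]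
    withTop {xs = x ∷ xs} h = x , ≤-refl ∷ h

    schedule : ∀ {cs ds} → IsGreedy₃Run I cs → AreDistances I ds → NonIncreasing cs ⊎ NonIncreasing ds → Schedule cs
    schedule {cs} run dist (inj₁ h) = record
      { βs = cs ; top = _ ; noninc = proj₂ (withTop h) ; cs≤βs = Pointwise.refl ≤-refl
      ; βs≤ = greedy≤ nonNegE run free }
    schedule {ds = ds} run dist (inj₂ h) = record
      { βs = ds ; top = _ ; noninc = proj₂ (withTop h)
      ; cs≤βs = costs≤distances nonNegE (greedy≤ nonNegE run free) dist
      ; βs≤ = distances-within nonNegE dist }

    module _ {cs : Vec ℝ K} (run : IsGreedy₃Run I cs) where

      -- Every served pair is joined by a tour of length 2 T.
      cost-free : T ≤ 0# → cost cs ≤ 0#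
      cost-free T≤0 = go (greedy≤ nonNegE run free) (proj₂ feasible)
        where
        -- As T ≤ 0, the unit 1 with B = 0 is admissible, and the tours have length at most 0.
        open Positions R E F nonNegF F⊆E 1# (0≤1 , 0≉1) 0 T≤0 using (shortWalk; tour≤; comp)
        go : ∀ {k} {ps : Vec (Fin n × Fin n) k} {cs : Vec ℝ k} → Pointwise (Within nonNegE) ps cs →
             VecAll.All (uncurry (Connected F)) ps → cost cs ≤ 0#
        go [] [] = ≤-refl
        go (_∷_ {x = s , t} c≤ cs≤) (p ∷ conn) = ≤-trans (+-mono-≤ (let w , w≤ = shortWalk p in
          ≤-trans (c≤ w) (≤-trans w≤ (tour≤ (comp s)))) (go cs≤ conn)) (≤-reflexive (+-identityˡ 0#))

      module _ (S : Schedule cs) (L l : ℕ) (K≤ : K ℕ.≤ 2 ℕ.^ L) (2≤L : 2 ℕ.≤ L) (1≤l : 1 ℕ.≤ l) (l≤L : l ℕ.≤ L)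
               (L≤ : L ℕ.≤ 2 ℕ.^ l) (T≰0 : ¬ (T ≤ 0#)) where
        open Schedule S
        open Parameters K L l K≤ 2≤L 1≤l l≤L L≤

        1≤fromB : 1# ≤ fromℕ B
        1≤fromB = ≤-trans (≤-reflexive (sym (+-identityʳ 1#))) (·-monoˡ-≤ 0≤1 (ℕ.m^n>0 2 (L ℕ.+ suc L ℕ.+ m)))

        B⁻¹ : ∃ λ x → fromℕ B * x ≈ 1#
        B⁻¹ = inverse (fromℕ B) (λ e → 1≰0 (≤-trans 1≤fromB (≤-reflexive e)))

        0≤B⁻¹ : 0# ≤ proj₁ B⁻¹
        0≤B⁻¹ = case total 0# (proj₁ B⁻¹) of λ
          { (inj₁ h) → h
          ; (inj₂ h) → contradiction (≤-trans (≤-reflexive (sym (proj₂ B⁻¹)))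
              (≤-trans (*-monoˡ-≤ (≤-trans 0≤1 1≤fromB) h) (≤-reflexive (zeroʳ _)))) 1≰0 }

        -- Normalised so that OPT is exactly `B` units.
        ε : ℝ
        ε = T * proj₁ B⁻¹

        Bε≈T : B · ε ≈ T
        Bε≈T = begin
          B · ε                          ≈⟨ fromℕ-* B ε ⟨
          fromℕ B * (T * proj₁ B⁻¹)      ≈⟨ *-congˡ (*-comm _ _) ⟩
          fromℕ B * (proj₁ B⁻¹ * T)      ≈⟨ *-assoc _ _ _ ⟨
          fromℕ B * proj₁ B⁻¹ * T        ≈⟨ *-congʳ (proj₂ B⁻¹) ⟩
          1# * T                         ≈⟨ *-identityˡ T ⟩
          T                              ∎
          where open import Relation.Binary.Reasoning.Setoid setoid

        0<ε : 0# < ε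
        0<ε = *-nonNegative 0≤T 0≤B⁻¹ , λ e → T≰0 (≤-reflexive (trans (sym Bε≈T)
                (trans (×-congʳ B (sym e)) (trans (sym (fromℕ-* B 0#)) (zeroʳ _)))))

        open Assembly R E F nonNegE nonNegF F⊆E ε 0<ε K B m J k G ρ s
               (≤-reflexive (sym Bε≈T)) 2B< small 1≤k k≤G 8J≤ 64G≤ ℕ.≤-refl 64Gρ≤ 1≤s many
               using (cost≤; Far)

        fars : ∀ {j} {ps : Vec (Fin n × Fin n) j} {βs : Vec ℝ j} → VecAll.All (uncurry (Connected F)) ps →
               Pointwise (Within nonNegE) ps βs → Pointwise Far ps βs
        fars []         []       = []
        fars (p ∷ conn) (c ∷ cs) = (p , c) ∷ fars conn cs

        cost-bound : cost cs ≤ (proj₁ bound ℕ.* (L ℕ.* l)) · T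
        cost-bound = begin
          cost cs                                       ≤⟨ cost≤ run noninc cs≤βs (fars (proj₂ feasible) βs≤) ⟩
          (suc (2 ℕ.* (512 ℕ.* (4 ℕ.* load))) ℕ.* B) · ε ≤⟨ ·-monoˡ-≤ (proj₁ 0<ε) (ℕ.*-monoˡ-≤ B (proj₂ (proj₂ bound) K L l K≤ 2≤L 1≤l l≤L L≤)) ⟩
          (proj₁ bound ℕ.* (L ℕ.* l) ℕ.* B) · ε         ≈⟨ ×-assocˡ ε (proj₁ bound ℕ.* (L ℕ.* l)) B ⟨
          (proj₁ bound ℕ.* (L ℕ.* l)) · (B · ε)         ≈⟨ ×-congʳ (proj₁ bound ℕ.* (L ℕ.* l)) Bε≈T ⟩
          (proj₁ bound ℕ.* (L ℕ.* l)) · T               ∎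
          where open ≤-Reasoning

theorem1p3 : (R : RealNumbers) →
    let open RealNumbers R renaming (Carrier to ℝ)
        open SteinerForest R
    in Σ ℝ λ C → (0# < C) ×
       (∀ (n k : ℕ) → 3 ℕ.≤ k →
        (I : Instance n k) (cs ds : Vec ℝ k) (F : Edges n) →
        IsGreedy₃Run I cs → AreDistances I ds → IsOPT I F →
        NonIncreasing cs ⊎ NonIncreasing ds →
        cost cs ≤ C * log₂ (fromℕ k) * log₂ (log₂ (fromℕ k)) * totalWeight F)
theorem1p3 R = C , (0≤C , C≉0) , competitive
  where
  open OrderedField R
  open SteinerForest R
  open Logarithm R
  open Competitive R

  -- The two factors 2 pay for rounding log k and log log k up to integers.
  C : ℝ
  C = fromℕ (proj₁ bound) * (fromℕ 2 * fromℕ 2)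

  1≤C : 1# ≤ C
  1≤C = begin
    1#                                ≈⟨ trans (*-identityˡ _) (*-identityˡ 1#) ⟨
    1# * (1# * 1#)                    ≤⟨ *-mono-≤ (0≤fromℕ (proj₁ bound)) (*-nonNegative 0≤1 0≤1) 1≤c (*-mono-≤ (0≤fromℕ 2) 0≤1 1≤2 1≤2) ⟩
    C                                 ∎
    where
    open ≤-Reasoning
    1≤c : 1# ≤ fromℕ (proj₁ bound)
    1≤c = ≤-trans (≤-reflexive (sym (+-identityʳ 1#))) (fromℕ-mono-≤ (proj₁ (proj₂ bound)))
    1≤2 : 1# ≤ fromℕ 2
    1≤2 = x≤x+y (0≤fromℕ 1)

  0≤C : 0# ≤ C
  0≤C = ≤-trans 0≤1 1≤C

  C≉0 : ¬ (0# ≈ C)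
  C≉0 e = 1≰0 (≤-trans 1≤C (≤-reflexive (sym e)))

  competitive : ∀ (n k : ℕ) → 3 ℕ.≤ k → (I : Instance n k) (cs ds : Vec ℝ k) (F : Edges n) →
                IsGreedy₃Run I cs → AreDistances I ds → IsOPT I F → NonIncreasing cs ⊎ NonIncreasing ds →
                cost cs ≤ C * log₂ (fromℕ k) * log₂ (log₂ (fromℕ k)) * totalWeight F
  competitive n k 3≤k I cs ds F run dist (feasible , _) mono with bracket k (ℕ.≤-trans (ℕ.n≤1+n 2) 3≤k)
  ... | zero , _ , k≤2 = contradiction (ℕ.≤-trans 3≤k k≤2) (ℕ.<-irrefl ≡.refl)
  ... | suc l₀ , 2^l<k , k≤ with bracket (suc (suc l₀)) (ℕ.s≤s (ℕ.s≤s ℕ.z≤n))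
  ...   | l′ , 2^l′< , ≤2^l′ with totalWeight F ≤? 0#
  -- The unit T / B is positive only for positive T, so weight zero is settled separately.
  ...     | yes T≤0 = ≤-trans (cost-free I F feasible run T≤0)
                        (≤-trans (·-nonNeg (proj₁ bound ℕ.* (suc (suc l₀) ℕ.* suc l′)) (0≤T I F feasible))
                          (product-≤ k (suc l₀) l′ 3≤k 2^l<k k≤ 2^l′< ≤2^l′ (ℕ.s≤s ℕ.z≤n) (proj₁ bound) _ (0≤T I F feasible)))
  ...     | no T≰0  = ≤-trans
                        (cost-bound I F feasible run (schedule I F feasible run dist mono) (suc (suc l₀)) (suc l′)
                          k≤ (ℕ.s≤s (ℕ.s≤s ℕ.z≤n)) (ℕ.s≤s ℕ.z≤n) (ℕ.≤-trans (n<2^n l′) (ℕ.<⇒≤ 2^l′<)) ≤2^l′ T≰0)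
                        (product-≤ k (suc l₀) l′ 3≤k 2^l<k k≤ 2^l′< ≤2^l′ (ℕ.s≤s ℕ.z≤n) (proj₁ bound) _ (0≤T I F feasible))
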